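{- Let $L$ be a number field, $h(x)$ a monic, irreducible polynomial in $\mathcal{O}_L[x]$, and $\eta$ a root of $h(x)$. Suppose $\mathfrak{p}$ is a prime of $L$ above the rational prime $p$ such that $\mathfrak{p}\mid\Delta_h$. Let $M$ be a finite extension of $L$ such that $h(x)$ is irreducible over $M$. If $\mathfrak{p}$ is ramified in $M$, then $p\mid[\mathcal{O}_{M(\eta)}:\mathcal{O}_M[\eta]]$.
   Context: $\mathcal{O}_F$ denotes the ring of integers of a number field $F$, and $\Delta_h$ denotes the discriminant of the polynomial $h$. The bracket $[\mathcal{O}_{M(\eta)}:\mathcal{O}_M[\eta]]$ denotes the index of $\mathcal{O}_M[\eta]$ in $\mathcal{O}_{M(\eta)}$. -}

module Defs where

open import Level using (Level; _⊔_) renaming (suc to lsuc)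
open import Algebra.Bundles using (CommutativeRing; AbelianGroup; RawRing; RawSemiring; Semiring)
open import Algebra.Structures using (IsCommutativeRing)
open import Algebra.Morphism.Structures using (module RingMorphisms)
import Algebra.Definitions.RawSemiring as RawSemiringDefs
import Algebra.Morphism.RingMonomorphism as RingMono
import Algebra.Properties.Ring as RingProperties
import Algebra.Properties.Semiring.Mult as SemiringMult
import Algebra.Solver.Ring as RingSolver
open import Algebra.Solver.Ring.AlmostCommutativeRing
  using (fromCommutativeRing; _-Raw-AlmostCommutative⟶_)
open import Data.Empty using (⊥-elim)
open import Data.Fin.Base using (Fin; zero; suc; toℕ; fromℕ; inject₁; opposite; punchIn; splitAt)
open import Data.Fin.Properties using (fromℕ≢inject₁; inject₁-injective)
open import Data.Integer.Base as ℤ using (ℤ; +_; -[1+_]; _⊖_)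
import Data.Integer.Divisibility as ℤᵈ
import Data.Integer.Properties as ℤₚ
import Data.Nat.Properties as ℕₚ
open import Data.List.Base using (List; []; _∷_; _++_; map; foldr; replicate; length; lookup)
open import Data.Maybe.Base using (Maybe; just; nothing)
open import Data.Nat.Base as ℕ using (ℕ; zero; suc; _<_; s≤s; z≤n; _∸_)
open import Data.Nat.DivMod using (_/_)
open import Data.Product using (Σ; ∃; ∃-syntax; _×_; _,_; proj₁; proj₂)
import Data.Rational.Properties as ℚₚ
open import Data.Sign.Base as Sign using (Sign)
open import Data.Sum.Base using (_⊎_; [_,_]′)
open import Data.Unit.Polymorphic using (⊤)
open import Function.Base using (_∘_)
open import Function.Bundles using (_⇔_)
open import Relation.Binary.PropositionalEquality as ≡ using (_≡_; _≢_)
open import Relation.Nullary using (¬_; yes; no)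
open import Relation.Unary using (Pred; _∈_; _≐_)

record RingHom {a ℓ₁ b ℓ₂} (R : CommutativeRing a ℓ₁) (S : CommutativeRing b ℓ₂) :
               Set (a ⊔ ℓ₁ ⊔ b ⊔ ℓ₂) where
  private
    module R = CommutativeRing R
    module S = CommutativeRing S
  open RingMorphisms R.rawRing S.rawRing using (IsRingHomomorphism)
  field
    fun                : R.Carrier → S.Carrier
    isRingHomomorphism : IsRingHomomorphism fun
  open IsRingHomomorphism isRingHomomorphism public

record Field (c ℓ : Level) : Set (lsuc (c ⊔ ℓ)) where
  field
    ring : CommutativeRing c ℓ
  open CommutativeRing ring hiding (zero)
  field
    1≉0        : ¬ (1# ≈ 0#)
    invertible : ∀ x → ¬ (x ≈ 0#) → ∃[ y ] x * y ≈ 1#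

module _ {a ℓ₁ b ℓ₂} {K : CommutativeRing a ℓ₁} {F : CommutativeRing b ℓ₂} (φ : RingHom K F) where
  private
    module K = CommutativeRing K
    module F = CommutativeRing F
  open RawSemiringDefs (Semiring.rawSemiring F.semiring) using (sum)
  open RingHom φ using (fun)

  combination : ∀ {n} → (Fin n → K.Carrier) → (Fin n → F.Carrier) → F.Carrier
  combination k b = sum (λ i → fun (k i) F.* b i)

  IsBasis : ∀ {n} → (Fin n → F.Carrier) → Set (a ⊔ ℓ₁ ⊔ b ⊔ ℓ₂)
  IsBasis b = ∀ x → ∃[ k ] (x F.≈ combination k b
                          × (∀ k′ → x F.≈ combination k′ b → ∀ i → k i K.≈ k′ i))

  FiniteExtension : Set (a ⊔ ℓ₁ ⊔ b ⊔ ℓ₂)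
  FiniteExtension = ∃[ n ] Σ (Fin n → F.Carrier) IsBasis

record NumberField (c ℓ : Level) : Set (lsuc (c ⊔ ℓ)) where
  field
    𝔽      : Field c ℓ
  open Field 𝔽 public
  field
    fromℚ  : RingHom ℚₚ.+-*-commutativeRing ring
    finite : FiniteExtension fromℚ

-- A polynomial is the list of its coefficients, constant term first;
-- trailing zeros are allowed and are ignored by _≈ₚ_.

module Polynomials {a ℓ} (R : CommutativeRing a ℓ) where
  open CommutativeRing R hiding (zero)

  Polynomial : Set a
  Polynomial = List Carrier

  coeff : Polynomial → ℕ → Carrier
  coeff []      _       = 0#
  coeff (c ∷ f) zero    = c
  coeff (c ∷ f) (suc k) = coeff f k

  infix  4 _≈ₚ_
  infixl 6 _+ₚ_
  infixl 7 _*ₚ_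

  _≈ₚ_ : Polynomial → Polynomial → Set ℓ
  f ≈ₚ g = ∀ k → coeff f k ≈ coeff g k

  _+ₚ_ : Polynomial → Polynomial → Polynomial
  []      +ₚ g       = g
  (c ∷ f) +ₚ []      = c ∷ f
  (c ∷ f) +ₚ (d ∷ g) = (c + d) ∷ (f +ₚ g)

  _*ₚ_ : Polynomial → Polynomial → Polynomial
  []      *ₚ g = []
  (c ∷ f) *ₚ g = map (c *_) g +ₚ (0# ∷ f *ₚ g)

  polynomialSemiring : RawSemiring a ℓ
  polynomialSemiring = record
    { Carrier = Polynomial ; _≈_ = _≈ₚ_ ; _+_ = _+ₚ_ ; _*_ = _*ₚ_ ; 0# = [] ; 1# = 1# ∷ [] }

  open RawSemiringDefs polynomialSemiring public using (Irreducible)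

  Monic : ℕ → Polynomial → Set ℓ
  Monic n f = coeff f n ≈ 1# × (∀ k → n < k → coeff f k ≈ 0#)

  -- (c + x f)′ = f + x f′
  derivative : Polynomial → Polynomial
  derivative []      = []
  derivative (c ∷ f) = f +ₚ (0# ∷ derivative f)

  open RawSemiringDefs (Semiring.rawSemiring semiring) using (sum; _^_)

  -- Laplace expansion along the first row.
  det : ∀ {n} → (Fin n → Fin n → Carrier) → Carrier
  det {zero}  A = 1#
  det {suc n} A =
    sum (λ j → (- 1#) ^ toℕ j * (A zero j * det (λ i k → A (suc i) (punchIn j k))))

  -- The Sylvester matrix of f (of degree m) and g (of degree l): its
  -- rows are the coefficients, highest degree (m + l - 1) first, of
  --   x^(l-1) f , … , x f , f , x^(m-1) g , … , x g , g.
  sylvester : ∀ m l → Polynomial → Polynomial → Fin (l ℕ.+ m) → Fin (l ℕ.+ m) → Carrier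
  sylvester m l f g i j = coeff ([ shift f , shift g ]′ (splitAt l i)) (toℕ (opposite j))
    where
    shift : ∀ {k} → Polynomial → Fin k → Polynomial
    shift q r = replicate (toℕ (opposite r)) 0# ++ q

  resultant : ℕ → ℕ → Polynomial → Polynomial → Carrier
  resultant m l f g = det (sylvester m l f g)

  -- The discriminant (-1)^(n(n-1)/2) Res(f, f′) of a polynomial f that
  -- is monic of degree n.
  discriminant : ℕ → Polynomial → Carrier
  discriminant n f = (- 1#) ^ (n ℕ.* (n ∸ 1) / 2) * resultant n (n ∸ 1) f (derivative f)

-- Value at x ∈ R of a polynomial whose coefficients are sent to R by φ.
module _ {a ℓ} (R : CommutativeRing a ℓ) where
  open CommutativeRing R hiding (zero)

  eval : ∀ {b} {A : Set b} → (A → Carrier) → List A → Carrier → Carrier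
  eval φ f x = foldr (λ c r → φ c + x * r) 0# f

module Ideals {a ℓ} (R : CommutativeRing a ℓ) where
  open CommutativeRing R hiding (zero)

  record Ideal : Set (lsuc (a ⊔ ℓ)) where
    field
      member   : Pred Carrier (a ⊔ ℓ)
      resp     : ∀ {x y} → x ≈ y → x ∈ member → y ∈ member
      0∈       : 0# ∈ member
      +-closed : ∀ {x y} → x ∈ member → y ∈ member → x + y ∈ member
      *-closed : ∀ r {x} → x ∈ member → r * x ∈ member

  open Ideal using (member)

  infix 4 _∈ᴵ_ _≐ᴵ_ _∣ᴵ_

  _∈ᴵ_ : Carrier → Ideal → Set (a ⊔ ℓ)
  x ∈ᴵ I = x ∈ member I

  _≐ᴵ_ : Ideal → Ideal → Set (a ⊔ ℓ)
  I ≐ᴵ J = member I ≐ member J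

  data Span {I : Set (a ⊔ ℓ)} (g : I → Carrier) : Carrier → Set (a ⊔ ℓ) where
    gen   : ∀ i → Span g (g i)
    resp  : ∀ {x y} → x ≈ y → Span g x → Span g y
    null  : Span g 0#
    add   : ∀ {x y} → Span g x → Span g y → Span g (x + y)
    scale : ∀ r {x} → Span g x → Span g (r * x)

  ⟨_⟩ : {I : Set (a ⊔ ℓ)} → (I → Carrier) → Ideal
  ⟨ g ⟩ = record
    { member = Span g ; resp = resp ; 0∈ = null ; +-closed = add ; *-closed = scale }

  principal : Carrier → Ideal
  principal x = ⟨ (λ (_ : ⊤ {a ⊔ ℓ}) → x) ⟩

  infixl 7 _·_
  infixr 8 _^ᴵ_

  _·_ : Ideal → Ideal → Ideal
  I · J = ⟨ (λ (((x , _) , (y , _)) : ∃ (member I) × ∃ (member J)) → x * y) ⟩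

  _^ᴵ_ : Ideal → ℕ → Ideal
  I ^ᴵ zero  = principal 1#
  I ^ᴵ suc n = I · I ^ᴵ n

  ∏ : ∀ {k} → (Fin k → Ideal) → Ideal
  ∏ {zero}  I = principal 1#
  ∏ {suc k} I = I zero · ∏ (I ∘ suc)

  _∣ᴵ_ : Ideal → Ideal → Set (lsuc (a ⊔ ℓ))
  I ∣ᴵ J = ∃[ K ] J ≐ᴵ I · K

  record IsNonzeroPrime (P : Ideal) : Set (a ⊔ ℓ) where
    field
      nonzero : ∃[ x ] (x ∈ᴵ P × ¬ (x ≈ 0#))
      proper  : ¬ (1# ∈ᴵ P)
      prime   : ∀ {x y} → x * y ∈ᴵ P → x ∈ᴵ P ⊎ y ∈ᴵ P

  record PrimeFactorisation (I : Ideal) : Set (lsuc (a ⊔ ℓ)) where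
    field
      size     : ℕ
      P        : Fin size → Ideal
      e        : Fin size → ℕ
      isPrime  : ∀ i → IsNonzeroPrime (P i)
      distinct : ∀ i j → P i ≐ᴵ P j → i ≡ j
      positive : ∀ i → 0 < e i
      product  : I ≐ᴵ ∏ (λ i → P i ^ᴵ e i)

module _ {a ℓ} {R S : CommutativeRing a ℓ} where
  private
    module R = Ideals R
    module S = Ideals S

  extend : (CommutativeRing.Carrier R → CommutativeRing.Carrier S) → R.Ideal → S.Ideal
  extend φ I = S.⟨ (λ ((x , _) : ∃ (R.Ideal.member I)) → φ x) ⟩

module FromInteger {a ℓ} (R : CommutativeRing a ℓ) where
  open CommutativeRing R hiding (zero)
  open SemiringMult semiring using (×-homo-+; ×1-homo-*) renaming (_×_ to _⨯_)
  open RingProperties (CommutativeRing.ring R)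
    using (-‿+-comm; -0#≈0#; -‿distribˡ-*; -‿distribʳ-*; -‿involutive)
  open import Relation.Binary.Reasoning.Setoid setoid

  fromℤ : ℤ → Carrier
  fromℤ (+ n)    = n ⨯ 1#
  fromℤ -[1+ n ] = - (suc n ⨯ 1#)

  fromℤ-⊖ : ∀ m n → fromℤ (m ⊖ n) ≈ m ⨯ 1# - n ⨯ 1#
  fromℤ-⊖ m       zero    = sym (trans (+-congˡ -0#≈0#) (+-identityʳ _))
  fromℤ-⊖ zero    (suc n) = sym (+-identityˡ _)
  fromℤ-⊖ (suc m) (suc n) = begin
    fromℤ (suc m ⊖ suc n)                  ≡⟨ ≡.cong fromℤ (ℤₚ.[1+m]⊖[1+n]≡m⊖n m n) ⟩
    fromℤ (m ⊖ n)                          ≈⟨ fromℤ-⊖ m n ⟩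
    m ⨯ 1# - n ⨯ 1#                        ≈⟨ +-congʳ (+-identityˡ _) ⟨
    (0# + m ⨯ 1#) - n ⨯ 1#                 ≈⟨ +-congʳ (+-congʳ (-‿inverseʳ 1#)) ⟨
    ((1# - 1#) + m ⨯ 1#) - n ⨯ 1#          ≈⟨ +-congʳ (+-assoc _ _ _) ⟩
    (1# + (- 1# + m ⨯ 1#)) - n ⨯ 1#        ≈⟨ +-congʳ (+-congˡ (+-comm _ _)) ⟩
    (1# + (m ⨯ 1# - 1#)) - n ⨯ 1#          ≈⟨ +-congʳ (+-assoc _ _ _) ⟨
    ((1# + m ⨯ 1#) - 1#) - n ⨯ 1#          ≈⟨ +-assoc _ _ _ ⟩
    (1# + m ⨯ 1#) + (- 1# + - (n ⨯ 1#))    ≈⟨ +-congˡ (-‿+-comm _ _) ⟩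
    (1# + m ⨯ 1#) - (1# + n ⨯ 1#)          ∎

  fromℤ-+ : ∀ i j → fromℤ (i ℤ.+ j) ≈ fromℤ i + fromℤ j
  fromℤ-+ (+ m)    (+ n)    = ×-homo-+ 1# m n
  fromℤ-+ (+ m)    -[1+ n ] = fromℤ-⊖ m (suc n)
  fromℤ-+ -[1+ m ] (+ n)    = trans (fromℤ-⊖ n (suc m)) (+-comm _ _)
  fromℤ-+ -[1+ m ] -[1+ n ] = begin
    - (suc (suc (m ℕ.+ n)) ⨯ 1#)    ≡⟨ ≡.cong (λ k → - (suc k ⨯ 1#)) (ℕₚ.+-suc m n) ⟨
    - ((suc m ℕ.+ suc n) ⨯ 1#)      ≈⟨ -‿cong (×-homo-+ 1# (suc m) (suc n)) ⟩
    - (suc m ⨯ 1# + suc n ⨯ 1#)     ≈⟨ -‿+-comm _ _ ⟨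
    - (suc m ⨯ 1#) - suc n ⨯ 1#     ∎

  fromℤ-neg : ∀ i → fromℤ (ℤ.- i) ≈ - fromℤ i
  fromℤ-neg (+ zero)  = sym -0#≈0#
  fromℤ-neg (+ suc n) = refl
  fromℤ-neg -[1+ n ]  = sym (-‿involutive _)

  fromℤ-+◃ : ∀ n → fromℤ (Sign.+ ℤ.◃ n) ≈ n ⨯ 1#
  fromℤ-+◃ zero    = refl
  fromℤ-+◃ (suc n) = refl

  fromℤ--◃ : ∀ n → fromℤ (Sign.- ℤ.◃ n) ≈ - (n ⨯ 1#)
  fromℤ--◃ zero    = sym -0#≈0#
  fromℤ--◃ (suc n) = refl

  fromℤ-* : ∀ i j → fromℤ (i ℤ.* j) ≈ fromℤ i * fromℤ j
  fromℤ-* (+ m)    (+ n)    = trans (fromℤ-+◃ (m ℕ.* n)) (×1-homo-* m n)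
  fromℤ-* (+ m)    -[1+ n ] = begin
    fromℤ (Sign.- ℤ.◃ m ℕ.* suc n)  ≈⟨ fromℤ--◃ (m ℕ.* suc n) ⟩
    - ((m ℕ.* suc n) ⨯ 1#)          ≈⟨ -‿cong (×1-homo-* m (suc n)) ⟩
    - (m ⨯ 1# * (suc n ⨯ 1#))       ≈⟨ -‿distribʳ-* _ _ ⟩
    m ⨯ 1# * - (suc n ⨯ 1#)         ∎
  fromℤ-* -[1+ m ] (+ n)    = begin
    fromℤ (Sign.- ℤ.◃ suc m ℕ.* n)  ≈⟨ fromℤ--◃ (suc m ℕ.* n) ⟩
    - ((suc m ℕ.* n) ⨯ 1#)          ≈⟨ -‿cong (×1-homo-* (suc m) n) ⟩
    - (suc m ⨯ 1# * (n ⨯ 1#))       ≈⟨ -‿distribˡ-* _ _ ⟩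
    - (suc m ⨯ 1#) * (n ⨯ 1#)       ∎
  fromℤ-* -[1+ m ] -[1+ n ] = begin
    (suc m ℕ.* suc n) ⨯ 1#            ≈⟨ ×1-homo-* (suc m) (suc n) ⟩
    suc m ⨯ 1# * (suc n ⨯ 1#)         ≈⟨ -‿involutive _ ⟨
    - - (suc m ⨯ 1# * (suc n ⨯ 1#))   ≈⟨ -‿cong (-‿distribʳ-* _ _) ⟩
    - (suc m ⨯ 1# * - (suc n ⨯ 1#))   ≈⟨ -‿distribˡ-* _ _ ⟩
    - (suc m ⨯ 1#) * - (suc n ⨯ 1#)   ∎

  fromℤ-1 : fromℤ (+ 1) ≈ 1#
  fromℤ-1 = +-identityʳ 1#

  fromℤ-morphism :
    CommutativeRing.rawRing ℤₚ.+-*-commutativeRing -Raw-AlmostCommutative⟶ fromCommutativeRing R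
  fromℤ-morphism = record
    { ⟦_⟧ = fromℤ ; +-homo = fromℤ-+ ; *-homo = fromℤ-* ; -‿homo = fromℤ-neg
    ; 0-homo = refl ; 1-homo = fromℤ-1 }

module _ {a ℓ₁ b ℓ₂} {R : CommutativeRing a ℓ₁} {S : CommutativeRing b ℓ₂} (φ : RingHom R S) where
  private
    module R = CommutativeRing R
    module S = CommutativeRing S
    module ℤR = FromInteger R
    module ℤS = FromInteger S
  open RingHom φ using (fun; +-homo; *-homo; 0#-homo; 1#-homo; -‿homo; ⟦⟧-cong)
  open SemiringMult R.semiring using () renaming (_×_ to _⨯ᴿ_)
  open SemiringMult S.semiring using () renaming (_×_ to _⨯ˢ_)

  hom-⨯1 : ∀ n → fun (n ⨯ᴿ R.1#) S.≈ n ⨯ˢ S.1#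
  hom-⨯1 zero    = 0#-homo
  hom-⨯1 (suc n) = S.trans (+-homo _ _) (S.+-cong 1#-homo (hom-⨯1 n))

  hom-fromℤ : ∀ i → fun (ℤR.fromℤ i) S.≈ ℤS.fromℤ i
  hom-fromℤ (+ n)    = hom-⨯1 n
  hom-fromℤ -[1+ n ] = S.trans (-‿homo _) (S.-‿cong (hom-⨯1 (suc n)))

  hom-eval : ∀ f x → fun (eval R ℤR.fromℤ f x) S.≈ eval S ℤS.fromℤ f (fun x)
  hom-eval []      x = 0#-homo
  hom-eval (c ∷ f) x = S.trans (+-homo _ _)
    (S.+-cong (hom-fromℤ c) (S.trans (*-homo _ _) (S.*-congˡ (hom-eval f x))))

module _ {a ℓ p} (R : CommutativeRing a ℓ) (P : Pred (CommutativeRing.Carrier R) p) where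
  open CommutativeRing R hiding (zero)

  record IsSubring : Set (a ⊔ p) where
    field
      +-closed : ∀ {x y} → P x → P y → P (x + y)
      *-closed : ∀ {x y} → P x → P y → P (x * y)
      -‿closed : ∀ {x} → P x → P (- x)
      0-closed : P 0#
      1-closed : P 1#

  module _ (S : IsSubring) where
    open IsSubring S
    open RingMorphisms using (IsRingMonomorphism)

    rawSubring : RawRing (a ⊔ p) ℓ
    rawSubring = record
      { Carrier = Σ Carrier P
      ; _≈_     = λ x y → proj₁ x ≈ proj₁ y
      ; _+_     = λ (x , px) (y , py) → x + y , +-closed px py
      ; _*_     = λ (x , px) (y , py) → x * y , *-closed px py
      ; -_      = λ (x , px) → - x , -‿closed px
      ; 0#      = 0# , 0-closed
      ; 1#      = 1# , 1-closed
      }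

    subring-inclusion : IsRingMonomorphism rawSubring rawRing proj₁
    subring-inclusion = record
      { isRingHomomorphism = record
        { isSemiringHomomorphism = record
          { isNearSemiringHomomorphism = record
            { +-isMonoidHomomorphism = record
              { isMagmaHomomorphism = record
                { isRelHomomorphism = record { cong = λ eq → eq }
                ; homo = λ _ _ → refl }
              ; ε-homo = refl }
            ; *-homo = λ _ _ → refl }
          ; 1#-homo = refl }
        ; -‿homo = λ _ → refl }
      ; injective = λ eq → eq }

    open RawRing rawSubring using ()
      renaming (_≈_ to _≈ₛ_; _+_ to _+ₛ_; _*_ to _*ₛ_; -_ to -ₛ_; 0# to 0ₛ; 1# to 1ₛ)

    -- Abstract, as are the closure proofs for 𝒪 below, only to keep the
    -- conversion checker from unfolding proofs.
    abstract
      subring-isCommutativeRing : IsCommutativeRing _≈ₛ_ _+ₛ_ _*ₛ_ -ₛ_ 0ₛ 1ₛ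
      subring-isCommutativeRing = RingMono.isCommutativeRing subring-inclusion isCommutativeRing

    subring : CommutativeRing (a ⊔ p) ℓ
    subring = record { isCommutativeRing = subring-isCommutativeRing }

module Integral {c ℓ} (R : CommutativeRing c ℓ) where
  open CommutativeRing R hiding (zero)
  open RawSemiringDefs (Semiring.rawSemiring semiring) using (_^_; sum)
  open FromInteger R
  open Polynomials ℤₚ.+-*-commutativeRing using (Polynomial; coeff; Monic)
  open import Relation.Binary.Reasoning.Setoid setoid
  open RingProperties (CommutativeRing.ring R) using (-1*x≈-x; -‿distribˡ-*)

  IsIntegral : Pred Carrier ℓ
  IsIntegral x = Σ Polynomial λ f → ∃[ n ] (Monic n f × eval R fromℤ f x ≈ 0#)

  -- The rest of this module proves that the integral elements form a
  -- subring.  They are the elements z stabilising some finitely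
  -- generated subgroup of R that contains 1; a monic equation for such
  -- a z comes from eliminating unknowns, without division, in the
  -- linear system expressing z * vᵢ through the generators vⱼ.

  private
    coeff≟ : ∀ i j → Maybe (fromℤ i ≈ fromℤ j)
    coeff≟ i j with i ℤₚ.≟ j
    ... | yes eq = just (reflexive (≡.cong fromℤ eq))
    ... | no  _  = nothing

  open RingSolver (CommutativeRing.rawRing ℤₚ.+-*-commutativeRing) (fromCommutativeRing R)
                  fromℤ-morphism coeff≟
    using (solve; _:=_; _:+_; _:*_; :-_; _:-_; con)

  record IsSubgroup {s} (C : Pred Carrier s) : Set (c ⊔ ℓ ⊔ s) where
    field
      resp     : ∀ {x y} → x ≈ y → C x → C y
      0∈       : C 0#
      +-closed : ∀ {x y} → C x → C y → C (x + y)

  data Int (x : Carrier) : Set ℓ where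
    int : ∀ i → x ≈ fromℤ i → Int x

  Int-isSubgroup : IsSubgroup Int
  Int-isSubgroup = record
    { resp     = λ { eq (int i p) → int i (trans (sym eq) p) }
    ; 0∈       = int (+ 0) refl
    ; +-closed = λ { (int i p) (int j q) → int (i ℤ.+ j) (trans (+-cong p q) (sym (fromℤ-+ i j))) }
    }

  Int-* : ∀ {x y} → Int x → Int y → Int (x * y)
  Int-* (int i p) (int j q) = int (i ℤ.* j) (trans (*-cong p q) (sym (fromℤ-* i j)))

  Int-neg : ∀ {x} → Int x → Int (- x)
  Int-neg (int i p) = int (ℤ.- i) (trans (-‿cong p) (sym (fromℤ-neg i)))

  Int-1 : Int 1#
  Int-1 = int (+ 1) (sym fromℤ-1)

  -- Deg< C x d is the set of all c₀ + c₁ x + … with d coefficients cᵢ ∈ C.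
  data Deg< {s} (C : Pred Carrier s) (x : Carrier) : ℕ → Carrier → Set (c ⊔ ℓ ⊔ s) where
    nil  : ∀ {w} → w ≈ 0# → Deg< C x 0 w
    cons : ∀ {d w b w′} → C b → Deg< C x d w′ → w ≈ b + x * w′ → Deg< C x (suc d) w

  module _ {s} {C : Pred Carrier s} (C-sub : IsSubgroup C) {x : Carrier} where
    private module C = IsSubgroup C-sub

    deg-resp : ∀ {d u w} → u ≈ w → Deg< C x d u → Deg< C x d w
    deg-resp eq (nil p)      = nil (trans (sym eq) p)
    deg-resp eq (cons b u p) = cons b u (trans (sym eq) p)

    deg-0 : ∀ d → Deg< C x d 0#
    deg-0 zero    = nil refl
    deg-0 (suc d) = cons C.0∈ (deg-0 d) (solve 1 (λ x → con (+ 0) := con (+ 0) :+ x :* con (+ 0)) refl x)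

    deg-+ : ∀ {d u w} → Deg< C x d u → Deg< C x d w → Deg< C x d (u + w)
    deg-+ (nil p) (nil q) = nil (trans (+-cong p q) (+-identityˡ _))
    deg-+ (cons {b = a} {u} ca du p) (cons {b = b} {w} cb dw q) =
      cons (C.+-closed ca cb) (deg-+ du dw) (trans (+-cong p q)
        (solve 5 (λ a b u w x → (a :+ x :* u) :+ (b :+ x :* w) := (a :+ b) :+ x :* (u :+ w))
          refl a b u w x))

    deg-isSubgroup : ∀ d → IsSubgroup (Deg< C x d)
    deg-isSubgroup d = record { resp = deg-resp ; 0∈ = deg-0 d ; +-closed = deg-+ }

    deg-const : ∀ {d b} → C b → Deg< C x (suc d) b
    deg-const {d} {b} cb = cons cb (deg-0 d) (solve 2 (λ b x → b := b :+ x :* con (+ 0)) refl b x)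

    deg-pad : ∀ {d u} → Deg< C x d u → Deg< C x (suc d) u
    deg-pad (nil p)      = deg-resp (sym p) (deg-0 1)
    deg-pad (cons b u p) = cons b (deg-pad u) p

    deg-shift : ∀ {d u} → Deg< C x d u → Deg< C x (suc d) (x * u)
    deg-shift du = cons C.0∈ du (sym (+-identityˡ _))

    deg-pad+ : ∀ e {d u} → Deg< C x d u → Deg< C x (e ℕ.+ d) u
    deg-pad+ zero    du = du
    deg-pad+ (suc e) du = deg-pad (deg-pad+ e du)

    deg-shift+ : ∀ e {d u} → Deg< C x d u → Deg< C x (e ℕ.+ d) (x ^ e * u)
    deg-shift+ zero    du = deg-resp (sym (*-identityˡ _)) du
    deg-shift+ (suc e) {u = u} du =
      deg-resp (sym (*-assoc x (x ^ e) u)) (deg-shift (deg-shift+ e du))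

    deg-scale : ∀ r → (∀ {b} → C b → C (r * b)) → ∀ {d u} → Deg< C x d u → Deg< C x d (r * u)
    deg-scale r rC (nil p) = nil (trans (*-congˡ p) (zeroʳ r))
    deg-scale r rC (cons {b = b} {u} cb du p) =
      cons (rC cb) (deg-scale r rC du) (trans (*-congˡ p)
        (solve 4 (λ r b u x → r :* (b :+ x :* u) := r :* b :+ x :* (r :* u)) refl r b u x))

    deg-top : ∀ d {u} → Deg< C x (suc d) u →
              ∃[ b ] ∃[ w ] (C b × Deg< C x d w × u ≈ w + x ^ d * b)
    deg-top zero (cons {b = b} {w} cb (nil q) p) = b , 0# , cb , nil refl , (begin
      _             ≈⟨ p ⟩
      b + x * w     ≈⟨ +-congˡ (*-congˡ q) ⟩
      b + x * 0#    ≈⟨ solve 2 (λ b x → b :+ x :* con (+ 0) := con (+ 0) :+ b) refl b x ⟩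
      0# + b        ≈⟨ +-congˡ (*-identityˡ b) ⟨
      0# + 1# * b   ∎)
    deg-top (suc d) (cons {b = a} {u} ca du p) with deg-top d du
    ... | b , w , cb , dw , q = b , a + x * w , cb , cons ca dw refl , (begin
      _                             ≈⟨ p ⟩
      a + x * u                     ≈⟨ +-congˡ (*-congˡ q) ⟩
      a + x * (w + x ^ d * b)       ≈⟨ solve 5 (λ a x w y b → a :+ x :* (w :+ y :* b) := (a :+ x :* w) :+ (x :* y) :* b)
                                         refl a x w (x ^ d) b ⟩
      (a + x * w) + (x * x ^ d) * b ∎)

  deg-* : ∀ {s t} {A : Pred Carrier s} {C : Pred Carrier t} → IsSubgroup C →
          (∀ {a b} → A a → C b → C (a * b)) →
          ∀ {x d e u w} → Deg< A x d u → Deg< C x e w → Deg< C x (d ℕ.+ e) (u * w)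
  deg-* C-sub AC {e = e} {w = w} (nil p) dw =
    deg-resp C-sub (sym (trans (*-congʳ p) (zeroˡ w))) (deg-0 C-sub e)
  deg-* C-sub AC {x} {suc d} {e} {w = w} (cons {b = a} {u} ca du p) dw =
    deg-resp C-sub
      (trans (solve 4 (λ a x u w → a :* w :+ x :* (u :* w) := (a :+ x :* u) :* w) refl a x u w)
             (*-congʳ (sym p)))
      (deg-+ C-sub (deg-pad+ C-sub (suc d) (deg-scale C-sub a (AC ca) dw))
                   (deg-shift C-sub (deg-* C-sub AC du dw)))

  deg-*ʳ : ∀ {s t} {A : Pred Carrier s} {C : Pred Carrier t} → IsSubgroup C →
           (∀ {a b} → A a → C b → C (a * b)) →
           ∀ {x d u b} → Deg< A x d u → C b → Deg< C x d (u * b)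
  deg-*ʳ C-sub AC {b = b} (nil p) cb = nil (trans (*-congʳ p) (zeroˡ b))
  deg-*ʳ C-sub AC {x} {b = b} (cons {b = a} {u} ca du p) cb =
    cons (AC ca cb) (deg-*ʳ C-sub AC du cb) (trans (*-congʳ p)
      (solve 4 (λ a x u b → (a :+ x :* u) :* b := a :* b :+ x :* (u :* b)) refl a x u b))

  -- Monic polynomial expressions of degree d in x with integer coefficients.
  record Mon (x : Carrier) (d : ℕ) (w : Carrier) : Set (c ⊔ ℓ) where
    constructor mon
    field
      {rest} : Carrier
      lower  : Deg< Int x d rest
      value  : w ≈ x ^ d + rest

  ^-+ : ∀ x d e → x ^ (d ℕ.+ e) ≈ x ^ d * x ^ e
  ^-+ x zero    e = sym (*-identityˡ _)
  ^-+ x (suc d) e = trans (*-congˡ (^-+ x d e)) (sym (*-assoc _ _ _))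

  private
    deg-neg : ∀ {x d u} → Deg< Int x d u → Deg< Int x d (- u)
    deg-neg {u = u} du = deg-resp Int-isSubgroup (-1*x≈-x u)
      (deg-scale Int-isSubgroup (- 1#) (Int-* (Int-neg Int-1)) du)

    deg-swap : ∀ {x u} d e → Deg< Int x (d ℕ.+ e) u → Deg< Int x (e ℕ.+ d) u
    deg-swap {x} {u} d e = ≡.subst (λ k → Deg< Int x k u) (ℕₚ.+-comm d e)

  mon-deg-* : ∀ {x d e u w} → Mon x d u → Deg< Int x e w → Deg< Int x (d ℕ.+ e) (u * w)
  mon-deg-* {x} {d} {w = w} (mon {r} dr p) dw =
    deg-resp Int-isSubgroup (trans (sym (distribʳ w (x ^ d) r)) (*-congʳ (sym p)))
      (deg-+ Int-isSubgroup (deg-shift+ Int-isSubgroup d dw) (deg-* Int-isSubgroup Int-* dr dw))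

  mon-* : ∀ {x d e u w} → Mon x d u → Mon x e w → Mon x (d ℕ.+ e) (u * w)
  mon-* {x} {d} {e} {u} {w} mu@(mon {r} dr p) (mon {s} ds q) = mon
    (deg-+ Int-isSubgroup (deg-swap e d (deg-shift+ Int-isSubgroup e dr)) (mon-deg-* mu ds))
    (begin
      u * w                                  ≈⟨ *-congˡ q ⟩
      u * (x ^ e + s)                        ≈⟨ distribˡ _ _ _ ⟩
      u * x ^ e + u * s                      ≈⟨ +-congʳ (*-congʳ p) ⟩
      (x ^ d + r) * x ^ e + u * s            ≈⟨ solve 4 (λ a r b t → (a :+ r) :* b :+ t := a :* b :+ (b :* r :+ t))
                                                  refl (x ^ d) r (x ^ e) (u * s) ⟩
      x ^ d * x ^ e + (x ^ e * r + u * s)    ≈⟨ +-congʳ (^-+ x d e) ⟨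
      x ^ (d ℕ.+ e) + (x ^ e * r + u * s)    ∎)

  mon-sub : ∀ {x d u w} → Mon x d u → Deg< Int x d w → Mon x d (u - w)
  mon-sub (mon dr p) dw = mon (deg-+ Int-isSubgroup dr (deg-neg dw))
    (trans (+-congʳ p) (+-assoc _ _ _))

  mon→poly : ∀ {z} d {r} → Deg< Int z d r →
             Σ Polynomial λ f → Monic d f × eval R fromℤ f z ≈ z ^ d + r
  mon→poly {z} zero {r} (nil p) =
    (+ 1 ∷ []) , (≡.refl , λ { (suc k) (s≤s _) → ≡.refl }) , (begin
      fromℤ (+ 1) + z * 0#  ≈⟨ +-cong fromℤ-1 (trans (zeroʳ z) (sym p)) ⟩
      1# + r                ∎)
  mon→poly {z} (suc d) {r} (cons {b = b} {w} (int i b≈) dw p) with mon→poly d dw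
  ... | f , (lead , high) , q = (i ∷ f) , (lead , λ { (suc k) (s≤s d<k) → high k d<k }) , (begin
      fromℤ i + z * eval R fromℤ f z  ≈⟨ +-cong (sym b≈) (*-congˡ q) ⟩
      b + z * (z ^ d + w)             ≈⟨ solve 4 (λ b z y w → b :+ z :* (y :+ w) := z :* y :+ (b :+ z :* w))
                                           refl b z (z ^ d) w ⟩
      z * z ^ d + (b + z * w)         ≈⟨ +-congˡ p ⟨
      z * z ^ d + r                   ∎)

  eval-0 : ∀ f z → (∀ k → coeff f k ≡ + 0) → eval R fromℤ f z ≈ 0#
  eval-0 []      z _    = refl
  eval-0 (i ∷ f) z all0 = begin
    fromℤ i + z * eval R fromℤ f z ≈⟨ +-cong (reflexive (≡.cong fromℤ (all0 0)))
                                             (*-congˡ (eval-0 f z (all0 ∘ suc))) ⟩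
    0# + z * 0#                    ≈⟨ trans (+-identityˡ _) (zeroʳ z) ⟩
    0#                             ∎

  poly→mon : ∀ n f z → Monic n f → Mon z n (eval R fromℤ f z)
  poly→mon n       []      z (() , _)
  poly→mon zero    (i ∷ f) z (lead , high) = mon (nil refl) (begin
    fromℤ i + z * eval R fromℤ f z ≈⟨ +-cong (trans (reflexive (≡.cong fromℤ lead)) fromℤ-1)
                                             (*-congˡ (eval-0 f z (λ k → high (suc k) (s≤s z≤n)))) ⟩
    1# + z * 0#                    ≈⟨ +-congˡ (zeroʳ z) ⟩
    1# + 0#                        ∎)
  poly→mon (suc n) (i ∷ f) z (lead , high)
    with poly→mon n f z (lead , λ k n<k → high (suc k) (s≤s n<k))
  ... | mon {r} dr p = mon (cons (int i refl) dr refl) (trans (+-congˡ (*-congˡ p))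
    (solve 4 (λ b z y w → b :+ z :* (y :+ w) := z :* y :+ (b :+ z :* w)) refl (fromℤ i) z (z ^ n) r))

  data Span : List Carrier → Pred Carrier (c ⊔ ℓ) where
    []  : ∀ {w} → w ≈ 0# → Span [] w
    _∷_ : ∀ {g G w w′} i → Span G w′ → {eq : w ≈ fromℤ i * g + w′} → Span (g ∷ G) w

  span-resp : ∀ {G u w} → u ≈ w → Span G u → Span G w
  span-resp eq ([] p)           = [] (trans (sym eq) p)
  span-resp eq (_∷_ i su {p})   = _∷_ i su {trans (sym eq) p}

  span-0 : ∀ G → Span G 0#
  span-0 []      = [] refl
  span-0 (g ∷ G) = _∷_ (+ 0) (span-0 G) {solve 1 (λ g → con (+ 0) := con (+ 0) :* g :+ con (+ 0)) refl g}

  span-+ : ∀ {G u w} → Span G u → Span G w → Span G (u + w)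
  span-+ ([] p) ([] q) = [] (trans (+-cong p q) (+-identityˡ _))
  span-+ {g ∷ G} (_∷_ {w′ = u} i su {p}) (_∷_ {w′ = w} j sw {q}) =
    _∷_ (i ℤ.+ j) (span-+ su sw) {trans (+-cong p q) (trans
      (solve 5 (λ i j g u w → (i :* g :+ u) :+ (j :* g :+ w) := (i :+ j) :* g :+ (u :+ w))
        refl (fromℤ i) (fromℤ j) g u w)
      (+-congʳ (*-congʳ (sym (fromℤ-+ i j)))))}

  span-isSubgroup : ∀ G → IsSubgroup (Span G)
  span-isSubgroup G = record { resp = span-resp ; 0∈ = span-0 G ; +-closed = span-+ }

  span-int : ∀ {G a w} → Int a → Span G w → Span G (a * w)
  span-int (int j a≈) ([] p) = [] (trans (*-congˡ p) (zeroʳ _))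
  span-int {g ∷ G} {a} (int j a≈) (_∷_ {w′ = u} i su {p}) =
    _∷_ (j ℤ.* i) (span-int (int j a≈) su) {trans (*-congˡ p) (trans
      (solve 4 (λ a i g u → a :* (i :* g :+ u) := (a :* i) :* g :+ a :* u) refl a (fromℤ i) g u)
      (+-congʳ (*-congʳ (trans (*-congʳ a≈) (sym (fromℤ-* j i))))))}

  span-neg : ∀ {G w} → Span G w → Span G (- w)
  span-neg sw = span-resp (-1*x≈-x _) (span-int (Int-neg Int-1) sw)

  span-++ : ∀ {G H u w} → Span G u → Span H w → Span (G ++ H) (u + w)
  span-++ ([] p) sw = span-resp (sym (trans (+-congʳ p) (+-identityˡ _))) sw
  span-++ (_∷_ i su {p}) sw = _∷_ i (span-++ su sw) {trans (+-congʳ p) (+-assoc _ _ _)}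

  span-++⁻ : ∀ G {H w} → Span (G ++ H) w → ∃[ u ] ∃[ v ] (Span G u × Span H v × w ≈ u + v)
  span-++⁻ []      sw = 0# , _ , [] refl , sw , sym (+-identityˡ _)
  span-++⁻ (g ∷ G) (_∷_ i sw {p}) with span-++⁻ G sw
  ... | u , v , su , sv , q =
    fromℤ i * g + u , v , _∷_ i su {refl} , sv , trans p (trans (+-congˡ q) (sym (+-assoc _ _ _)))

  span-map : ∀ x {G w} → Span G w → Span (map (x *_) G) (x * w)
  span-map x ([] p) = [] (trans (*-congˡ p) (zeroʳ x))
  span-map x {g ∷ G} (_∷_ {w′ = u} i su {p}) = _∷_ i (span-map x su) {trans (*-congˡ p)
    (solve 4 (λ x i g u → x :* (i :* g :+ u) := i :* (x :* g) :+ x :* u) refl x (fromℤ i) g u)}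

  span-map⁻ : ∀ x G {w} → Span (map (x *_) G) w → ∃[ u ] (Span G u × w ≈ x * u)
  span-map⁻ x []      ([] p) = 0# , [] refl , trans p (sym (zeroʳ x))
  span-map⁻ x (g ∷ G) (_∷_ i sw {p}) with span-map⁻ x G sw
  ... | u , su , q = fromℤ i * g + u , _∷_ i su {refl} , trans p (trans (+-congˡ q)
    (solve 4 (λ x i g u → i :* (x :* g) :+ x :* u := x :* (i :* g :+ u)) refl x (fromℤ i) g u))

  -- Generators of G + x G + … + x^(m-1) G.
  powers : Carrier → List Carrier → ℕ → List Carrier
  powers x G zero    = []
  powers x G (suc m) = G ++ map (x *_) (powers x G m)

  deg→span : ∀ {x G m w} → Deg< (Span G) x m w → Span (powers x G m) w
  deg→span (nil p)              = [] p
  deg→span {x} (cons sb dw p) = span-resp (sym p) (span-++ sb (span-map x (deg→span dw)))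

  span→deg : ∀ x G m {w} → Span (powers x G m) w → Deg< (Span G) x m w
  span→deg x G zero    ([] p) = nil p
  span→deg x G (suc m) sw with span-++⁻ G sw
  ... | u , v , su , sv , p with span-map⁻ x (powers x G m) sv
  ... | t , st , q = cons su (span→deg x G m st) (trans p (+-congˡ q))

  Stable : List Carrier → Pred Carrier (c ⊔ ℓ)
  Stable G z = ∀ {w} → Span G w → Span G (z * w)

  stable-powers : ∀ {x G y} m → Stable G y → Stable (powers x G m) y
  stable-powers {x} {G} {y} m st sw =
    deg→span (deg-scale (span-isSubgroup G) y st (span→deg x G m sw))

  stable-root : ∀ {x G} m → Mon x m 0# → Stable (powers x G m) x
  stable-root {x} {G} m (mon {r} dr p) sw
    with deg-top (span-isSubgroup G) m (deg-shift (span-isSubgroup G) (span→deg x G m sw))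
  ... | b , v , sb , dv , q = span-resp eq (span-+ (deg→span dv) (span-neg (deg→span rb)))
    where
    rb : Deg< (Span G) x m (r * b)
    rb = deg-*ʳ (span-isSubgroup G) span-int dr sb
    eq : v - r * b ≈ x * _
    eq = begin
      v - r * b                             ≈⟨ +-identityʳ _ ⟨
      (v - r * b) + 0#                      ≈⟨ +-congˡ (zeroˡ b) ⟨
      (v - r * b) + 0# * b                  ≈⟨ +-congˡ (*-congʳ p) ⟩
      (v - r * b) + (x ^ m + r) * b         ≈⟨ solve 4 (λ v r b y → (v :- r :* b) :+ (y :+ r) :* b := v :+ y :* b)
                                                 refl v r b (x ^ m) ⟩
      v + x ^ m * b                         ≈⟨ q ⟨
      x * _                                 ∎

  adjoin : ∀ G {x} → IsIntegral x →
           ∃[ H ] (Stable (1# ∷ H) x × (∀ {y} → Stable (1# ∷ G) y → Stable (1# ∷ H) y))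
  adjoin G {x} (f , n , monic , root) with poly→mon n f x monic
  ... | mon {r} dr p = _ , stable-root (suc n) bump , stable-powers (suc n)
    where
    bump : Mon x (suc n) 0#
    bump = mon (deg-shift Int-isSubgroup dr) (begin
      0#                      ≈⟨ zeroʳ x ⟨
      x * 0#                  ≈⟨ *-congˡ (trans (sym root) p) ⟩
      x * (x ^ n + r)         ≈⟨ distribˡ _ _ _ ⟩
      x * x ^ n + x * r       ∎)

  sum-cong : ∀ {n} {f g : Fin n → Carrier} → (∀ i → f i ≈ g i) → sum f ≈ sum g
  sum-cong {zero}  eq = refl
  sum-cong {suc n} eq = +-cong (eq zero) (sum-cong (eq ∘ suc))

  sum-last : ∀ {n} (f : Fin (suc n) → Carrier) → sum f ≈ sum (f ∘ inject₁) + f (fromℕ n)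
  sum-last {zero}  f = +-comm _ _
  sum-last {suc n} f = trans (+-congˡ (sum-last (f ∘ suc))) (sym (+-assoc _ _ _))

  sum-linear : ∀ p q {n} (f g v : Fin n → Carrier) →
    sum (λ j → (p * f j - q * g j) * v j) ≈ p * sum (λ j → f j * v j) - q * sum (λ j → g j * v j)
  sum-linear p q {zero}  f g v = solve 2 (λ p q → con (+ 0) := p :* con (+ 0) :- q :* con (+ 0)) refl p q
  sum-linear p q {suc n} f g v = trans (+-congˡ (sum-linear p q (f ∘ suc) (g ∘ suc) (v ∘ suc)))
    (solve 7 (λ p q f g v s t →
        (p :* f :- q :* g) :* v :+ (p :* s :- q :* t) := p :* (f :* v :+ s) :- q :* (g :* v :+ t))
      refl p q (f zero) (g zero) (v zero)
      (sum (λ j → f (suc j) * v (suc j))) (sum (λ j → g (suc j) * v (suc j))))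

  module _ (z : Carrier) where

    -- If v solves a linear system whose diagonal entries are monic of
    -- degree d in z, all other entries having degree < d, then some
    -- monic expression in z kills v zero.
    eliminate : ∀ n d (B : Fin (suc n) → Fin (suc n) → Carrier) (v : Fin (suc n) → Carrier) →
      (∀ i → Mon z d (B i i)) → (∀ i j → i ≢ j → Deg< Int z d (B i j)) →
      (∀ i → sum (λ j → B i j * v j) ≈ 0#) →
      ∃[ D ] ∃[ b ] (Mon z D b × b * v zero ≈ 0#)
    eliminate zero    d B v diag off sys =
      d , B zero zero , diag zero , trans (sym (+-identityʳ _)) (sys zero)
    eliminate (suc n) d B v diag off sys = eliminate n (d ℕ.+ d) B′ (v ∘ inject₁) diag′ off′ sys′
      where
      l  = fromℕ (suc n)
      B′ : Fin (suc n) → Fin (suc n) → Carrier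
      B′ i j = B l l * B (inject₁ i) (inject₁ j) - B (inject₁ i) l * B l (inject₁ j)

      offʳ : ∀ i → Deg< Int z d (B (inject₁ i) l)
      offʳ i = off _ _ (λ eq → fromℕ≢inject₁ (≡.sym eq))

      offˡ : ∀ j → Deg< Int z d (B l (inject₁ j))
      offˡ j = off _ _ fromℕ≢inject₁

      cross : ∀ i j → Deg< Int z (d ℕ.+ d) (B (inject₁ i) l * B l (inject₁ j))
      cross i j = deg-* Int-isSubgroup Int-* (offʳ i) (offˡ j)

      diag′ : ∀ i → Mon z (d ℕ.+ d) (B′ i i)
      diag′ i = mon-sub (mon-* (diag l) (diag (inject₁ i))) (cross i i)

      off′ : ∀ i j → i ≢ j → Deg< Int z (d ℕ.+ d) (B′ i j)
      off′ i j i≢j = deg-+ Int-isSubgroup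
        (mon-deg-* (diag l) (off _ _ (i≢j ∘ inject₁-injective))) (deg-neg (cross i j))

      sys′ : ∀ i → sum (λ j → B′ i j * v (inject₁ j)) ≈ 0#
      sys′ i = begin
        sum (λ j → B′ i j * v (inject₁ j))
          ≈⟨ sum-linear (B l l) (B (inject₁ i) l) (λ j → B (inject₁ i) (inject₁ j))
                        (λ j → B l (inject₁ j)) (v ∘ inject₁) ⟩
        B l l * S - B (inject₁ i) l * T
          ≈⟨ solve 5 (λ p q s t w → p :* s :- q :* t := p :* (s :+ q :* w) :- q :* (t :+ p :* w))
               refl (B l l) (B (inject₁ i) l) S T (v l) ⟩
        B l l * (S + B (inject₁ i) l * v l) - B (inject₁ i) l * (T + B l l * v l)
          ≈⟨ +-cong (*-congˡ (trans (sym (sum-last (λ j → B (inject₁ i) j * v j))) (sys (inject₁ i))))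
                    (-‿cong (*-congˡ (trans (sym (sum-last (λ j → B l j * v j))) (sys l)))) ⟩
        B l l * 0# - B (inject₁ i) l * 0#
          ≈⟨ solve 2 (λ p q → p :* con (+ 0) :- q :* con (+ 0) := con (+ 0)) refl (B l l) (B (inject₁ i) l) ⟩
        0# ∎
        where
        S = sum (λ j → B (inject₁ i) (inject₁ j) * v (inject₁ j))
        T = sum (λ j → B l (inject₁ j) * v (inject₁ j))

    δ : ∀ {n} → Fin n → Fin n → Carrier
    δ zero    zero    = z
    δ zero    (suc j) = 0#
    δ (suc i) zero    = 0#
    δ (suc i) (suc j) = δ i j

    δ-diag : ∀ {n} (i : Fin n) → δ i i ≡ z
    δ-diag zero    = ≡.refl
    δ-diag (suc i) = δ-diag i

    δ-off : ∀ {n} (i j : Fin n) → i ≢ j → δ i j ≡ 0#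
    δ-off zero    zero    i≢j = ⊥-elim (i≢j ≡.refl)
    δ-off zero    (suc j) i≢j = ≡.refl
    δ-off (suc i) zero    i≢j = ≡.refl
    δ-off (suc i) (suc j) i≢j = δ-off i j (i≢j ∘ ≡.cong suc)

    sum-0 : ∀ {n} (v : Fin n → Carrier) → sum (λ j → 0# * v j) ≈ 0#
    sum-0 {zero}  v = refl
    sum-0 {suc n} v = trans (+-cong (zeroˡ _) (sum-0 (v ∘ suc))) (+-identityˡ _)

    sum-δ : ∀ {n} (v : Fin n → Carrier) i → sum (λ j → δ i j * v j) ≈ z * v i
    sum-δ v zero    = trans (+-congˡ (sum-0 (v ∘ suc))) (+-identityʳ _)
    sum-δ v (suc i) = trans (+-cong (zeroˡ _) (sum-δ (v ∘ suc) i)) (+-identityˡ _)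

    span-coefficients : ∀ G {w} → Span G w →
      Σ (Fin (length G) → ℤ) λ a → w ≈ sum (λ j → fromℤ (a j) * lookup G j)
    span-coefficients []      ([] p) = (λ ()) , p
    span-coefficients (g ∷ G) (_∷_ i sw {p}) with span-coefficients G sw
    ... | a , q = (λ { zero → i ; (suc j) → a j }) , trans p (+-congˡ q)

    span-lookup : ∀ G i → Span G (lookup G i)
    span-lookup (g ∷ G) zero    = _∷_ (+ 1) (span-0 G)
      {trans (sym (*-identityˡ g)) (trans (*-congʳ (sym fromℤ-1)) (sym (+-identityʳ _)))}
    span-lookup (g ∷ G) (suc i) = _∷_ (+ 0) (span-lookup G i)
      {solve 2 (λ g u → u := con (+ 0) :* g :+ u) refl g (lookup G i)}

    killed→integral : ∃[ D ] ∃[ b ] (Mon z D b × b * 1# ≈ 0#) → IsIntegral z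
    killed→integral (D , b , mon dr p , b*1≈0) with mon→poly D dr
    ... | f , monic , q = f , D , monic , trans q (trans (sym p) (trans (sym (*-identityʳ b)) b*1≈0))

    stable→integral : ∀ G → Stable (1# ∷ G) z → IsIntegral z
    stable→integral G st = killed→integral (eliminate (length G) 1 B v diag off sys)
      where
      v : Fin (suc (length G)) → Carrier
      v = lookup (1# ∷ G)

      A : ∀ i → Σ (Fin (suc (length G)) → ℤ) λ a → z * v i ≈ sum (λ j → fromℤ (a j) * v j)
      A i = span-coefficients (1# ∷ G) (st (span-lookup (1# ∷ G) i))

      B : Fin (suc (length G)) → Fin (suc (length G)) → Carrier
      B i j = 1# * δ i j - 1# * fromℤ (proj₁ (A i) j)

      const : ∀ i → Deg< Int z 1 (1# * fromℤ i)
      const i = deg-const Int-isSubgroup (Int-* Int-1 (int i refl))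

      diag : ∀ i → Mon z 1 (B i i)
      diag i = mon-sub
        (mon (deg-0 Int-isSubgroup 1) (begin
          1# * δ i i      ≡⟨ ≡.cong (1# *_) (δ-diag i) ⟩
          1# * z          ≈⟨ *-comm _ _ ⟩
          z * 1#          ≈⟨ +-identityʳ _ ⟨
          z * 1# + 0#     ∎))
        (const (proj₁ (A i) i))

      off : ∀ i j → i ≢ j → Deg< Int z 1 (B i j)
      off i j i≢j = deg-+ Int-isSubgroup
        (deg-resp Int-isSubgroup
          (sym (trans (*-congˡ (reflexive (δ-off i j i≢j))) (zeroʳ 1#)))
          (deg-0 Int-isSubgroup 1))
        (deg-neg (const (proj₁ (A i) j)))

      sys : ∀ i → sum (λ j → B i j * v j) ≈ 0#
      sys i = begin
        sum (λ j → B i j * v j)                     ≈⟨ sum-linear 1# 1# (δ i) (λ j → fromℤ (proj₁ (A i) j)) v ⟩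
        1# * sum (λ j → δ i j * v j) - 1# * S       ≈⟨ +-congʳ (*-congˡ (trans (sum-δ v i) (proj₂ (A i)))) ⟩
        1# * S - 1# * S                             ≈⟨ -‿inverseʳ (1# * S) ⟩
        0#                                          ∎
        where S = sum (λ j → fromℤ (proj₁ (A i) j) * v j)

  stable-1 : Stable (1# ∷ []) 1#
  stable-1 {w} sw = span-resp (sym (*-identityˡ w)) sw

  Common : Carrier → Carrier → Set (c ⊔ ℓ)
  Common x y = ∃[ G ] (Stable (1# ∷ G) x × Stable (1# ∷ G) y)

  common : ∀ {x y} → IsIntegral x → IsIntegral y → Common x y
  common {x} {y} ix iy =
    let G , stx , _    = adjoin [] {x} ix
        H , sty , keep = adjoin G {y} iy
    in H , keep {x} stx , sty

  integral-+ : ∀ {x y} → Common x y → IsIntegral (x + y)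
  integral-+ {x} {y} (G , stx , sty) = stable→integral (x + y) G
    λ {w} sw → span-resp (sym (distribʳ w x y)) (span-+ (stx sw) (sty sw))

  integral-* : ∀ {x y} → Common x y → IsIntegral (x * y)
  integral-* {x} {y} (G , stx , sty) = stable→integral (x * y) G
    λ {w} sw → span-resp (sym (*-assoc x y w)) (stx (sty sw))

  integral-neg : ∀ {x y} → Common x y → IsIntegral (- x)
  integral-neg {x} (G , stx , _) = stable→integral (- x) G
    λ {w} sw → span-resp (-‿distribˡ-* x w) (span-neg (stx sw))

  integral-0 : IsIntegral 0#
  integral-0 = stable→integral 0# [] λ {w} sw → span-resp (sym (zeroˡ w)) (span-0 (1# ∷ []))

  abstract
    integral-isSubring : IsSubring R IsIntegral
    integral-isSubring = record
      { +-closed = λ ix iy → integral-+ (common ix iy)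
      ; *-closed = λ ix iy → integral-* (common ix iy)
      ; -‿closed = λ ix → integral-neg (common ix ix)
      ; 0-closed = integral-0
      ; 1-closed = stable→integral 1# [] stable-1
      }

open Integral using (IsIntegral)

-- The ring of elements of R integral over ℤ; for R a number field this
-- is its ring of integers.
𝒪 : ∀ {c ℓ} → CommutativeRing c ℓ → CommutativeRing (c ⊔ ℓ) ℓ
𝒪 R = subring R (IsIntegral R) (Integral.integral-isSubring R)

𝒪-map : ∀ {c ℓ c′ ℓ′} {R : CommutativeRing c ℓ} {S : CommutativeRing c′ ℓ′} → RingHom R S →
        CommutativeRing.Carrier (𝒪 R) → CommutativeRing.Carrier (𝒪 S)
𝒪-map {S = S} φ (x , f , n , monic , root) =
  RingHom.fun φ x , f , n , monic ,
  S.trans (S.sym (hom-eval φ f x)) (S.trans (RingHom.⟦⟧-cong φ root) (RingHom.0#-homo φ))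
  where module S = CommutativeRing S

-- P ∩ ℤ = pℤ.
LiesOver : ∀ {a ℓ} (R : CommutativeRing a ℓ) → Ideals.Ideal R → ℕ → Set (a ⊔ ℓ)
LiesOver R P p = ∀ i → (fromℤ i ∈ᴵ P) ⇔ ((+ p) ℤᵈ.∣ i)
  where
  open FromInteger R using (fromℤ)
  open Ideals R using (_∈ᴵ_)

-- The extension of P along φ has a prime factor of exponent at least 2.
RamifiedIn : ∀ {c ℓ} {K F : CommutativeRing c ℓ} →
             RingHom K F → Ideals.Ideal (𝒪 K) → Set (lsuc (c ⊔ ℓ))
RamifiedIn {K = K} {F} φ P =
  Σ (PrimeFactorisation (extend {R = 𝒪 K} {S = 𝒪 F} (𝒪-map φ) P)) λ fact →
    ∃[ i ] (1 < PrimeFactorisation.e fact i)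
  where open Ideals (𝒪 F) using (PrimeFactorisation)

module Simple {c ℓ} {M : CommutativeRing c ℓ} (Ω : Field c ℓ) (ε : RingHom M (Field.ring Ω))
              (η : CommutativeRing.Carrier (Field.ring Ω)) where
  private module M = CommutativeRing M
  open CommutativeRing (Field.ring Ω) hiding (zero)
  open RingHom ε using (fun; 0#-homo; 1#-homo)

  -- Membership in the subfield of Ω generated by the image of M and η.
  data Generated : Pred Carrier (c ⊔ ℓ) where
    base : ∀ m → Generated (fun m)
    root : Generated η
    resp : ∀ {x y} → x ≈ y → Generated x → Generated y
    add  : ∀ {x y} → Generated x → Generated y → Generated (x + y)
    mul  : ∀ {x y} → Generated x → Generated y → Generated (x * y)
    neg  : ∀ {x} → Generated x → Generated (- x)
    inv  : ∀ {x y} → Generated x → x * y ≈ 1# → Generated y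

  M⟮η⟯ : Field (c ⊔ ℓ) ℓ
  M⟮η⟯ = record
    { ring = subring (Field.ring Ω) Generated (record
      { +-closed = add ; *-closed = mul ; -‿closed = neg
      ; 0-closed = resp 0#-homo (base M.0#) ; 1-closed = resp 1#-homo (base M.1#) })
    ; 1≉0 = Field.1≉0 Ω
    ; invertible = λ (x , gx) x≉0 → let y , xy≈1 = Field.invertible Ω x x≉0 in (y , inv gx xy≈1) , xy≈1
    }

  𝒪M[η] : Pred (CommutativeRing.Carrier (𝒪 (Field.ring M⟮η⟯))) (c ⊔ ℓ)
  𝒪M[η] ((y , _) , _) = Σ (List (CommutativeRing.Carrier (𝒪 M))) λ f →
    y ≈ eval (Field.ring Ω) (fun ∘ proj₁) f η

-- The subgroup B of G has index n: there is a system of n representatives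
-- of the cosets of B.
HasIndex : ∀ {a ℓ b} (G : AbelianGroup a ℓ) → Pred (AbelianGroup.Carrier G) b → ℕ → Set (a ⊔ b)
HasIndex G B n = Σ (Fin n → Carrier) λ r →
  (∀ x → ∃[ i ] B (x - r i)) × (∀ i j → B (r i - r j) → i ≡ j)
  where open AbelianGroup G

{-# OPTIONS --safe #-}
module Submission where

-- Modulo 𝔭, the class of x in k[x]/(h) generates a finite ring, so that
-- x^(p^i) = x^(p^j) for some i < j, and Frobenius makes
-- w = x - x^(p^(j-i)) nilpotent.  Since w′ = 1, w ∈ (h) would make h and
-- h′ coprime, although the discriminant vanishes modulo 𝔭.  Hence some
-- z ∉ (h, 𝔭) has z² ∈ (h, 𝔭).  If P² divides 𝔭 𝒪M, there is a
-- non-integral γ ∈ M with γ 𝔭 and γ² 𝔭 integral; it has the form β/Δ, as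
-- (Δ) = 𝔭 K makes 𝔭 invertible.  Then θ = γ z(η) has θ² ∈ 𝒪M[η], so it is
-- integral, and p θ ∈ 𝒪M[η]; but θ ∉ 𝒪M[η], since 1, η, …, η^(n-1) are
-- independent over M.  So θ has order p modulo 𝒪M[η].
--
-- Divisibility of the index by p is decidable, so the classical steps
-- are carried out under a double negation.

open import Algebra.Bundles using (CommutativeRing; CommutativeMonoid)
open import Algebra.Definitions.RawMagma using () renaming (_,_ to divides-by)
import Algebra.Definitions.RawSemiring as RawSemiringDefs
import Algebra.Properties.CommutativeMonoid.Sum as MonoidSum
import Algebra.Properties.CommutativeSemiring.Binomial as Binomial
import Algebra.Properties.Monoid.Mult as MonoidMult
import Algebra.Properties.Ring as RingProperties
import Algebra.Properties.Semiring.Exp as SemiringExp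
import Algebra.Properties.Semiring.Mult as SemiringMult
import Algebra.Properties.Semiring.Sum as SemiringSum
import Algebra.Solver.Ring as RingSolver
open import Algebra.Solver.Ring.AlmostCommutativeRing using (fromCommutativeRing)
open import Algebra.Structures using (IsCommutativeRing)
open import Data.Empty using (⊥-elim; ⊥)
open import Data.Fin.Base using (Fin; zero; suc; toℕ; punchIn; opposite; fromℕ<; splitAt; _↑ˡ_; _↑ʳ_; fromℕ; inject₁; finToFun; funToFin)
open import Data.Fin.Permutation using (Permutation; permutation)
import Data.Fin.Properties as Finₚ
open import Data.Integer.Base as ℤ using (ℤ; +_; -[1+_]; ∣_∣)
open import Data.Integer.DivMod using (_%ℕ_; _/ℕ_; a≡a%ℕn+[a/ℕn]*n; n%ℕd<d)
import Data.Integer.Properties as ℤₚ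
open import Data.List.Base as List using (List; []; _∷_; map; length; _++_; replicate; take)
import Data.List.Properties as Listₚ
open import Data.List.Relation.Unary.All as All using (All; []; _∷_)
import Data.List.Relation.Unary.All.Properties as Allₚ
open import Data.Maybe.Base using (Maybe; just; nothing)
open import Data.Nat.Base as ℕ using (ℕ; zero; suc; _≤_; _<_; z≤n; s≤s; _∸_; _!; NonZero)
open import Data.Nat.Combinatorics using (_C_; nCk≡n!/k![n-k]!; k![n∸k]!∣n!; nCn≡1)
open import Data.Nat.Coprimality using (coprime-Bézout)
open import Data.Nat.DivMod using (m/n*n≡m; _/_)
open import Data.Nat.Divisibility using (_∣_; _∤_; divides; ∣⇒≤; m∣m*n; ∣1⇒≡1; _∣?_; ∣-refl)
open import Data.Nat.GCD using (module Bézout)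
open import Data.Nat.Primality using (Prime; prime⇒nonZero; euclidsLemma; prime⇒irreducible)
import Data.Nat.Properties as ℕₚ
open import Data.Product using (∃; ∃-syntax; _×_; _,_; proj₁; proj₂; Σ)
open import Data.Rational.Base as ℚ using (ℚ; 0ℚ; 1ℚ; 1/_)
import Data.Rational.Properties as ℚₚ
open import Data.Sum.Base using (inj₁; inj₂; _⊎_) renaming (map to ⊎-map)
open import Data.Vec.Base using (Vec; []; _∷_; lookup; removeAt; allFin)
import Data.Vec.Functional as Vector
import Data.Vec.Functional.Properties as Vectorₚ
open import Data.Vec.Properties using (lookup-allFin)
open import Function.Base using (_∘_; id)
open import Function.Bundles using (Equivalence)
open import Level using (Level; _⊔_)
open import Relation.Binary.PropositionalEquality as ≡ using (_≡_; _≢_)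
import Relation.Binary.Reasoning.Setoid as SetoidReasoning
open import Relation.Nullary using (¬_; yes; no)
open import Relation.Nullary.Decidable using (¬¬-excluded-middle; decidable-stable)
open import Relation.Unary using (Pred)
open import Defs

-- A repeated factor of `h` modulo 𝔭 would be the textbook source of `z`, but factoring presupposes
-- decidable equality in the residue field k; pigeonhole on integer coefficients modulo `p` does
-- not. The finite ring comes from integrality over ℤ: the coefficients of `h` are algebraic
-- integers, so the class of x is integral over ℤ, and its powers lie in a subgroup with finitely
-- many generators, annihilated by `p`. The element γ is a non-integral element of the fractional
-- ideal P⁻¹. Writing 𝔭𝒪M = P²I gives γ𝔭 ⊆ PI and γ²𝔭 ⊆ I. Ramification is thus what lets 𝔭 absorb
-- the square of γ, and this matches z² ∈ (h, 𝔭): modulo h, θ² = γ² z(η)² has coefficients in γ²𝔭.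
-- With J = 𝔭𝒪M, the products P (J : P²) K Δ⁻¹ take the place of P⁻¹, since K Δ⁻¹ is the inverse of
-- 𝔭. Non-integrality passes from γ to θ because some coefficient of `z` is a unit modulo 𝔭, while
-- γ𝔭 is integral.

module Solver {a ℓ} (R : CommutativeRing a ℓ) where
  open CommutativeRing R using (_≈_; reflexive)
  open FromInteger R

  private
    coeff≟ : ∀ i j → Maybe (fromℤ i ≈ fromℤ j)
    coeff≟ i j with i ℤₚ.≟ j
    ... | yes eq = just (reflexive (≡.cong fromℤ eq))
    ... | no  _  = nothing

  open RingSolver (CommutativeRing.rawRing ℤₚ.+-*-commutativeRing) (fromCommutativeRing R)
                  fromℤ-morphism coeff≟ public
    using (solve; _:=_; _:+_; _:*_; :-_; _:-_; con)

-- Quotient rings and principal ideals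

module _ {a ℓ} (R : CommutativeRing a ℓ) (I : Ideals.Ideal R) where
  open CommutativeRing R
  open Ideals.Ideal I
  open Solver R
  open FromInteger R using (fromℤ)

  -- A record, so that x and y can be inferred from a proof.
  record Congruent (x y : Carrier) : Set (a ⊔ ℓ) where
    constructor congruent
    field difference∈ : member (x - y)
  open Congruent public

  quotient-≈ : ∀ {x y} → x ≈ y → Congruent x y
  quotient-≈ p = congruent (resp (sym (trans (+-congʳ p) (-‿inverseʳ _))) 0∈)

  ∈⇒≈0 : ∀ {x} → member x → Congruent x 0#
  ∈⇒≈0 {x} m = congruent (resp (solve 1 (λ x → x := x :- con (+ 0)) refl x) m)

  ≈0⇒∈ : ∀ {x} → Congruent x 0# → member x
  ≈0⇒∈ {x} (congruent m) = resp (solve 1 (λ x → x :- con (+ 0) := x) refl x) m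

  abstract
    quotient-isCommutativeRing : IsCommutativeRing Congruent _+_ _*_ -_ 0# 1#
    quotient-isCommutativeRing = record
      { isRing = record
        { +-isAbelianGroup = record
          { isGroup = record
            { isMonoid = record
              { isSemigroup = record
                { isMagma = record
                  { isEquivalence = record
                    { refl  = quotient-≈ refl
                    ; sym   = λ {x} {y} (congruent p) → congruent
                        (resp (solve 2 (λ x y → :- con (+ 1) :* (x :- y) := y :- x) refl x y)
                              (*-closed (- fromℤ (+ 1)) p))
                    ; trans = λ {x} {y} {z} (congruent p) (congruent q) → congruent
                        (resp (solve 3 (λ x y z → (x :- y) :+ (y :- z) := x :- z) refl x y z)
                              (+-closed p q)) }
                  ; ∙-cong = λ {x} {y} {u} {v} (congruent p) (congruent q) → congruent
                      (resp (solve 4 (λ x y u v → (x :- y) :+ (u :- v) := (x :+ u) :- (y :+ v)) refl x y u v)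
                            (+-closed p q)) }
                ; assoc = λ x y z → quotient-≈ (+-assoc x y z) }
              ; identity = (λ x → quotient-≈ (+-identityˡ x)) , (λ x → quotient-≈ (+-identityʳ x)) }
            ; inverse = (λ x → quotient-≈ (-‿inverseˡ x)) , (λ x → quotient-≈ (-‿inverseʳ x))
            ; ⁻¹-cong = λ {x} {y} (congruent p) → congruent
                (resp (solve 2 (λ x y → :- con (+ 1) :* (x :- y) := (:- x) :- (:- y)) refl x y)
                      (*-closed (- fromℤ (+ 1)) p)) }
          ; comm = λ x y → quotient-≈ (+-comm x y) }
        ; *-cong = λ {x} {y} {u} {v} (congruent p) (congruent q) → congruent
            (resp (solve 4 (λ x y u v → u :* (x :- y) :+ y :* (u :- v) := (x :* u) :- (y :* v)) refl x y u v)
                  (+-closed (*-closed u p) (*-closed y q)))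
        ; *-assoc = λ x y z → quotient-≈ (*-assoc x y z)
        ; *-identity = (λ x → quotient-≈ (*-identityˡ x)) , (λ x → quotient-≈ (*-identityʳ x))
        ; distrib = (λ x y z → quotient-≈ (distribˡ x y z)) , (λ x y z → quotient-≈ (distribʳ x y z)) }
      ; *-comm = λ x y → quotient-≈ (*-comm x y) }

  Quotient : CommutativeRing a (a ⊔ ℓ)
  Quotient = record { isCommutativeRing = quotient-isCommutativeRing }

module _ {a ℓ} (R : CommutativeRing a ℓ) where
  open CommutativeRing R

  module _ (m : Carrier) where

    Multiple : Carrier → Set (a ⊔ ℓ)
    Multiple x = ∃[ q ] x ≈ q * m

    abstract
      multiple-resp : ∀ {x y} → x ≈ y → Multiple x → Multiple y
      multiple-resp x≈y (q , p) = q , trans (sym x≈y) p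

      multiple-0 : Multiple 0#
      multiple-0 = 0# , sym (zeroˡ m)

      multiple-+ : ∀ {x y} → Multiple x → Multiple y → Multiple (x + y)
      multiple-+ (q , p) (r , s) = q + r , trans (+-cong p s) (sym (distribʳ m q r))

      multiple-* : ∀ r {x} → Multiple x → Multiple (r * x)
      multiple-* r (q , p) = r * q , trans (*-congˡ p) (sym (*-assoc r q m))

    multiples : Ideals.Ideal R
    multiples = record
      { member = Multiple ; resp = multiple-resp ; 0∈ = multiple-0 ; +-closed = multiple-+ ; *-closed = multiple-* }

  -- Exchanges the inductive span for a visible quotient; it later divides the products in 𝔭 K by Δ.
  principal⇒multiple : ∀ {m x} → Ideals._∈ᴵ_ R x (Ideals.principal R m) → Multiple m x
  principal⇒multiple {m} (Ideals.gen _)        = 1# , sym (*-identityˡ m)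
  principal⇒multiple {m} (Ideals.resp eq s)    = multiple-resp m eq (principal⇒multiple s)
  principal⇒multiple {m} Ideals.null           = multiple-0 m
  principal⇒multiple {m} (Ideals.add s t)      = multiple-+ m (principal⇒multiple s) (principal⇒multiple t)
  principal⇒multiple {m} (Ideals.scale r s)    = multiple-* m r (principal⇒multiple s)

-- Polynomials

module PolynomialRing {a ℓ} (R : CommutativeRing a ℓ) where
  open CommutativeRing R hiding (zero)
  open Polynomials R public
  open Solver R
  open RingProperties (CommutativeRing.ring R) using (-0#≈0#)

  -- A record, so that the polynomials can be inferred from a proof.
  infix 4 _≋_
  record _≋_ (f g : Polynomial) : Set ℓ where
    constructor coeffs
    field at : f ≈ₚ g
  open _≋_ public

  scale : Carrier → Polynomial → Polynomial
  scale c = map (c *_)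

  shift : Polynomial → Polynomial
  shift f = 0# ∷ f

  -ₚ_ : Polynomial → Polynomial
  -ₚ_ = map (-_)

  1ₚ : Polynomial
  1ₚ = 1# ∷ []

  X : Polynomial
  X = shift 1ₚ

  constant : Carrier → Polynomial
  constant c = c ∷ []

  coeff-+ : ∀ f g k → coeff (f +ₚ g) k ≈ coeff f k + coeff g k
  coeff-+ []      g       k       = sym (+-identityˡ _)
  coeff-+ (c ∷ f) []      k       = sym (+-identityʳ _)
  coeff-+ (c ∷ f) (d ∷ g) zero    = refl
  coeff-+ (c ∷ f) (d ∷ g) (suc k) = coeff-+ f g k

  coeff-scale : ∀ c g k → coeff (scale c g) k ≈ c * coeff g k
  coeff-scale c []      k       = sym (zeroʳ c)
  coeff-scale c (d ∷ g) zero    = refl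
  coeff-scale c (d ∷ g) (suc k) = coeff-scale c g k

  coeff-neg : ∀ f k → coeff (-ₚ f) k ≈ - coeff f k
  coeff-neg []      k       = sym -0#≈0#
  coeff-neg (c ∷ f) zero    = refl
  coeff-neg (c ∷ f) (suc k) = coeff-neg f k

  ≋-refl : ∀ {f} → f ≋ f
  ≋-refl = coeffs λ k → refl

  ≋-sym : ∀ {f g} → f ≋ g → g ≋ f
  ≋-sym p = coeffs λ k → sym (at p k)

  ≋-trans : ∀ {f g h} → f ≋ g → g ≋ h → f ≋ h
  ≋-trans p q = coeffs λ k → trans (at p k) (at q k)

  ∷-cong : ∀ {c d f g} → c ≈ d → f ≋ g → (c ∷ f) ≋ (d ∷ g)
  ∷-cong p q = coeffs λ { zero → p ; (suc k) → at q k }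

  ∷-injectiveʳ : ∀ {c d f g} → (c ∷ f) ≋ (d ∷ g) → f ≋ g
  ∷-injectiveʳ p = coeffs (at p ∘ suc)

  shift-[] : shift [] ≋ []
  shift-[] = coeffs λ { zero → refl ; (suc k) → refl }

  +ₚ-cong : ∀ {f g u v} → f ≋ g → u ≋ v → (f +ₚ u) ≋ (g +ₚ v)
  +ₚ-cong {f} {g} {u} {v} p q = coeffs λ k →
    trans (coeff-+ f u k) (trans (+-cong (at p k) (at q k)) (sym (coeff-+ g v k)))

  +ₚ-identityʳ : ∀ f → (f +ₚ []) ≋ f
  +ₚ-identityʳ f = coeffs λ k → trans (coeff-+ f [] k) (+-identityʳ _)

  +ₚ-assoc : ∀ f g h → ((f +ₚ g) +ₚ h) ≋ (f +ₚ (g +ₚ h))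
  +ₚ-assoc f g h = coeffs λ k → trans (coeff-+ (f +ₚ g) h k) (trans (+-congʳ (coeff-+ f g k))
    (trans (+-assoc _ _ _) (sym (trans (coeff-+ f (g +ₚ h) k) (+-congˡ (coeff-+ g h k))))))

  +ₚ-comm : ∀ f g → (f +ₚ g) ≋ (g +ₚ f)
  +ₚ-comm f g = coeffs λ k → trans (coeff-+ f g k) (trans (+-comm _ _) (sym (coeff-+ g f k)))

  -ₚ-cong : ∀ {f g} → f ≋ g → (-ₚ f) ≋ (-ₚ g)
  -ₚ-cong {f} {g} p = coeffs λ k → trans (coeff-neg f k) (trans (-‿cong (at p k)) (sym (coeff-neg g k)))

  -ₚ-inverseʳ : ∀ f → (f +ₚ -ₚ f) ≋ []
  -ₚ-inverseʳ f = coeffs λ k →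
    trans (coeff-+ f (-ₚ f) k) (trans (+-congˡ (coeff-neg f k)) (-‿inverseʳ _))

  scale-cong : ∀ {c d f g} → c ≈ d → f ≋ g → scale c f ≋ scale d g
  scale-cong {c} {d} {f} {g} p q = coeffs λ k →
    trans (coeff-scale c f k) (trans (*-cong p (at q k)) (sym (coeff-scale d g k)))

  scale-0 : ∀ f → scale 0# f ≋ []
  scale-0 f = coeffs λ k → trans (coeff-scale 0# f k) (zeroˡ _)

  scale-1 : ∀ f → scale 1# f ≋ f
  scale-1 f = coeffs λ k → trans (coeff-scale 1# f k) (*-identityˡ _)

  scale-+ : ∀ c f g → scale c (f +ₚ g) ≋ (scale c f +ₚ scale c g)
  scale-+ c f g = coeffs λ k → trans (coeff-scale c (f +ₚ g) k) (trans (*-congˡ (coeff-+ f g k))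
    (trans (distribˡ _ _ _) (sym (trans (coeff-+ (scale c f) (scale c g) k)
      (+-cong (coeff-scale c f k) (coeff-scale c g k))))))

  scale-+ˡ : ∀ c d f → scale (c + d) f ≋ (scale c f +ₚ scale d f)
  scale-+ˡ c d f = coeffs λ k → trans (coeff-scale (c + d) f k) (trans (distribʳ _ _ _)
    (sym (trans (coeff-+ (scale c f) (scale d f) k) (+-cong (coeff-scale c f k) (coeff-scale d f k)))))

  scale-scale : ∀ c d f → scale (c * d) f ≋ scale c (scale d f)
  scale-scale c d f = coeffs λ k → trans (coeff-scale (c * d) f k) (trans (*-assoc _ _ _)
    (sym (trans (coeff-scale c (scale d f) k) (*-congˡ (coeff-scale d f k)))))

  scale-shift : ∀ c f → scale c (shift f) ≋ shift (scale c f)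
  scale-shift c f = ∷-cong (zeroʳ c) ≋-refl

  +ₚ-interchange : ∀ f g u v → ((f +ₚ g) +ₚ (u +ₚ v)) ≋ ((f +ₚ u) +ₚ (g +ₚ v))
  +ₚ-interchange f g u v = coeffs λ k → trans (expand f g u v k)
    (trans (solve 4 (λ f g u v → (f :+ g) :+ (u :+ v) := (f :+ u) :+ (g :+ v)) refl
             (coeff f k) (coeff g k) (coeff u k) (coeff v k))
           (sym (expand f u g v k)))
    where
    expand : ∀ f g u v k → coeff ((f +ₚ g) +ₚ (u +ₚ v)) k ≈ (coeff f k + coeff g k) + (coeff u k + coeff v k)
    expand f g u v k = trans (coeff-+ (f +ₚ g) (u +ₚ v) k) (+-cong (coeff-+ f g k) (coeff-+ u v k))

  shift-+ : ∀ f g → shift (f +ₚ g) ≋ (shift f +ₚ shift g)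
  shift-+ f g = ∷-cong (sym (+-identityˡ 0#)) ≋-refl

  []*ʳ : ∀ f → (f *ₚ []) ≋ []
  []*ʳ []      = ≋-refl
  []*ʳ (c ∷ f) = ≋-trans (∷-cong refl ([]*ʳ f)) shift-[]

  *ₚ-zeroˡ : ∀ f g → f ≋ [] → (f *ₚ g) ≋ []
  *ₚ-zeroˡ []      g p = ≋-refl
  *ₚ-zeroˡ (c ∷ f) g p = ≋-trans
    (+ₚ-cong (≋-trans (scale-cong (at p 0) ≋-refl) (scale-0 g))
             (∷-cong refl (*ₚ-zeroˡ f g (coeffs (at p ∘ suc)))))
    shift-[]

  *ₚ-congˡ : ∀ f {g g′} → g ≋ g′ → (f *ₚ g) ≋ (f *ₚ g′)
  *ₚ-congˡ []      p = ≋-refl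
  *ₚ-congˡ (c ∷ f) p = +ₚ-cong (scale-cong refl p) (∷-cong refl (*ₚ-congˡ f p))

  *ₚ-congʳ : ∀ f f′ g → f ≋ f′ → (f *ₚ g) ≋ (f′ *ₚ g)
  *ₚ-congʳ []      f′       g p = ≋-sym (*ₚ-zeroˡ f′ g (≋-sym p))
  *ₚ-congʳ (c ∷ f) []       g p = *ₚ-zeroˡ (c ∷ f) g p
  *ₚ-congʳ (c ∷ f) (d ∷ f′) g p =
    +ₚ-cong (scale-cong (at p 0) ≋-refl) (∷-cong refl (*ₚ-congʳ f f′ g (∷-injectiveʳ p)))

  *ₚ-distribʳ : ∀ h f g → ((f +ₚ g) *ₚ h) ≋ (f *ₚ h +ₚ g *ₚ h)
  *ₚ-distribʳ h []      g       = ≋-refl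
  *ₚ-distribʳ h (c ∷ f) []      = ≋-sym (+ₚ-identityʳ _)
  *ₚ-distribʳ h (c ∷ f) (d ∷ g) = ≋-trans
    (+ₚ-cong (scale-+ˡ c d h) (≋-trans (∷-cong refl (*ₚ-distribʳ h f g)) (shift-+ (f *ₚ h) (g *ₚ h))))
    (+ₚ-interchange (scale c h) (scale d h) (shift (f *ₚ h)) (shift (g *ₚ h)))

  *ₚ-∷ : ∀ f d g → (f *ₚ (d ∷ g)) ≋ (scale d f +ₚ shift (f *ₚ g))
  *ₚ-∷ []      d g = ≋-sym shift-[]
  *ₚ-∷ (c ∷ f) d g = ∷-cong (+-congʳ (*-comm c d))
    (≋-trans (+ₚ-cong ≋-refl (*ₚ-∷ f d g))
    (≋-trans (≋-sym (+ₚ-assoc (scale c g) (scale d f) _))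
    (≋-trans (+ₚ-cong (+ₚ-comm (scale c g) (scale d f)) ≋-refl)
             (+ₚ-assoc (scale d f) (scale c g) _))))

  *ₚ-comm : ∀ f g → (f *ₚ g) ≋ (g *ₚ f)
  *ₚ-comm []      g = ≋-sym ([]*ʳ g)
  *ₚ-comm (c ∷ f) g = ≋-trans (+ₚ-cong ≋-refl (∷-cong refl (*ₚ-comm f g))) (≋-sym (*ₚ-∷ g c f))

  scale-*ₚ : ∀ c f g → (scale c f *ₚ g) ≋ scale c (f *ₚ g)
  scale-*ₚ c []      g = ≋-refl
  scale-*ₚ c (d ∷ f) g = ≋-trans
    (+ₚ-cong (scale-scale c d g) (≋-trans (∷-cong refl (scale-*ₚ c f g)) (≋-sym (scale-shift c (f *ₚ g)))))
    (≋-sym (scale-+ c (scale d g) (shift (f *ₚ g))))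

  shift-*ₚ : ∀ f g → (shift f *ₚ g) ≋ shift (f *ₚ g)
  shift-*ₚ f g = +ₚ-cong (scale-0 g) ≋-refl

  *ₚ-assoc : ∀ f g h → ((f *ₚ g) *ₚ h) ≋ (f *ₚ (g *ₚ h))
  *ₚ-assoc []      g h = ≋-refl
  *ₚ-assoc (c ∷ f) g h = ≋-trans (*ₚ-distribʳ h (scale c g) (shift (f *ₚ g)))
    (+ₚ-cong (scale-*ₚ c g h) (≋-trans (shift-*ₚ (f *ₚ g) h) (∷-cong refl (*ₚ-assoc f g h))))

  *ₚ-identityˡ : ∀ f → (1ₚ *ₚ f) ≋ f
  *ₚ-identityˡ f = ≋-trans (+ₚ-cong (scale-1 f) shift-[]) (+ₚ-identityʳ f)

  abstract
    polynomial-isCommutativeRing : IsCommutativeRing _≋_ _+ₚ_ _*ₚ_ -ₚ_ [] 1ₚ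
    polynomial-isCommutativeRing = record
      { isRing = record
        { +-isAbelianGroup = record
          { isGroup = record
            { isMonoid = record
              { isSemigroup = record
                { isMagma = record
                  { isEquivalence = record { refl = ≋-refl ; sym = ≋-sym ; trans = ≋-trans }
                  ; ∙-cong = +ₚ-cong }
                ; assoc = +ₚ-assoc }
              ; identity = (λ f → ≋-refl) , +ₚ-identityʳ }
            ; inverse = (λ f → ≋-trans (+ₚ-comm (-ₚ f) f) (-ₚ-inverseʳ f)) , -ₚ-inverseʳ
            ; ⁻¹-cong = -ₚ-cong }
          ; comm = +ₚ-comm }
        ; *-cong = λ {f} {f′} {g} p q → ≋-trans (*ₚ-congʳ f f′ g p) (*ₚ-congˡ f′ q)
        ; *-assoc = *ₚ-assoc
        ; *-identity = *ₚ-identityˡ , λ f → ≋-trans (*ₚ-comm f 1ₚ) (*ₚ-identityˡ f)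
        ; distrib = (λ f g h → ≋-trans (*ₚ-comm f (g +ₚ h)) (≋-trans (*ₚ-distribʳ f g h)
                       (+ₚ-cong (*ₚ-comm g f) (*ₚ-comm h f))))
                  , *ₚ-distribʳ }
      ; *-comm = *ₚ-comm }

  R[X] : CommutativeRing a ℓ
  R[X] = record { isCommutativeRing = polynomial-isCommutativeRing }

  infix 4 deg_<_
  -- A bound instead of a degree, since the true length of a coefficient list cannot be computed
  -- without deciding equality. The zero polynomial is the one with bound 0.
  deg_<_ : Polynomial → ℕ → Set ℓ
  deg f < d = ∀ k → d ≤ k → coeff f k ≈ 0#

  deg-length : ∀ f → deg f < length f
  deg-length []      k       _         = refl
  deg-length (c ∷ f) (suc k) (s≤s l≤k) = deg-length f k l≤k

  deg-mono : ∀ {f d e} → d ≤ e → deg f < d → deg f < e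
  deg-mono d≤e p k e≤k = p k (ℕₚ.≤-trans d≤e e≤k)

  deg-resp : ∀ {f g d} → f ≋ g → deg f < d → deg g < d
  deg-resp p q k d≤k = trans (sym (at p k)) (q k d≤k)

  deg-+ₚ : ∀ {f g d} → deg f < d → deg g < d → deg (f +ₚ g) < d
  deg-+ₚ {f} {g} p q k d≤k = trans (coeff-+ f g k) (trans (+-cong (p k d≤k) (q k d≤k)) (+-identityˡ _))

  deg-neg : ∀ {f d} → deg f < d → deg (-ₚ f) < d
  deg-neg {f} p k d≤k = trans (coeff-neg f k) (trans (-‿cong (p k d≤k)) -0#≈0#)

  deg-scale : ∀ c {f d} → deg f < d → deg (scale c f) < d
  deg-scale c {f} p k d≤k = trans (coeff-scale c f k) (trans (*-congˡ (p k d≤k)) (zeroʳ c))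

  deg-0 : ∀ {f} → deg f < 0 → f ≋ []
  deg-0 p = coeffs λ k → p k z≤n

  -- The second bound is a successor so that the sharp bound on the product needs no truncated
  -- subtraction.
  deg-*ₚ : ∀ f g d {e} → deg f < d → deg g < suc e → deg (f *ₚ g) < d ℕ.+ e
  deg-*ₚ []      g d       p q k d+e≤k = refl
  deg-*ₚ (c ∷ f) g zero    p q k d+e≤k = at (*ₚ-zeroˡ (c ∷ f) g (deg-0 {c ∷ f} p)) k
  deg-*ₚ (c ∷ f) g (suc d) {e} p q zero    ()
  deg-*ₚ (c ∷ f) g (suc d) {e} p q (suc k) (s≤s d+e≤k) = trans
    (coeff-+ (scale c g) (shift (f *ₚ g)) (suc k))
    (trans (+-cong (deg-scale c {g} q (suc k) (s≤s (ℕₚ.≤-trans (ℕₚ.m≤n+m e d) d+e≤k)))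
                   (deg-*ₚ f g d (λ j d≤j → p (suc j) (s≤s d≤j)) q k d+e≤k))
           (+-identityˡ _))

  module _ {n f} (monic : Monic n f) where

    monic-deg : deg f < suc n
    monic-deg = proj₂ monic

    -- Recursion from the constant term: if `g = q f + r`, then `c + x g` leaves `c + x r`, of
    -- degree at most `n`, and subtracting `t f` with `t` its coefficient at `n` removes the top, as
    -- `f` is monic.
    divide : ∀ g → ∃[ q ] ∃[ r ] (g ≋ (q *ₚ f +ₚ r) × deg r < n)
    divide []      = [] , [] , ≋-refl , λ k _ → refl
    divide (c ∷ g) with divide g
    ... | q , r , p , deg-r = (t ∷ q) , ((c ∷ r) +ₚ -ₚ scale t f) , coeffs eq , bound
      where
      t = coeff (c ∷ r) n
      low : ∀ k → coeff ((c ∷ r) +ₚ -ₚ scale t f) k ≈ coeff (c ∷ r) k - t * coeff f k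
      low k = trans (coeff-+ (c ∷ r) (-ₚ scale t f) k)
        (+-congˡ (trans (coeff-neg (scale t f) k) (-‿cong (coeff-scale t f k))))
      expand : ∀ k → coeff ((t ∷ q) *ₚ f +ₚ ((c ∷ r) +ₚ -ₚ scale t f)) k ≈
                     (t * coeff f k + coeff (shift (q *ₚ f)) k) + (coeff (c ∷ r) k - t * coeff f k)
      expand k = trans (coeff-+ ((t ∷ q) *ₚ f) _ k)
        (+-cong (trans (coeff-+ (scale t f) (shift (q *ₚ f)) k) (+-congʳ (coeff-scale t f k))) (low k))
      eq : ∀ k → coeff (c ∷ g) k ≈ coeff ((t ∷ q) *ₚ f +ₚ ((c ∷ r) +ₚ -ₚ scale t f)) k
      eq zero    = sym (trans (expand 0)
        (solve 2 (λ m c → (m :+ con (+ 0)) :+ (c :- m) := c) refl (t * coeff f 0) c))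
      eq (suc k) = sym (trans (expand (suc k)) (trans
        (solve 3 (λ m s c → (m :+ s) :+ (c :- m) := s :+ c) refl (t * coeff f (suc k)) (coeff (q *ₚ f) k) (coeff r k))
        (sym (trans (at p k) (coeff-+ (q *ₚ f) r k)))))
      bound : deg ((c ∷ r) +ₚ -ₚ scale t f) < n
      bound k n≤k with n ℕₚ.≟ k
      ... | yes ≡.refl = trans (low n) (trans (+-congˡ (-‿cong (trans (*-congˡ (proj₁ monic)) (*-identityʳ t))))
                               (-‿inverseʳ t))
      bound zero n≤k | no n≢k with () ← n≢k (ℕₚ.n≤0⇒n≡0 n≤k)
      bound (suc k) n≤k | no n≢k with ℕₚ.≤∧≢⇒< n≤k n≢k
      ... | n<k@(s≤s n≤k′) = trans (low (suc k)) (trans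
        (+-cong (deg-r k n≤k′) (-‿cong (trans (*-congˡ (monic-deg (suc k) n<k)) (zeroʳ t))))
        (-‿inverseʳ 0#))

    private
      coeff-∷-* : ∀ c q k → coeff ((c ∷ q) *ₚ f) k ≈ c * coeff f k + coeff (shift (q *ₚ f)) k
      coeff-∷-* c q k = trans (coeff-+ (scale c f) (shift (q *ₚ f)) k) (+-congʳ (coeff-scale c f k))

      above : ∀ c q k → n ≤ k → coeff (q *ₚ f) k ≈ coeff ((c ∷ q) *ₚ f) (suc k)
      above c q k n≤k = sym (trans (coeff-∷-* c q (suc k)) (trans
        (+-congʳ (trans (*-congˡ (monic-deg (suc k) (s≤s n≤k))) (zeroʳ c))) (+-identityˡ _)))

    -- A monic factor raises the degree by exactly `n`, even over a ring with zero divisors.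
    -- Coefficients of `(c ∷ q) f` beyond `n` are those of `q f`, which gives the induction. For
    -- `d = 0` it follows that `q` vanishes, and then `c` is the coefficient at `n`.
    deg-cancel : ∀ q {d} → deg (q *ₚ f) < d ℕ.+ n → deg q < d
    deg-cancel []      p k d≤k = refl
    deg-cancel (c ∷ q) {suc e} p (suc k) (s≤s e≤k) = deg-cancel q
      (λ j e+n≤j → trans (above c q j (ℕₚ.≤-trans (ℕₚ.m≤n+m n e) e+n≤j)) (p (suc j) (s≤s e+n≤j))) k e≤k
    deg-cancel (c ∷ q) {zero} p = λ { zero _ → c≈0 ; (suc k) _ → at q≋0 k }
      where
      q≋0 : q ≋ []
      q≋0 = deg-0 {q} (deg-cancel q (λ k n≤k → trans (above c q k n≤k) (p (suc k) (ℕₚ.m≤n⇒m≤1+n n≤k))))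
      shifted : ∀ k → coeff (shift (q *ₚ f)) k ≈ 0#
      shifted zero    = refl
      shifted (suc k) = at (*ₚ-zeroˡ q f q≋0) k
      c≈0 : c ≈ 0#
      c≈0 = trans (sym (trans (+-cong (trans (*-congˡ (proj₁ monic)) (*-identityʳ c)) (shifted n)) (+-identityʳ c)))
        (trans (sym (coeff-∷-* c q n)) (p n ℕₚ.≤-refl))

module Derivative {a ℓ} (R : CommutativeRing a ℓ) where
  open CommutativeRing R hiding (zero)
  open PolynomialRing R
  open SemiringMult semiring using () renaming (_×_ to _⨯_)
  private module P = CommutativeRing R[X]
  open SemiringMult P.semiring using () renaming (_×_ to _⨯ₚ_; ×-assoc-* to ⨯-*; ×-congʳ to ⨯-congʳ)
  open SemiringExp P.semiring using (_^_)
  open Solver R[X]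
  open SetoidReasoning P.setoid

  -- The recursion defining `derivative` acts on lists and does not visibly respect `≋`;
  -- compatibility and the degree bound are read off this coefficient formula.
  coeff-derivative : ∀ f k → coeff (derivative f) k ≈ suc k ⨯ coeff f (suc k)
  coeff-derivative []      k       = sym (vanish (suc k))
    where
    vanish : ∀ k → k ⨯ 0# ≈ 0#
    vanish zero    = refl
    vanish (suc k) = trans (+-identityˡ _) (vanish k)
  coeff-derivative (c ∷ f) zero    = coeff-+ f (shift (derivative f)) 0
  coeff-derivative (c ∷ f) (suc k) = trans (coeff-+ f (shift (derivative f)) (suc k)) (+-congˡ (coeff-derivative f k))

  ⨯-cong : ∀ k {x y} → x ≈ y → k ⨯ x ≈ k ⨯ y
  ⨯-cong zero    p = refl
  ⨯-cong (suc k) p = +-cong p (⨯-cong k p)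

  derivative-cong : ∀ {f g} → f ≋ g → derivative f ≋ derivative g
  derivative-cong {f} {g} p = coeffs λ k → trans (coeff-derivative f k)
    (trans (⨯-cong (suc k) (at p (suc k))) (sym (coeff-derivative g k)))

  derivative-deg : ∀ f {d} → deg f < suc d → deg (derivative f) < d
  derivative-deg f {d} p k d≤k = trans (coeff-derivative f k)
    (trans (⨯-cong (suc k) (p (suc k) (s≤s d≤k))) (sym (coeff-derivative [] k)))

  derivative-+ : ∀ f g → derivative (f +ₚ g) ≋ derivative f +ₚ derivative g
  derivative-+ []      g       = ≋-refl
  derivative-+ (c ∷ f) []      = ≋-sym (+ₚ-identityʳ _)
  derivative-+ (c ∷ f) (d ∷ g) = ≋-trans
    (+ₚ-cong ≋-refl (≋-trans (∷-cong refl (derivative-+ f g)) (shift-+ (derivative f) (derivative g))))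
    (+ₚ-interchange f g _ _)

  derivative-scale : ∀ c f → derivative (scale c f) ≋ scale c (derivative f)
  derivative-scale c []      = ≋-refl
  derivative-scale c (d ∷ f) = ≋-trans
    (+ₚ-cong ≋-refl (≋-trans (∷-cong refl (derivative-scale c f)) (≋-sym (scale-shift c (derivative f)))))
    (≋-sym (scale-+ c f (shift (derivative f))))

  derivative-* : ∀ f g → derivative (f *ₚ g) ≋ derivative f *ₚ g +ₚ f *ₚ derivative g
  derivative-* []      g = ≋-refl
  derivative-* (c ∷ f) g = begin
    derivative (scale c g +ₚ shift (f *ₚ g))
      ≈⟨ derivative-+ (scale c g) (shift (f *ₚ g)) ⟩
    derivative (scale c g) +ₚ (f *ₚ g +ₚ shift (derivative (f *ₚ g)))
      ≈⟨ +ₚ-cong (derivative-scale c g) (+ₚ-cong (≋-refl {f *ₚ g})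
           (≋-trans (∷-cong refl (derivative-* f g)) (shift-+ (derivative f *ₚ g) (f *ₚ derivative g)))) ⟩
    scale c (derivative g) +ₚ (f *ₚ g +ₚ (shift (derivative f *ₚ g) +ₚ shift (f *ₚ derivative g)))
      ≈⟨ solve 4 (λ s p q r → s :+ (p :+ (q :+ r)) := (p :+ q) :+ (s :+ r)) ≋-refl
           (scale c (derivative g)) (f *ₚ g) (shift (derivative f *ₚ g)) (shift (f *ₚ derivative g)) ⟩
    (f *ₚ g +ₚ shift (derivative f *ₚ g)) +ₚ (scale c (derivative g) +ₚ shift (f *ₚ derivative g))
      ≈⟨ +ₚ-cong (+ₚ-cong (≋-refl {f *ₚ g}) (≋-sym (shift-*ₚ (derivative f) g))) ≋-refl ⟩
    (f *ₚ g +ₚ shift (derivative f) *ₚ g) +ₚ (c ∷ f) *ₚ derivative g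
      ≈⟨ +ₚ-cong (*ₚ-distribʳ g f (shift (derivative f))) ≋-refl ⟨
    derivative (c ∷ f) *ₚ g +ₚ (c ∷ f) *ₚ derivative g ∎

  derivative-neg : ∀ f → derivative (-ₚ f) ≋ -ₚ derivative f
  derivative-neg f = begin
    derivative (-ₚ f)
      ≈⟨ solve 2 (λ x y → x := (x :+ y) :- y) ≋-refl (derivative (-ₚ f)) (derivative f) ⟩
    (derivative (-ₚ f) +ₚ derivative f) +ₚ -ₚ derivative f
      ≈⟨ +ₚ-cong (≋-trans (≋-sym (derivative-+ (-ₚ f) f)) (derivative-cong (P.-‿inverseˡ f))) (≋-refl { -ₚ derivative f}) ⟩
    -ₚ derivative f ∎

  derivative-^ : ∀ f m → derivative (f ^ suc m) ≋ suc m ⨯ₚ (derivative f *ₚ f ^ m)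
  derivative-^ f zero    = begin
    derivative (f *ₚ 1ₚ)                                  ≈⟨ derivative-cong (P.*-identityʳ f) ⟩
    derivative f                                          ≈⟨ P.*-identityʳ (derivative f) ⟨
    derivative f *ₚ 1ₚ                                    ≈⟨ P.+-identityʳ _ ⟨
    derivative f *ₚ 1ₚ +ₚ []                              ∎
  derivative-^ f (suc m) = begin
    derivative (f *ₚ f ^ suc m)
      ≈⟨ derivative-* f (f ^ suc m) ⟩
    derivative f *ₚ f ^ suc m +ₚ f *ₚ derivative (f ^ suc m)
      ≈⟨ P.+-congˡ {derivative f *ₚ f ^ suc m} (P.*-congˡ {f} (derivative-^ f m)) ⟩
    derivative f *ₚ f ^ suc m +ₚ f *ₚ (suc m ⨯ₚ (derivative f *ₚ f ^ m))
      ≈⟨ P.+-congˡ {derivative f *ₚ f ^ suc m} (≋-trans (P.*-comm f _) (⨯-* (suc m) (derivative f *ₚ f ^ m) f)) ⟩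
    derivative f *ₚ f ^ suc m +ₚ suc m ⨯ₚ ((derivative f *ₚ f ^ m) *ₚ f)
      ≈⟨ P.+-congˡ {derivative f *ₚ f ^ suc m} (⨯-congʳ (suc m)
           (solve 3 (λ d e f → (d :* e) :* f := d :* (f :* e)) ≋-refl (derivative f) (f ^ m) f)) ⟩
    suc (suc m) ⨯ₚ (derivative f *ₚ f ^ suc m) ∎

-- Homomorphisms, evaluation and change of coefficients

_∘ʰ_ : ∀ {a ℓ₁ b ℓ₂ c ℓ₃} {R : CommutativeRing a ℓ₁} {S : CommutativeRing b ℓ₂} {T : CommutativeRing c ℓ₃} →
       RingHom S T → RingHom R S → RingHom R T
_∘ʰ_ {T = T} ψ φ = record
  { fun = ψ.fun ∘ φ.fun
  ; isRingHomomorphism = record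
    { isSemiringHomomorphism = record
      { isNearSemiringHomomorphism = record
        { +-isMonoidHomomorphism = record
          { isMagmaHomomorphism = record
            { isRelHomomorphism = record { cong = ψ.⟦⟧-cong ∘ φ.⟦⟧-cong }
            ; homo = λ x y → trans (ψ.⟦⟧-cong (φ.+-homo x y)) (ψ.+-homo _ _) }
          ; ε-homo = trans (ψ.⟦⟧-cong φ.0#-homo) ψ.0#-homo }
        ; *-homo = λ x y → trans (ψ.⟦⟧-cong (φ.*-homo x y)) (ψ.*-homo _ _) }
      ; 1#-homo = trans (ψ.⟦⟧-cong φ.1#-homo) ψ.1#-homo }
    ; -‿homo = λ x → trans (ψ.⟦⟧-cong (φ.-‿homo x)) (ψ.-‿homo _) } }
  where
  module ψ = RingHom ψ
  module φ = RingHom φ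
  open CommutativeRing T using (trans)

subring-hom : ∀ {a ℓ p} (R : CommutativeRing a ℓ) (P : CommutativeRing.Carrier R → Set p) (S : IsSubring R P) →
              RingHom (subring R P S) R
subring-hom R P S = record
  { fun = proj₁ ; isRingHomomorphism = IsRingMonomorphism.isRingHomomorphism (subring-inclusion R P S) }
  where
  open import Algebra.Morphism.Structures using (module RingMorphisms)
  open RingMorphisms (rawSubring R P S) (CommutativeRing.rawRing R) using (module IsRingMonomorphism)

module Evaluation {a ℓ₁ b ℓ₂} {K : CommutativeRing a ℓ₁} {F : CommutativeRing b ℓ₂} (φ : RingHom K F)
                  (x : CommutativeRing.Carrier F) where
  open CommutativeRing F hiding (zero)
  open PolynomialRing K
  open RingHom φ using (fun; ⟦⟧-cong; +-homo; *-homo; 0#-homo)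
  open Solver F

  ev : Polynomial → Carrier
  ev f = eval F fun f x

  private
    ev-0 : ∀ f → f ≋ [] → ev f ≈ 0#
    ev-0 []      p = refl
    ev-0 (c ∷ f) p = trans
      (+-cong (trans (⟦⟧-cong (at p 0)) 0#-homo) (trans (*-congˡ (ev-0 f (coeffs (at p ∘ suc)))) (zeroʳ x)))
      (+-identityˡ 0#)

  ev-cong : ∀ f g → f ≋ g → ev f ≈ ev g
  ev-cong []      g       p = sym (ev-0 g (≋-sym p))
  ev-cong (c ∷ f) []      p = ev-0 (c ∷ f) p
  ev-cong (c ∷ f) (d ∷ g) p = +-cong (⟦⟧-cong (at p 0)) (*-congˡ (ev-cong f g (∷-injectiveʳ p)))

  ev-+ : ∀ f g → ev (f +ₚ g) ≈ ev f + ev g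
  ev-+ []      g       = sym (+-identityˡ _)
  ev-+ (c ∷ f) []      = sym (+-identityʳ _)
  ev-+ (c ∷ f) (d ∷ g) = trans (+-cong (+-homo c d) (*-congˡ (ev-+ f g)))
    (solve 5 (λ c d x f g → (c :+ d) :+ x :* (f :+ g) := (c :+ x :* f) :+ (d :+ x :* g)) refl
      (fun c) (fun d) x (ev f) (ev g))

  ev-scale : ∀ c f → ev (scale c f) ≈ fun c * ev f
  ev-scale c []      = sym (zeroʳ _)
  ev-scale c (d ∷ f) = trans (+-cong (*-homo c d) (*-congˡ (ev-scale c f)))
    (solve 4 (λ c d x f → c :* d :+ x :* (c :* f) := c :* (d :+ x :* f)) refl (fun c) (fun d) x (ev f))

  ev-shift : ∀ f → ev (shift f) ≈ x * ev f
  ev-shift f = trans (+-congʳ 0#-homo) (+-identityˡ _)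

  ev-* : ∀ f g → ev (f *ₚ g) ≈ ev f * ev g
  ev-* []      g = sym (zeroˡ _)
  ev-* (c ∷ f) g = trans (ev-+ (scale c g) (shift (f *ₚ g)))
    (trans (+-cong (ev-scale c g) (trans (ev-shift (f *ₚ g)) (*-congˡ (ev-* f g))))
      (solve 4 (λ c x f g → c :* g :+ x :* (f :* g) := (c :+ x :* f) :* g) refl (fun c) x (ev f) (ev g)))

  ev-neg : ∀ f → ev (-ₚ f) ≈ - ev f
  ev-neg f = trans (solve 2 (λ u v → u := (u :+ v) :- v) refl (ev (-ₚ f)) (ev f))
    (trans (+-congʳ (trans (sym (ev-+ (-ₚ f) f)) (ev-0 (-ₚ f +ₚ f) (CommutativeRing.-‿inverseˡ R[X] f))))
      (+-identityˡ _))

  ev-constant : ∀ c → ev (constant c) ≈ fun c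
  ev-constant c = trans (+-congˡ (zeroʳ x)) (+-identityʳ _)

module _ {a ℓ₁ b ℓ₂} {K : CommutativeRing a ℓ₁} {F : CommutativeRing b ℓ₂} (φ : RingHom K F) where
  open RingHom φ using (fun; ⟦⟧-cong; +-homo; 0#-homo; 1#-homo)
  open CommutativeRing F using (_≈_; refl; sym; trans; +-cong)
  private
    module K = PolynomialRing K
    module F = PolynomialRing F

  coeff-map : ∀ f k → F.coeff (map fun f) k ≈ fun (K.coeff f k)
  coeff-map []      k       = sym 0#-homo
  coeff-map (c ∷ f) zero    = refl
  coeff-map (c ∷ f) (suc k) = coeff-map f k

  monic-map : ∀ {n f} → K.Monic n f → F.Monic n (map fun f)
  monic-map {n} {f} (lead , high) =
    trans (coeff-map f n) (trans (⟦⟧-cong lead) 1#-homo) ,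
    λ k n<k → trans (coeff-map f k) (trans (⟦⟧-cong (high k n<k)) 0#-homo)

  deg-map : ∀ {f d} → K.deg f < d → F.deg map fun f < d
  deg-map {f} p k d≤k = trans (coeff-map f k) (trans (⟦⟧-cong (p k d≤k)) 0#-homo)

  map-+ₚ : ∀ f g → map fun (f K.+ₚ g) F.≋ map fun f F.+ₚ map fun g
  map-+ₚ f g = F.coeffs λ k → trans (coeff-map (f K.+ₚ g) k) (trans (⟦⟧-cong (K.coeff-+ f g k))
    (trans (+-homo _ _) (sym (trans (F.coeff-+ (map fun f) (map fun g) k)
      (+-cong (coeff-map f k) (coeff-map g k))))))

  map-derivative : ∀ f → map fun (K.derivative f) F.≋ F.derivative (map fun f)
  map-derivative []      = F.≋-refl
  map-derivative (c ∷ f) = F.≋-trans (map-+ₚ f (K.shift (K.derivative f)))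
    (F.+ₚ-cong F.≋-refl (F.∷-cong 0#-homo (map-derivative f)))

module _ {b ℓ} (E : CommutativeRing b ℓ) {a a′} {A : Set a} {B : Set a′} where
  open CommutativeRing E using (Carrier; _+_; _*_)

  eval-map : ∀ (ψ : B → Carrier) (φ : A → B) f x → eval E ψ (map φ f) x ≡ eval E (ψ ∘ φ) f x
  eval-map ψ φ []      x = ≡.refl
  eval-map ψ φ (c ∷ f) x = ≡.cong (λ r → ψ (φ c) + x * r) (eval-map ψ φ f x)

-- Determinants and resultants

module Determinant {a ℓ} (R : CommutativeRing a ℓ) where
  open CommutativeRing R hiding (zero)
  open Polynomials R using (det)
  open SemiringSum semiring using (sum; sum-cong-≋; *-distribˡ-sum)
  open SemiringExp semiring using (_^_)
  open RingProperties (CommutativeRing.ring R) using (-1*x≈-x; -0#≈0#)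
  open Solver R
  open SetoidReasoning setoid

  sgn : ∀ {n} → Fin n → Carrier
  sgn j = (- 1#) ^ toℕ j

  sgn*sgn : ∀ k → (- 1#) ^ k * (- 1#) ^ k ≈ 1#
  sgn*sgn zero    = *-identityˡ 1#
  sgn*sgn (suc k) = begin
    (- 1# * s) * (- 1# * s)  ≈⟨ *-cong (-1*x≈-x s) (-1*x≈-x s) ⟩
    - s * - s                ≈⟨ solve 1 (λ s → (:- s) :* (:- s) := s :* s) refl s ⟩
    s * s                    ≈⟨ sgn*sgn k ⟩
    1#                       ∎
    where s = (- 1#) ^ k

  det-cong : ∀ {n} {A B : Fin n → Fin n → Carrier} → (∀ i j → A i j ≈ B i j) → det A ≈ det B
  det-cong {zero}  A≈B = refl
  det-cong {suc n} A≈B = sum-cong-≋ {suc n} λ j →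
    *-congˡ {sgn j} (*-cong (A≈B zero j) (det-cong λ i k → A≈B (suc i) (punchIn j k)))

  module _ {x} {X : Set x} where

    private
      Row = X → Carrier

    -- Laplace expansion along the row a, with G computing the minors.  By
    -- recursion on the columns, alternation becomes a direct induction.
    expansion : ∀ {n} → Row → (Vec X n → Carrier) → Vec X (suc n) → Carrier
    expansion {zero}  a G (s ∷ []) = a s * G []
    expansion {suc n} a G (s ∷ σ)  = a s * G σ - expansion a (G ∘ (s ∷_)) σ

    expansion-cong : ∀ {n a b} {G H : Vec X n → Carrier} → (∀ s → a s ≈ b s) → (∀ σ → G σ ≈ H σ) →
                     ∀ σ → expansion a G σ ≈ expansion b H σ
    expansion-cong {zero}  a≈b G≈H (s ∷ []) = *-cong (a≈b s) (G≈H [])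
    expansion-cong {suc n} a≈b G≈H (s ∷ σ)  =
      +-cong (*-cong (a≈b s) (G≈H σ)) (-‿cong (expansion-cong a≈b (G≈H ∘ (s ∷_)) σ))

    -- The combination `c * G - H` is exactly the shape that `expansion` takes on vectors beginning
    -- with a fixed column, so an inner expansion can be pulled through an outer one.
    expansion-linear : ∀ {n} a c (G H : Vec X n → Carrier) σ →
      expansion a (λ τ → c * G τ - H τ) σ ≈ c * expansion a G σ - expansion a H σ
    expansion-linear {zero}  a c G H (s ∷ []) =
      solve 4 (λ a c g h → a :* (c :* g :- h) := c :* (a :* g) :- a :* h) refl (a s) c (G []) (H [])
    expansion-linear {suc n} a c G H (s ∷ σ)  = trans
      (+-congˡ (-‿cong (expansion-linear a c (G ∘ (s ∷_)) (H ∘ (s ∷_)) σ)))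
      (solve 6 (λ a c g h u v → a :* (c :* g :- h) :- (c :* u :- v) := c :* (a :* g :- u) :- (a :* h :- v)) refl
        (a s) c (G σ) (H σ) (expansion a (G ∘ (s ∷_)) σ) (expansion a (H ∘ (s ∷_)) σ))

    -- The first column is chosen either by the outer or by the inner expansion. The two
    -- contributions are equal with opposite signs, and what remains has the first column fixed in
    -- `G`.
    expansion-alternating : ∀ {n} a (G : Vec X n → Carrier) σ → expansion a (expansion a G) σ ≈ 0#
    expansion-alternating {zero}  a G (s ∷ t ∷ []) =
      solve 3 (λ a b g → a :* (b :* g) :- b :* (a :* g) := con (+ 0)) refl (a s) (a t) (G [])
    expansion-alternating {suc n} a G (s ∷ σ) = begin
      a s * E - expansion a (expansion a G ∘ (s ∷_)) σ
        ≈⟨ +-congˡ (-‿cong (expansion-linear a (a s) G (expansion a (G ∘ (s ∷_))) σ)) ⟩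
      a s * E - (a s * E - expansion a (expansion a (G ∘ (s ∷_))) σ)
        ≈⟨ +-congˡ (-‿cong (+-congˡ (-‿cong (expansion-alternating a (G ∘ (s ∷_)) σ)))) ⟩
      a s * E - (a s * E - 0#)
        ≈⟨ solve 1 (λ m → m :- (m :- con (+ 0)) := con (+ 0)) refl (a s * E) ⟩
      0# ∎
      where E = expansion a G σ

    -- The polarised form of `expansion-alternating`, by the same cancellation in the first column.
    -- It moves a row past its neighbour.
    expansion-swap : ∀ {n} a b (G : Vec X n → Carrier) σ →
                     expansion a (expansion b G) σ + expansion b (expansion a G) σ ≈ 0#
    expansion-swap {zero}  a b G (s ∷ t ∷ []) =
      solve 5 (λ a b a′ b′ g → (a :* (b′ :* g) :- a′ :* (b :* g)) :+ (b :* (a′ :* g) :- b′ :* (a :* g)) := con (+ 0))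
        refl (a s) (b s) (a t) (b t) (G [])
    expansion-swap {suc n} a b G (s ∷ σ) = begin
      (a s * Eb - expansion a (expansion b G ∘ (s ∷_)) σ) + (b s * Ea - expansion b (expansion a G ∘ (s ∷_)) σ)
        ≈⟨ +-cong (+-congˡ (-‿cong (expansion-linear a (b s) G (expansion b (G ∘ (s ∷_))) σ)))
                  (+-congˡ (-‿cong (expansion-linear b (a s) G (expansion a (G ∘ (s ∷_))) σ))) ⟩
      (a s * Eb - (b s * Ea - u)) + (b s * Ea - (a s * Eb - v))
        ≈⟨ solve 4 (λ p q u v → (p :- (q :- u)) :+ (q :- (p :- v)) := u :+ v) refl (a s * Eb) (b s * Ea) u v ⟩
      u + v
        ≈⟨ expansion-swap a b (G ∘ (s ∷_)) σ ⟩
      0# ∎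
      where
      Ea = expansion a G σ
      Eb = expansion b G σ
      u  = expansion a (expansion b (G ∘ (s ∷_))) σ
      v  = expansion b (expansion a (G ∘ (s ∷_))) σ

    lookup-removeAt : ∀ {n} (σ : Vec X (suc n)) j k → lookup (removeAt σ j) k ≡ lookup σ (punchIn j k)
    lookup-removeAt (s ∷ σ)     zero    k       = ≡.refl
    lookup-removeAt (s ∷ t ∷ σ) (suc j) zero    = ≡.refl
    lookup-removeAt (s ∷ t ∷ σ) (suc j) (suc k) = lookup-removeAt (t ∷ σ) j k

    expansion-sum : ∀ {n} a (G : Vec X n → Carrier) σ →
                    sum (λ j → sgn j * (a (lookup σ j) * G (removeAt σ j))) ≈ expansion a G σ
    expansion-sum {zero}  a G (s ∷ []) = trans (+-identityʳ _) (*-identityˡ _)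
    expansion-sum {suc n} a G (s ∷ σ@(_ ∷ _))  = begin
      1# * (a s * G σ) + sum (λ j → (- 1# * sgn j) * (a (lookup σ j) * G (s ∷ removeAt σ j)))
        ≈⟨ +-cong (*-identityˡ _) (sum-cong-≋ λ j → *-assoc (- 1#) (sgn j) (a (lookup σ j) * G (s ∷ removeAt σ j))) ⟩
      a s * G σ + sum (λ j → - 1# * (sgn j * (a (lookup σ j) * G (s ∷ removeAt σ j))))
        ≈⟨ +-congˡ (*-distribˡ-sum (- 1#) (λ j → sgn j * (a (lookup σ j) * G (s ∷ removeAt σ j)))) ⟨
      a s * G σ + - 1# * sum (λ j → sgn j * (a (lookup σ j) * G (s ∷ removeAt σ j)))
        ≈⟨ +-congˡ (-1*x≈-x _) ⟩
      a s * G σ - sum (λ j → sgn j * (a (lookup σ j) * G (s ∷ removeAt σ j)))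
        ≈⟨ +-congˡ (-‿cong (expansion-sum a (G ∘ (s ∷_)) σ)) ⟩
      a s * G σ - expansion a (G ∘ (s ∷_)) σ ∎

    minor : ∀ {n} → (Fin n → Row) → Vec X n → Carrier
    minor r σ = det (λ i k → r i (lookup σ k))

    minor-expansion : ∀ {n} (r : Fin (suc n) → Row) σ → minor r σ ≈ expansion (r zero) (minor (r ∘ suc)) σ
    minor-expansion r σ = trans
      (sum-cong-≋ λ j → *-congˡ {sgn j} (*-congˡ {r zero (lookup σ j)} (det-cong λ i k →
        reflexive (≡.cong (r (suc i)) (≡.sym (lookup-removeAt σ j k))))))
      (expansion-sum (r zero) (minor (r ∘ suc)) σ)

    minor-expansion₂ : ∀ {n} (r : Fin (suc (suc n)) → Row) σ →
      minor r σ ≈ expansion (r zero) (expansion (r (suc zero)) (minor (λ i → r (suc (suc i))))) σ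
    minor-expansion₂ r σ = trans (minor-expansion r σ)
      (expansion-cong (λ s → refl) (minor-expansion (r ∘ suc)) σ)

    -- Adjacent equal rows vanish by alternation. Otherwise rows 0 and 1 are exchanged at the cost
    -- of a sign; the inner minors are then those of `r′`, where row 1 is dropped and the copy of
    -- row 0 is one step nearer.
    minor-repeated : ∀ {n} (r : Fin (suc n) → Row) i → (∀ s → r zero s ≈ r (suc i) s) → ∀ σ → minor r σ ≈ 0#
    minor-repeated {suc n} r zero    eq σ = trans (minor-expansion₂ r σ)
      (trans (expansion-cong eq (λ τ → refl) σ) (expansion-alternating (r (suc zero)) _ σ))
    minor-repeated {suc n} r (suc i) eq σ = begin
      minor r σ          ≈⟨ minor-expansion₂ r σ ⟩
      u                  ≈⟨ solve 2 (λ u v → u := (u :+ v) :- v) refl u v ⟩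
      (u + v) - v        ≈⟨ +-cong (expansion-swap (r zero) (r (suc zero)) G σ) (-‿cong vanish) ⟩
      0# - 0#            ≈⟨ -‿inverseʳ 0# ⟩
      0#                 ∎
      where
      G = minor (λ i → r (suc (suc i)))
      u = expansion (r zero) (expansion (r (suc zero)) G) σ
      v = expansion (r (suc zero)) (expansion (r zero) G) σ
      r′ : Fin (suc n) → Row
      r′ zero    = r zero
      r′ (suc k) = r (suc (suc k))
      expansion-0 : ∀ {m} a (σ : Vec X (suc m)) → expansion a (λ _ → 0#) σ ≈ 0#
      expansion-0 {zero}  a (s ∷ []) = zeroʳ _
      expansion-0 {suc m} a (s ∷ σ)  = trans (+-cong (zeroʳ _) (trans (-‿cong (expansion-0 a σ)) -0#≈0#)) (+-identityˡ 0#)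
      vanish : v ≈ 0#
      vanish = trans
        (expansion-cong (λ s → refl) (λ τ → trans (sym (minor-expansion r′ τ)) (minor-repeated r′ i eq τ)) σ)
        (expansion-0 (r (suc zero)) σ)

  det-repeated : ∀ {n} (A : Fin (suc n) → Fin (suc n) → Carrier) i → (∀ k → A zero k ≈ A (suc i) k) → det A ≈ 0#
  det-repeated {n} A i eq = trans
    (det-cong λ j k → reflexive (≡.cong (A j) (≡.sym (lookup-allFin k))))
    (minor-repeated A i eq (allFin (suc n)))

module _ {a ℓ₁ b ℓ₂} {K : CommutativeRing a ℓ₁} {F : CommutativeRing b ℓ₂} (φ : RingHom K F) where
  private
    module K where
      open CommutativeRing K public
      open Polynomials K public using (det)
      open SemiringSum semiring public using (sum)
      open SemiringExp semiring public using (_^_)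
  open CommutativeRing F hiding (zero)
  open Polynomials F using (det)
  open SemiringSum semiring using (sum)
  open SemiringExp semiring using (_^_)
  open RingHom φ using (fun; +-homo; *-homo; 0#-homo; 1#-homo; -‿homo)

  sum-hom : ∀ {n} (v : Fin n → K.Carrier) → fun (K.sum v) ≈ sum (fun ∘ v)
  sum-hom {zero}  v = 0#-homo
  sum-hom {suc n} v = trans (+-homo _ _) (+-congˡ (sum-hom (v ∘ suc)))

  sgn-hom : ∀ k → fun ((K.- K.1#) K.^ k) ≈ (- 1#) ^ k
  sgn-hom zero    = 1#-homo
  sgn-hom (suc k) = trans (*-homo _ _) (*-cong (trans (-‿homo K.1#) (-‿cong 1#-homo)) (sgn-hom k))

  det-hom : ∀ {n} (A : Fin n → Fin n → K.Carrier) → fun (K.det A) ≈ det (λ i j → fun (A i j))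
  det-hom {zero}  A = 1#-homo
  det-hom {suc n} A = trans (sum-hom cofactor) (sum-cong-≋ λ j → trans (*-homo (sgn j) (A zero j K.* minor j))
    (*-cong (sgn-hom (toℕ j)) (trans (*-homo (A zero j) (minor j))
      (*-congˡ {fun (A zero j)} (det-hom λ i k → A (suc i) (punchIn j k))))))
    where
    open SemiringSum semiring using (sum-cong-≋)
    minor cofactor sgn : Fin (suc n) → K.Carrier
    sgn j      = (K.- K.1#) K.^ toℕ j
    minor j    = K.det (λ i k → A (suc i) (punchIn j k))
    cofactor j = sgn j K.* (A zero j K.* minor j)

module Kernel {c ℓ} (𝐅 : Field c ℓ) where
  open Field 𝐅 using (1≉0; invertible)
  private F = Field.ring 𝐅
  open CommutativeRing F hiding (zero)
  open Polynomials F using (det)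
  open SemiringSum semiring using (sum; sum-cong-≋; *-distribˡ-sum; sum-remove; ∑-distrib-+)
  open RingProperties (CommutativeRing.ring F) using (-0#≈0#)
  open Determinant F
  open Solver F
  open SetoidReasoning setoid

  zero-product : ∀ {x y} → x * y ≈ 0# → ¬ x ≈ 0# → y ≈ 0#
  zero-product {x} {y} xy≈0 x≉0 with invertible x x≉0
  ... | z , xz≈1 = begin
    y              ≈⟨ *-identityˡ y ⟨
    1# * y         ≈⟨ *-congʳ xz≈1 ⟨
    (x * z) * y    ≈⟨ solve 3 (λ x y z → (x :* z) :* y := z :* (x :* y)) refl x y z ⟩
    z * (x * y)    ≈⟨ *-congˡ xy≈0 ⟩
    z * 0#         ≈⟨ zeroʳ z ⟩
    0#             ∎

  -- If the cofactors along the first row do not all vanish, they form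
  -- a kernel vector.  Otherwise the minors yield two independent vectors
  -- killed by all rows but the first, and a combination kills that too.
  det≈0⇒kernel : ∀ n (A : Fin n → Fin n → Carrier) → det A ≈ 0# →
    ¬ ¬ (Σ (Fin n → Carrier) λ v → (∃[ j ] ¬ v j ≈ 0#) × ∀ i → sum (λ j → A i j * v j) ≈ 0#)
  det≈0⇒kernel zero    A det≈0 none = 1≉0 det≈0
  det≈0⇒kernel (suc n) A det≈0 none = ¬¬-excluded-middle {A = ∃[ j ] ¬ minors j ≈ 0#} λ
    { (yes (j , m≉0)) → none (cofactor , (j , λ c≈0 → m≉0 (begin
        minors j                       ≈⟨ *-identityˡ _ ⟨
        1# * minors j                  ≈⟨ *-congʳ (sgn*sgn (toℕ j)) ⟨
        (sgn j * sgn j) * minors j     ≈⟨ *-assoc _ _ _ ⟩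
        sgn j * cofactor j             ≈⟨ *-congˡ c≈0 ⟩
        sgn j * 0#                     ≈⟨ zeroʳ _ ⟩
        0#                             ∎)) , cofactor-kills)
    ; (no m≈0) →
        deleted zero (λ m → m≈0 (zero , m)) λ (u , u₀≈0 , (k , uₖ≉0) , u-kills) →
        -- Taking for `k` a nonzero coordinate of `u` makes `u` and `v` independent: `v k` is 0, so
        -- `t u - s v` has kth coordinate `t * u k`. The coefficients `t` and `- s` are those that
        -- kill the first row.
        deleted k (λ m → m≈0 (k , m)) λ (v , vₖ≈0 , v≉0 , v-kills) →
        let s = sum (λ j → A zero j * u j) ; t = sum (λ j → A zero j * v j) in
        ¬¬-excluded-middle {A = t ≈ 0#} λ
          { (yes t≈0) → none (v , v≉0 , λ { zero → t≈0 ; (suc i) → v-kills i })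
          ; (no t≉0)  → none ((λ j → t * u j - s * v j) ,
              (k , λ w≈0 → uₖ≉0 (zero-product (begin
                t * u k                      ≈⟨ solve 3 (λ m s w → m := (m :- s :* w) :+ s :* w) refl (t * u k) s (v k) ⟩
                (t * u k - s * v k) + s * v k ≈⟨ +-cong w≈0 (trans (*-congˡ vₖ≈0) (zeroʳ s)) ⟩
                0# + 0#                      ≈⟨ +-identityˡ 0# ⟩
                0#                           ∎) t≉0)) ,
              λ { zero    → trans (sum-combine t s (A zero) u v) (solve 2 (λ s t → t :* s :- s :* t := con (+ 0)) refl s t)
                ; (suc i) → trans (sum-combine t s (A (suc i)) u v)
                    (trans (+-cong (trans (*-congˡ (u-kills i)) (zeroʳ t))
                                   (trans (-‿cong (trans (*-congˡ (v-kills i)) (zeroʳ s))) -0#≈0#))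
                           (+-identityˡ 0#)) }) } }
    where
    minors : Fin (suc n) → Carrier
    minors j = det (λ i k → A (suc i) (punchIn j k))

    cofactor : Fin (suc n) → Carrier
    cofactor j = sgn j * minors j

    rearrange : ∀ (a : Fin (suc n) → Carrier) → sum (λ j → a j * cofactor j) ≈ sum (λ j → sgn j * (a j * minors j))
    rearrange a = sum-cong-≋ λ j → solve 3 (λ a s m → a :* (s :* m) := s :* (a :* m)) refl (a j) (sgn j) (minors j)

    cofactor-kills : ∀ i → sum (λ j → A i j * cofactor j) ≈ 0#
    cofactor-kills zero    = trans (rearrange (A zero)) det≈0
    cofactor-kills (suc i) = trans (rearrange (A (suc i))) (det-repeated A′ i λ k → refl)
      where
      A′ : Fin (suc n) → Fin (suc n) → Carrier
      A′ zero    = A (suc i)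
      A′ (suc j) = A (suc j)

    sum-combine : ∀ p q (a f g : Fin (suc n) → Carrier) →
      sum (λ j → a j * (p * f j - q * g j)) ≈ p * sum (λ j → a j * f j) - q * sum (λ j → a j * g j)
    sum-combine p q a f g = begin
      sum (λ j → a j * (p * f j - q * g j))
        ≈⟨ sum-cong-≋ (λ j → solve 5 (λ a p f q g → a :* (p :* f :- q :* g) := (p :* (a :* f)) :+ ((:- q) :* (a :* g)))
             refl (a j) p (f j) q (g j)) ⟩
      sum (λ j → p * (a j * f j) + - q * (a j * g j))
        ≈⟨ ∑-distrib-+ (λ j → p * (a j * f j)) (λ j → - q * (a j * g j)) ⟩
      sum (λ j → p * (a j * f j)) + sum (λ j → - q * (a j * g j))
        ≈⟨ +-cong (sym (*-distribˡ-sum p (λ j → a j * f j))) (sym (*-distribˡ-sum (- q) (λ j → a j * g j))) ⟩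
      p * S + - q * T
        ≈⟨ solve 4 (λ p s q t → p :* s :+ (:- q) :* t := p :* s :- q :* t) refl p S q T ⟩
      p * S - q * T ∎
      where
      S = sum (λ j → a j * f j)
      T = sum (λ j → a j * g j)

    -- A kernel vector of the matrix without the first row and column `k`, padded by 0 in position
    -- `k`.
    deleted : ∀ k → ¬ ¬ minors k ≈ 0# →
      ¬ ¬ (Σ (Fin (suc n) → Carrier) λ v →
        v k ≈ 0# × (∃[ j ] ¬ v j ≈ 0#) × ∀ i → sum (λ j → A (suc i) j * v j) ≈ 0#)
    deleted k ¬¬m≈0 none = ¬¬m≈0 λ m≈0 →
      det≈0⇒kernel n (λ i j → A (suc i) (punchIn k j)) m≈0 λ (v , (j , vⱼ≉0) , kills) →
      let w : Fin (suc n) → Carrier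
          w = Vector.insertAt v k 0#
          at-k : w k ≈ 0#
          at-k  = reflexive (Vectorₚ.insertAt-lookup v k 0#)
          off-k : ∀ j → w (punchIn k j) ≈ v j
          off-k = λ j → reflexive (Vectorₚ.insertAt-punchIn v k 0# j)
      in none (w , at-k ,
           (punchIn k j , λ w≈0 → vⱼ≉0 (trans (sym (off-k j)) w≈0)) ,
           λ i → begin
             sum (λ j → A (suc i) j * w j)
               ≈⟨ sum-remove {i = k} (λ j → A (suc i) j * w j) ⟩
             A (suc i) k * w k + sum (λ j → A (suc i) (punchIn k j) * w (punchIn k j))
               ≈⟨ +-cong (trans (*-congˡ at-k) (zeroʳ _)) (sum-cong-≋ λ j → *-congˡ {A (suc i) (punchIn k j)} (off-k j)) ⟩
             0# + sum (λ j → A (suc i) (punchIn k j) * v j)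
               ≈⟨ trans (+-identityˡ _) (kills i) ⟩
             0# ∎)

module Resultant {c ℓ} (𝐅 : Field c ℓ) where
  private F = Field.ring 𝐅
  open CommutativeRing F hiding (zero)
  open PolynomialRing F
  open Kernel 𝐅 using (det≈0⇒kernel)
  open SemiringSum semiring using (sum; sum-cong-≋; *-distribˡ-sum; sum-remove; ∑-distrib-+; sum-replicate-zero)
  private module P = CommutativeRing R[X]

  -- Multiplication by X^s as padding of the list, the form in which the rows of `sylvester` are
  -- written.
  X^_*_ : ℕ → Polynomial → Polynomial
  X^ s * q = replicate s 0# ++ q

  X^-∷ : ∀ s c q → X^ s * (c ∷ q) ≋ scale c (X^ s * 1ₚ) +ₚ X^ suc s * q
  X^-∷ zero    c q = ∷-cong (trans (sym (*-identityʳ c)) (sym (+-identityʳ _))) ≋-refl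
  X^-∷ (suc s) c q = ∷-cong (sym (trans (+-identityʳ _) (zeroʳ c))) (X^-∷ s c q)

  X^-* : ∀ s q f → X^ s * q *ₚ f ≋ X^ s * (q *ₚ f)
  X^-* zero    q f = ≋-refl
  X^-* (suc s) q f = ≋-trans (shift-*ₚ (X^ s * q) f) (∷-cong refl (X^-* s q f))

  coeff-X^ : ∀ s → coeff (X^ s * 1ₚ) s ≈ 1#
  coeff-X^ zero    = refl
  coeff-X^ (suc s) = coeff-X^ s

  coeff-X^-≢ : ∀ s k → s ≢ k → coeff (X^ s * 1ₚ) k ≈ 0#
  coeff-X^-≢ zero    zero    s≢k = ⊥-elim (s≢k ≡.refl)
  coeff-X^-≢ zero    (suc k) s≢k = refl
  coeff-X^-≢ (suc s) zero    s≢k = refl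
  coeff-X^-≢ (suc s) (suc k) s≢k = coeff-X^-≢ s k (s≢k ∘ ≡.cong suc)

  deg-X^ : ∀ {s d} → s < d → deg (X^ s * 1ₚ) < d
  deg-X^ {s} s<d k d≤k = coeff-X^-≢ s k (ℕₚ.<⇒≢ (ℕₚ.<-≤-trans s<d d≤k))

  -- Converts a degree bound into a length bound, as needed for recursion on the list.
  take-deg : ∀ d q → deg q < d → take d q ≋ q
  take-deg zero    q       p = ≋-sym (deg-0 {q} p)
  take-deg (suc d) []      p = ≋-refl
  take-deg (suc d) (c ∷ q) p = ∷-cong refl (take-deg d q λ k d≤k → p (suc k) (s≤s d≤k))

  module _ {N} (v : Fin N → Carrier) where

    -- A column vector read as a linear form on polynomials of degree below `N`. The index is
    -- reversed because Sylvester columns begin with the highest degree. A row of the matrix applied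
    -- to `v` is then a value of this form.
    functional : Polynomial → Carrier
    functional q = sum λ j → coeff q (toℕ (opposite j)) * v j

    functional-cong : ∀ {p q} → p ≋ q → functional p ≈ functional q
    functional-cong {p} {q} p≋q = sum-cong-≋ λ j → *-congʳ {v j} (at p≋q (toℕ (opposite j)))

    functional-+ : ∀ p q → functional (p +ₚ q) ≈ functional p + functional q
    functional-+ p q = trans
      (sum-cong-≋ λ j → trans (*-congʳ {v j} (coeff-+ p q (toℕ (opposite j))))
        (distribʳ (v j) (coeff p (toℕ (opposite j))) (coeff q (toℕ (opposite j)))))
      (∑-distrib-+ (λ j → coeff p (toℕ (opposite j)) * v j) (λ j → coeff q (toℕ (opposite j)) * v j))

    functional-scale : ∀ c q → functional (scale c q) ≈ c * functional q
    functional-scale c q = trans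
      (sum-cong-≋ λ j → trans (*-congʳ {v j} (coeff-scale c q (toℕ (opposite j))))
        (*-assoc c (coeff q (toℕ (opposite j))) (v j)))
      (sym (*-distribˡ-sum c (λ j → coeff q (toℕ (opposite j)) * v j)))

    functional-0 : functional [] ≈ 0#
    functional-0 = trans (sum-cong-≋ λ j → zeroˡ (v j)) (sum-replicate-zero N)

    functional-X^ : ∀ j → functional (X^ toℕ (opposite j) * 1ₚ) ≈ v j
    functional-X^ j = pick N v j
      where
      pick : ∀ N (v : Fin N → Carrier) (j : Fin N) →
             sum (λ i → coeff (X^ toℕ (opposite j) * 1ₚ) (toℕ (opposite i)) * v i) ≈ v j
      pick (suc M) v j = trans (sum-remove {i = j} (λ i → coeff (X^ toℕ (opposite j) * 1ₚ) (toℕ (opposite i)) * v i))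
        (trans (+-cong (trans (*-congʳ (coeff-X^ (toℕ (opposite j)))) (*-identityˡ (v j)))
                       (trans (sum-cong-≋ λ i → trans
                                 (*-congʳ {v (punchIn j i)}
                                   (coeff-X^-≢ (toℕ (opposite j)) (toℕ (opposite (punchIn j i))) (distinct i)))
                                                      (zeroˡ (v (punchIn j i))))
                              (sum-replicate-zero M)))
               (+-identityʳ (v j)))
        where
        distinct : ∀ i → toℕ (opposite j) ≢ toℕ (opposite (punchIn j i))
        distinct i eq = Finₚ.punchInᵢ≢i j i (≡.sym (≡.trans (≡.sym (Finₚ.opposite-involutive j))
          (≡.trans (≡.cong opposite (Finₚ.toℕ-injective eq)) (Finₚ.opposite-involutive (punchIn j i)))))

    functional-multiple : ∀ {K} f → (∀ s → s < K → functional (X^ s * f) ≈ 0#) →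
                          ∀ u s → s ℕ.+ length u ≤ K → functional (X^ s * (u *ₚ f)) ≈ 0#
    functional-multiple f kills []      s _ = trans (functional-cong (X^-[] s)) functional-0
      where
      X^-[] : ∀ s → X^ s * [] ≋ []
      X^-[] zero    = ≋-refl
      X^-[] (suc s) = ≋-trans (∷-cong refl (X^-[] s)) shift-[]
    functional-multiple {K} f kills (c ∷ u) s bound = trans
      (functional-cong (≋-trans (≋-sym (X^-* s (c ∷ u) f)) (≋-trans (P.*-congʳ {f} (X^-∷ s c u))
        (≋-trans (*ₚ-distribʳ f (scale c (X^ s * 1ₚ)) (X^ suc s * u))
          (+ₚ-cong (≋-trans (scale-*ₚ c (X^ s * 1ₚ) f) (scale-cong refl (≋-trans (X^-* s 1ₚ f) (X^-cong s (*ₚ-identityˡ f)))))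
                   (X^-* (suc s) u f))))))
      (trans (functional-+ (scale c (X^ s * f)) (X^ suc s * (u *ₚ f)))
      (trans (+-cong (trans (functional-scale c (X^ s * f)) (trans (*-congˡ (kills s s<K)) (zeroʳ c)))
                     (functional-multiple f kills u (suc s) s+u<K))
             (+-identityˡ 0#)))
      where
      X^-cong : ∀ s {p q} → p ≋ q → X^ s * p ≋ X^ s * q
      X^-cong zero    p≋q = p≋q
      X^-cong (suc s) p≋q = ∷-cong refl (X^-cong s p≋q)
      s+u<K : suc s ℕ.+ length u ≤ K
      s+u<K = ≡.subst (_≤ K) (ℕₚ.+-suc s (length u)) bound
      s<K : s < K
      s<K = ℕₚ.≤-trans (ℕₚ.m≤m+n (suc s) (length u)) s+u<K

    functional-multiple-deg : ∀ {K} f → (∀ s → s < K → functional (X^ s * f) ≈ 0#) →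
                              ∀ u → deg u < K → functional (u *ₚ f) ≈ 0#
    functional-multiple-deg {K} f kills u deg-u = trans
      (functional-cong (P.*-congʳ {f} (≋-sym (take-deg K u deg-u))))
      (functional-multiple f kills (take K u) 0
        (≡.subst (_≤ K) (≡.sym (Listₚ.length-take K u)) (ℕₚ.m⊓n≤m K (length u))))

  -- A kernel vector of the Sylvester matrix is a form vanishing on X^s f for s < l and on X^s g for
  -- s < n. The Bézout identity makes every power of X below `l + n` a combination of these, so the
  -- form, and with it the vector, is 0.
  resultant≉0 : ∀ {n l f g} u w → Monic n f → deg g < suc l → 1ₚ ≋ u *ₚ f +ₚ w *ₚ g → ¬ resultant n l f g ≈ 0#
  resultant≉0 {n} {l} {f} {g} u w monic deg-g bezout res≈0 =
    det≈0⇒kernel (l ℕ.+ n) (sylvester n l f g) res≈0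
      λ (v , (j , vⱼ≉0) , kills) → vⱼ≉0 (trans (sym (functional-X^ v j))
        (power-vanishes v kills (toℕ (opposite j)) (Finₚ.toℕ<n (opposite j))))
    where
    module _ (v : Fin (l ℕ.+ n) → Carrier) (kills : ∀ i → sum (λ j → sylvester n l f g i j * v j) ≈ 0#) where

      kills-f : ∀ s → s < l → functional v (X^ s * f) ≈ 0#
      kills-f s s<l = trans (sum-cong-≋ λ j → *-congʳ {v j} (reflexive (entry j))) (kills (r ↑ˡ n))
        where
        r = opposite (fromℕ< s<l)
        s≡ : toℕ (opposite r) ≡ s
        s≡ = ≡.trans (≡.cong toℕ (Finₚ.opposite-involutive (fromℕ< s<l))) (Finₚ.toℕ-fromℕ< s<l)
        entry : ∀ j → coeff (X^ s * f) (toℕ (opposite j)) ≡ sylvester n l f g (r ↑ˡ n) j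
        entry j rewrite Finₚ.splitAt-↑ˡ l r n | s≡ = ≡.refl

      kills-g : ∀ s → s < n → functional v (X^ s * g) ≈ 0#
      kills-g s s<n = trans (sum-cong-≋ λ j → *-congʳ {v j} (reflexive (entry j))) (kills (l ↑ʳ r))
        where
        r = opposite (fromℕ< s<n)
        s≡ : toℕ (opposite r) ≡ s
        s≡ = ≡.trans (≡.cong toℕ (Finₚ.opposite-involutive (fromℕ< s<n))) (Finₚ.toℕ-fromℕ< s<n)
        entry : ∀ j → coeff (X^ s * g) (toℕ (opposite j)) ≡ sylvester n l f g (l ↑ʳ r) j
        entry j rewrite Finₚ.splitAt-↑ʳ l n r | s≡ = ≡.refl

      power-vanishes : ∀ k → k < l ℕ.+ n → functional v (X^ k * 1ₚ) ≈ 0#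
      -- Multiplying the Bézout identity by X^k makes the cofactors too large. The cofactor of `g`
      -- is reduced modulo `f`; that of `f` then has degree below `l` automatically, since
      -- `U f = X^k - r g` has degree below `l + n` and `f` is monic.
      power-vanishes k k<N with divide monic (X^ k * 1ₚ *ₚ w)
      ... | q , r , division , deg-r = trans (functional-cong v split)
        (trans (functional-+ v (U *ₚ f) (r *ₚ g))
        (trans (+-cong (functional-multiple-deg v f kills-f U deg-U) (functional-multiple-deg v g kills-g r deg-r))
               (+-identityˡ 0#)))
        where
        open SetoidReasoning P.setoid
        open Solver R[X]
        x^k = X^ k * 1ₚ
        U = x^k *ₚ u +ₚ q *ₚ g
        split : x^k ≋ U *ₚ f +ₚ r *ₚ g
        split = begin
          x^k                                     ≈⟨ P.*-identityʳ x^k ⟨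
          x^k *ₚ 1ₚ                               ≈⟨ *ₚ-congˡ x^k bezout ⟩
          x^k *ₚ (u *ₚ f +ₚ w *ₚ g)
            ≈⟨ solve 5 (λ x u f w g → x :* (u :* f :+ w :* g) := (x :* u) :* f :+ (x :* w) :* g) ≋-refl x^k u f w g ⟩
          (x^k *ₚ u) *ₚ f +ₚ (x^k *ₚ w) *ₚ g      ≈⟨ P.+-congˡ {(x^k *ₚ u) *ₚ f} (P.*-congʳ {g} division) ⟩
          (x^k *ₚ u) *ₚ f +ₚ (q *ₚ f +ₚ r) *ₚ g
            ≈⟨ solve 5 (λ m f q r g → m :* f :+ (q :* f :+ r) :* g := (m :+ q :* g) :* f :+ r :* g) ≋-refl (x^k *ₚ u) f q r g ⟩
          U *ₚ f +ₚ r *ₚ g                        ∎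
        deg-U : deg U < l
        deg-U = deg-cancel monic U (deg-resp
          (≋-sym (begin
            U *ₚ f
              ≈⟨ solve 2 (λ a b → a := (a :+ b) :- b) ≋-refl (U *ₚ f) (r *ₚ g) ⟩
            (U *ₚ f +ₚ r *ₚ g) +ₚ -ₚ (r *ₚ g)
              ≈⟨ P.+-congʳ { -ₚ (r *ₚ g)} (≋-sym split) ⟩
            x^k +ₚ -ₚ (r *ₚ g) ∎))
          (deg-+ₚ {x^k} (deg-X^ k<N) (deg-neg {r *ₚ g}
            (≡.subst (deg (r *ₚ g) <_) (ℕₚ.+-comm n l) (deg-*ₚ r g n deg-r deg-g)))))

-- Frobenius

prime∤! : ∀ {p} → Prime p → ∀ k → k < p → p ∤ k !
prime∤! {p} pp zero    0<p p∣1 with () ← ≡.subst Prime (∣1⇒≡1 p∣1) pp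
prime∤! {p} pp (suc k) k<p p∣k! with euclidsLemma (suc k) (k !) pp p∣k!
... | inj₁ p∣k  = ℕₚ.<⇒≱ k<p (∣⇒≤ p∣k)
... | inj₂ p∣k! = prime∤! pp k (ℕₚ.<-trans (ℕₚ.n<1+n k) k<p) p∣k!

prime∣C : ∀ {p} → Prime p → ∀ {k} → 0 < k → k < p → p ∣ p C k
prime∣C {p} pp {k} 0<k k<p with euclidsLemma (p C k) (k ! ℕ.* (p ∸ k) !) pp p∣product
  where
  instance _ = ℕₚ.m*n≢0 (k !) ((p ∸ k) !) {{k ℕₚ.!≢0}} {{(p ∸ k) ℕₚ.!≢0}}
  product : (p C k) ℕ.* (k ! ℕ.* (p ∸ k) !) ≡ p !
  product = ≡.trans (≡.cong (ℕ._* (k ! ℕ.* (p ∸ k) !)) (nCk≡n!/k![n-k]! (ℕₚ.<⇒≤ k<p)))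
                    (m/n*n≡m (k![n∸k]!∣n! (ℕₚ.<⇒≤ k<p)))
  p∣! : ∀ p → 0 < p → p ∣ p !
  p∣! (suc p) _ = m∣m*n (p !)
  p∣product : p ∣ (p C k) ℕ.* (k ! ℕ.* (p ∸ k) !)
  p∣product = ≡.subst (p ∣_) (≡.sym product) (p∣! p (ℕₚ.<-trans 0<k k<p))
... | inj₁ p∣C = p∣C
... | inj₂ p∣d with euclidsLemma (k !) ((p ∸ k) !) pp p∣d
...   | inj₁ p∣k!     = ⊥-elim (prime∤! pp k k<p p∣k!)
...   | inj₂ p∣[p-k]! = ⊥-elim (prime∤! pp (p ∸ k) (ℕₚ.∸-monoʳ-< 0<k (ℕₚ.<⇒≤ k<p)) p∣[p-k]!)

module Characteristic {a ℓ} (R : CommutativeRing a ℓ) {p} (pp : Prime p) where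
  open CommutativeRing R hiding (zero)
  open SemiringSum semiring using (sum; sum-cong-≋; sum-replicate-zero; sum-init-last)
  open SemiringMult semiring using (×-assoc-*; ×-congʳ; ×-congˡ; ×1-homo-*; ×-homo-1) renaming (_×_ to _⨯_)
  open SemiringExp semiring using (_^_; ^-congˡ; ^-assocʳ; ^-congʳ)
  open FromInteger R
  open Solver R
  open SetoidReasoning setoid

  private instance
    p≢0 : NonZero p
    p≢0 = prime⇒nonZero pp

  module _ (char : p ⨯ 1# ≈ 0#) where

    p∣⇒⨯≈0 : ∀ {m} → p ∣ m → ∀ x → m ⨯ x ≈ 0#
    p∣⇒⨯≈0 {m} (divides q eq) x = begin
      m ⨯ x                    ≈⟨ ×-congʳ m (sym (*-identityˡ x)) ⟩
      m ⨯ (1# * x)             ≈⟨ ×-assoc-* m 1# x ⟨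
      (m ⨯ 1#) * x             ≈⟨ *-congʳ (×-congˡ eq) ⟩
      ((q ℕ.* p) ⨯ 1#) * x     ≈⟨ *-congʳ (×1-homo-* q p) ⟩
      (q ⨯ 1# * (p ⨯ 1#)) * x  ≈⟨ *-congʳ (trans (*-congˡ char) (zeroʳ _)) ⟩
      0# * x                   ≈⟨ zeroˡ x ⟩
      0#                       ∎

    frobenius-+ : ∀ x y → (x + y) ^ p ≈ x ^ p + y ^ p
    frobenius-+ x y = expand p ≡.refl
      where
      open Binomial commutativeSemiring using (theorem; binomialTerm)
      -- The exponent is generalised so that it can be split as a successor, which exposes the first
      -- and last binomial terms.
      expand : ∀ m → m ≡ p → (x + y) ^ m ≈ x ^ m + y ^ m
      expand zero    eq = ⊥-elim (ℕ.≢-nonZero⁻¹ p (≡.sym eq))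
      expand (suc m) eq = begin
        (x + y) ^ suc m
          ≈⟨ theorem (suc m) x y ⟩
        term zero + sum (term ∘ suc)
          ≈⟨ +-cong (trans (×-homo-1 _) (*-identityˡ _)) (sum-init-last (term ∘ suc)) ⟩
        y ^ suc m + (sum (λ i → term (suc (inject₁ i))) + term (suc (fromℕ m)))
          ≈⟨ +-congˡ (+-cong (trans (sum-cong-≋ middle) (sum-replicate-zero m)) last-term) ⟩
        y ^ suc m + (0# + x ^ suc m)
          ≈⟨ solve 2 (λ x y → y :+ (con (+ 0) :+ x) := x :+ y) refl (x ^ suc m) (y ^ suc m) ⟩
        x ^ suc m + y ^ suc m ∎
        where
        term = binomialTerm x y (suc m)
        middle : ∀ (i : Fin m) → term (suc (inject₁ i)) ≈ 0#
        middle i = p∣⇒⨯≈0 (≡.subst (_∣ suc m C suc (toℕ (inject₁ i))) eq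
          (prime∣C (≡.subst Prime (≡.sym eq) pp) (s≤s z≤n) (s≤s (Finₚ.inject₁ℕ< i)))) _
        last-term : term (suc (fromℕ m)) ≈ x ^ suc m
        last-term rewrite Finₚ.toℕ-fromℕ m | nCn≡1 (suc m) | ℕₚ.n∸n≡0 m = trans (×-homo-1 _) (*-identityʳ _)

    -- Deduced from additivity by cancelling `y ^ p`, so that the parity of `p` never enters.
    frobenius-- : ∀ x y → (x - y) ^ p ≈ x ^ p - y ^ p
    frobenius-- x y = begin
      (x - y) ^ p                     ≈⟨ solve 2 (λ u v → u := (u :+ v) :- v) refl ((x - y) ^ p) (y ^ p) ⟩
      ((x - y) ^ p + y ^ p) - y ^ p   ≈⟨ +-congʳ (sym (frobenius-+ (x - y) y)) ⟩
      ((x - y) + y) ^ p - y ^ p       ≈⟨ +-congʳ (^-congˡ p (solve 2 (λ x y → (x :- y) :+ y := x) refl x y)) ⟩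
      x ^ p - y ^ p                   ∎

    frobenius^-- : ∀ i x y → (x - y) ^ (p ℕ.^ i) ≈ x ^ (p ℕ.^ i) - y ^ (p ℕ.^ i)
    frobenius^-- zero    x y = trans (×1 (x - y)) (+-cong (sym (×1 x)) (-‿cong (sym (×1 y))))
      where
      ×1 : ∀ x → x ^ 1 ≈ x
      ×1 = *-identityʳ
    frobenius^-- (suc i) x y = begin
      (x - y) ^ (p ℕ.* p ℕ.^ i)                          ≈⟨ ^-assocʳ (x - y) p (p ℕ.^ i) ⟨
      ((x - y) ^ p) ^ (p ℕ.^ i)                          ≈⟨ ^-congˡ (p ℕ.^ i) (frobenius-- x y) ⟩
      (x ^ p - y ^ p) ^ (p ℕ.^ i)                        ≈⟨ frobenius^-- i (x ^ p) (y ^ p) ⟩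
      (x ^ p) ^ (p ℕ.^ i) - (y ^ p) ^ (p ℕ.^ i)          ≈⟨ +-cong (^-assocʳ x p _) (-‿cong (^-assocʳ y p _)) ⟩
      x ^ (p ℕ.* p ℕ.^ i) - y ^ (p ℕ.* p ℕ.^ i)          ∎

    fromℤ-% : ∀ i → fromℤ i ≈ fromℤ (+ (i %ℕ p))
    fromℤ-% i = begin
      fromℤ i                                           ≡⟨ ≡.cong fromℤ (a≡a%ℕn+[a/ℕn]*n i p) ⟩
      fromℤ (+ (i %ℕ p) ℤ.+ (i /ℕ p) ℤ.* + p)           ≈⟨ fromℤ-+ (+ (i %ℕ p)) ((i /ℕ p) ℤ.* + p) ⟩
      fromℤ (+ (i %ℕ p)) + fromℤ ((i /ℕ p) ℤ.* + p)     ≈⟨ +-congˡ (fromℤ-* (i /ℕ p) (+ p)) ⟩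
      fromℤ (+ (i %ℕ p)) + fromℤ (i /ℕ p) * (p ⨯ 1#)    ≈⟨ +-congˡ (trans (*-congˡ char) (zeroʳ _)) ⟩
      fromℤ (+ (i %ℕ p)) + 0#                           ≈⟨ +-identityʳ _ ⟩
      fromℤ (+ (i %ℕ p))                                ∎

    -- An integral x generates a finite ring, so two of the powers x^(p^i)
    -- coincide.
    nilpotent-difference : ∀ {x} → Integral.IsIntegral R x →
      ∃[ i ] ∃[ m ] (x - x ^ (p ℕ.^ suc m)) ^ (p ℕ.^ i) ≈ 0#
    -- There are `p ^ size` coefficient vectors modulo `p`, and one more exponent than that.
    nilpotent-difference {x} integral = result (Finₚ.pigeonhole (ℕₚ.n<1+n (p ℕ.^ size)) code)
      where
      open Integral R using (Span; Stable; adjoin; span-lookup; span-coefficients)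
      -- Generators of a subgroup stabilised by `x`; it contains 1 and therefore every power of `x`.
      generators : List Carrier
      generators = 1# ∷ proj₁ (adjoin [] {x} integral)
      size = length generators
      stable : Stable generators x
      stable = proj₁ (proj₂ (adjoin [] {x} integral))
      power∈ : ∀ k → Span generators (x ^ k)
      power∈ zero    = span-lookup x generators zero
      power∈ (suc k) = stable (power∈ k)
      coefficient : ℕ → Fin size → Fin p
      coefficient k j = fromℕ< (n%ℕd<d (proj₁ (span-coefficients x generators (power∈ k)) j) p)
      decode : (Fin size → Fin p) → Carrier
      decode f = sum λ j → fromℤ (+ toℕ (f j)) * List.lookup generators j
      power≈ : ∀ k → x ^ k ≈ decode (coefficient k)
      power≈ k = trans (proj₂ (span-coefficients x generators (power∈ k)))
        (sum-cong-≋ λ j → let i = proj₁ (span-coefficients x generators (power∈ k)) j in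
          *-congʳ {List.lookup generators j} (trans (fromℤ-% i)
            (reflexive (≡.cong (λ r → fromℤ (+ r)) (≡.sym (Finₚ.toℕ-fromℕ< (n%ℕd<d i p)))))))
      code : Fin (suc (p ℕ.^ size)) → Fin (p ℕ.^ size)
      code i = funToFin (coefficient (p ℕ.^ toℕ i))
      result : (∃[ i ] ∃[ j ] (toℕ i < toℕ j × code i ≡ code j)) →
               ∃[ i ] ∃[ m ] (x - x ^ (p ℕ.^ suc m)) ^ (p ℕ.^ i) ≈ 0#
      -- Strictness of `i < j` yields the exponent `p ^ suc m`, a multiple of `p`; later this makes
      -- the derivative of that power of X vanish.
      result (i , j , i<j , eq) with ℕₚ.m≤n⇒∃[o]m+o≡n i<j
      ... | m , i+m≡j = toℕ i , m , (begin
        (x - x ^ (p ℕ.^ suc m)) ^ (p ℕ.^ toℕ i)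
          ≈⟨ frobenius^-- (toℕ i) x (x ^ (p ℕ.^ suc m)) ⟩
        x ^ (p ℕ.^ toℕ i) - (x ^ (p ℕ.^ suc m)) ^ (p ℕ.^ toℕ i)
          ≈⟨ +-congˡ (-‿cong (^-assocʳ x (p ℕ.^ suc m) (p ℕ.^ toℕ i))) ⟩
        x ^ (p ℕ.^ toℕ i) - x ^ (p ℕ.^ suc m ℕ.* p ℕ.^ toℕ i)
          ≈⟨ +-congˡ (-‿cong (^-congʳ x exponent)) ⟩
        x ^ (p ℕ.^ toℕ i) - x ^ (p ℕ.^ toℕ j)
          ≈⟨ +-congʳ same ⟩
        x ^ (p ℕ.^ toℕ j) - x ^ (p ℕ.^ toℕ j)
          ≈⟨ -‿inverseʳ _ ⟩
        0# ∎)
        where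
        exponent : p ℕ.^ suc m ℕ.* p ℕ.^ toℕ i ≡ p ℕ.^ toℕ j
        exponent = ≡.trans (≡.sym (ℕₚ.^-distribˡ-+-* p (suc m) (toℕ i)))
          (≡.cong (p ℕ.^_) (≡.trans (≡.cong suc (ℕₚ.+-comm m (toℕ i))) i+m≡j))
        coefficients≡ : ∀ l → coefficient (p ℕ.^ toℕ i) l ≡ coefficient (p ℕ.^ toℕ j) l
        coefficients≡ l = ≡.trans (≡.sym (Finₚ.finToFun-funToFin (coefficient (p ℕ.^ toℕ i)) l))
          (≡.trans (≡.cong (λ k → finToFun k l) eq) (Finₚ.finToFun-funToFin (coefficient (p ℕ.^ toℕ j)) l))
        same : x ^ (p ℕ.^ toℕ i) ≈ x ^ (p ℕ.^ toℕ j)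
        same = trans (power≈ (p ℕ.^ toℕ i)) (trans
          (sum-cong-≋ λ l → *-congʳ {List.lookup generators l} (reflexive (≡.cong (λ r → fromℤ (+ toℕ r)) (coefficients≡ l))))
          (sym (power≈ (p ℕ.^ toℕ j))))

module _ {a ℓ} (R : CommutativeRing a ℓ) where
  open CommutativeRing R hiding (zero)
  open SemiringExp semiring using (_^_; ^-homo-*; ^-congʳ)

  -- The last nonzero power works, as twice its exponent reaches the next one. Which power is last
  -- is not decidable, hence the double negation.
  nilpotent⇒square-zero : ∀ n {x} → x ^ suc n ≈ 0# → ¬ x ≈ 0# → ¬ ¬ (∃[ z ] (¬ z ≈ 0# × z * z ≈ 0#))
  nilpotent⇒square-zero zero    x≈0 x≉0 none = x≉0 (trans (sym (*-identityʳ _)) x≈0)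
  nilpotent⇒square-zero (suc n) {x} x^n≈0 x≉0 none = ¬¬-excluded-middle {A = x ^ suc n ≈ 0#} λ
    { (yes x^n≈0) → nilpotent⇒square-zero n x^n≈0 x≉0 none
    ; (no x^n≉0)  → none (x ^ suc n , x^n≉0 , (begin
        x ^ suc n * x ^ suc n       ≈⟨ ^-homo-* x (suc n) (suc n) ⟨
        x ^ (suc n ℕ.+ suc n)       ≈⟨ ^-congʳ x (ℕₚ.+-suc (suc n) n) ⟩
        x ^ (suc (suc n) ℕ.+ n)     ≈⟨ ^-homo-* x (suc (suc n)) n ⟩
        x ^ suc (suc n) * x ^ n     ≈⟨ trans (*-congʳ x^n≈0) (zeroˡ _) ⟩
        0#                          ∎)) }
    where open SetoidReasoning setoid

-- Integrality

module IntegralEquation {a ℓ} (R : CommutativeRing a ℓ) where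
  open CommutativeRing R hiding (zero)
  open PolynomialRing R using (Monic)
  open Integral R
  open SemiringExp semiring using (_^_)
  open Solver R
  open SetoidReasoning setoid

  -- A single finitely generated subgroup for all coefficients: each `adjoin` enlarges it while
  -- keeping the stabilisers already obtained.
  stabilise : ∀ {f} → All IsIntegral f → ∃[ G ] All (Stable (1# ∷ G)) f
  stabilise []       = [] , []
  stabilise (_∷_ {c} {f} i is) = enlarge (stabilise is)
    where
    enlarge : ∃[ G ] All (Stable (1# ∷ G)) f → ∃[ G ] All (Stable (1# ∷ G)) (c ∷ f)
    enlarge (G , stable) = keep-all (adjoin G {c} i)
      where
      keep-all : ∃[ H ] (Stable (1# ∷ H) c × (∀ {y} → Stable (1# ∷ G) y → Stable (1# ∷ H) y)) →
                 ∃[ G ] All (Stable (1# ∷ G)) (c ∷ f)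
      keep-all (H , stable-c , keep) = H , (λ {w} → stable-c {w}) ∷ All.map (λ {y} → keep {y}) stable

  module _ {G : List Carrier} where

    Stable-isSubgroup : IsSubgroup (Stable G)
    Stable-isSubgroup = record
      { resp     = λ x≈y st sw → span-resp (*-congʳ x≈y) (st sw)
      ; 0∈       = λ {w} _ → span-resp (sym (zeroˡ w)) (span-0 G)
      ; +-closed = λ {x} {y} sx sy {w} sw → span-resp (sym (distribʳ w x y)) (span-+ (sx sw) (sy sw))
      }

    eval≈0 : ∀ f x → (∀ k → Polynomials.coeff R f k ≈ 0#) → eval R id f x ≈ 0#
    eval≈0 []      x all0 = refl
    eval≈0 (c ∷ f) x all0 = trans (+-cong (all0 0) (trans (*-congˡ (eval≈0 f x (all0 ∘ suc))) (zeroʳ x))) (+-identityˡ 0#)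

    leading-term : ∀ n f x → All (Stable G) f → Monic n f →
                   ∃[ r ] (Deg< (Stable G) x n r × eval R id f x ≈ x ^ n + r)
    -- The empty list is monic only when 0 and 1 coincide, and then all elements are equal.
    leading-term n       []      x _          (0≈1 , _) =
      0# , deg-0 Stable-isSubgroup n , trans (sym (zeroʳ _)) (trans (*-congˡ 0≈1)
        (trans (*-identityʳ (x ^ n)) (sym (+-identityʳ (x ^ n)))))
    leading-term zero    (c ∷ f) x (st ∷ sts) (lead , high) =
      0# , nil refl , +-cong lead (trans (*-congˡ (eval≈0 f x (λ k → high (suc k) (s≤s z≤n)))) (zeroʳ x))
    leading-term (suc n) (c ∷ f) x (st ∷ sts) (lead , high)
      with leading-term n f x sts (lead , λ k n<k → high (suc k) (s≤s n<k))
    ... | r , dr , eq = c + x * r , cons (λ {w} → st {w}) dr refl , trans (+-congˡ (*-congˡ eq))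
      (solve 4 (λ c x y r → c :+ x :* (y :+ r) := x :* y :+ (c :+ x :* r)) refl c x (x ^ n) r)

    -- Multiplication by `x` creates one term `x ^ m * b` of excessive degree. The equation replaces
    -- it by `- r * b`, which stays in the span because the coefficients of `r` stabilise `G`.
    root-stable : ∀ {x r} m → Deg< (Stable G) x m r → 0# ≈ x ^ m + r → Stable (powers x G m) x
    root-stable {x} {r} m dr root {w} sw
      with deg-top (span-isSubgroup G) m (deg-shift (span-isSubgroup G) (span→deg x G m sw))
    ... | b , v , sb , dv , q = span-resp eq (span-+ (deg→span dv) (span-neg (deg→span rb)))
      where
      rb : Deg< (Span G) x m (r * b)
      rb = deg-*ʳ (span-isSubgroup G) (λ st sw → st sw) dr sb
      eq : v - r * b ≈ x * w
      eq = begin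
        v - r * b                     ≈⟨ solve 3 (λ v r b → v :- r :* b := (v :- r :* b) :+ con (+ 0) :* b) refl v r b ⟩
        (v - r * b) + 0# * b          ≈⟨ +-congˡ (*-congʳ root) ⟩
        (v - r * b) + (x ^ m + r) * b ≈⟨ solve 4 (λ v r b y → (v :- r :* b) :+ (y :+ r) :* b := v :+ y :* b)
                                           refl v r b (x ^ m) ⟩
        v + x ^ m * b                 ≈⟨ q ⟨
        x * w                         ∎

  -- Transitivity of integrality: when the coefficients stabilise `G`, the sum of the groups `x^i G`
  -- over finitely many i is stabilised by `x`.
  monic-root-integral : ∀ {n f x} → Monic n f → All IsIntegral f → eval R id f x ≈ 0# → IsIntegral x
  monic-root-integral {n} {f} {x} monic integral root with stabilise integral
  ... | G , stable with leading-term n f x stable monic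
  ...   | r , dr , eq = stable→integral x _
    -- The equation is multiplied by `x` so that the list of generators begins with a copy of `G`,
    -- hence with 1, even for `n = 0`; `stable→integral` relies on this.
    (λ {w} → root-stable (suc n) (deg-shift Stable-isSubgroup dr) (begin
      0#                 ≈⟨ zeroʳ x ⟨
      x * 0#             ≈⟨ *-congˡ (trans (sym root) eq) ⟩
      x * (x ^ n + r)    ≈⟨ distribˡ x (x ^ n) r ⟩
      x * x ^ n + x * r  ∎) {w})

  eval-cong : ∀ {b} {B : Set b} (φ : B → Carrier) f {x y} → x ≈ y → eval R φ f x ≈ eval R φ f y
  eval-cong φ []      x≈y = refl
  eval-cong φ (c ∷ f) x≈y = +-congˡ (*-cong x≈y (eval-cong φ f x≈y))

  integral-resp : ∀ {x y} → x ≈ y → IsIntegral x → IsIntegral y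
  integral-resp x≈y (f , n , monic , root) =
    f , n , monic , trans (eval-cong (FromInteger.fromℤ R) f (sym x≈y)) root

  square-integral : ∀ {x} → IsIntegral (x * x) → IsIntegral x
  square-integral {x} integral = monic-root-integral {2} { - (x * x) ∷ 0# ∷ 1# ∷ []}
    (refl , λ { (suc (suc (suc k))) _ → refl ; (suc (suc zero)) (s≤s (s≤s ())) ; (suc zero) (s≤s ()) })
    (-‿closed integral ∷ 0-closed ∷ 1-closed ∷ [])
    (begin
      - (x * x) + x * (0# + x * (1# + x * 0#))
        -- The unit is passed as a variable, because the solver's constant 1 means `fromℤ (+ 1)`,
        -- which equals `1#` only by a proof.
        ≈⟨ solve 2 (λ x o → (:- (x :* x)) :+ x :* (con (+ 0) :+ x :* (o :+ x :* con (+ 0))) :=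
                            x :* (x :* (o :- con (+ 1)))) refl x 1# ⟩
      x * (x * (1# - FromInteger.fromℤ R (+ 1)))
        ≈⟨ *-congˡ (*-congˡ (trans (+-congˡ (-‿cong (FromInteger.fromℤ-1 R))) (-‿inverseʳ 1#))) ⟩
      x * (x * 0#)
        ≈⟨ trans (*-congˡ (zeroʳ x)) (zeroʳ x) ⟩
      0# ∎)
    where open IsSubring integral-isSubring

-- Coprimality with an irreducible polynomial

module Coprimality {c ℓ} (𝐅 : Field c ℓ) where
  open Field 𝐅 using (1≉0; invertible)
  private F = Field.ring 𝐅
  open CommutativeRing F hiding (zero)
  open PolynomialRing F
  private module P = CommutativeRing R[X]

  -- Descends from the bound to the first coefficient that does not vanish; each test is classical.
  leading-coefficient : ∀ d q → deg q < d → ¬ q ≋ [] →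
    ¬ ¬ (∃[ e ] (e < d × deg q < suc e × ¬ coeff q e ≈ 0#))
  leading-coefficient zero    q deg-q q≉0 none = q≉0 (deg-0 {q} deg-q)
  leading-coefficient (suc d) q deg-q q≉0 none = ¬¬-excluded-middle {A = coeff q d ≈ 0#} λ
    { (yes c≈0) → leading-coefficient d q (lower c≈0) q≉0 λ (e , e<d , deg-e , c≉0) →
                    none (e , ℕₚ.m<n⇒m<1+n e<d , deg-e , c≉0)
    ; (no c≉0)  → none (d , ℕₚ.n<1+n d , deg-q , c≉0) }
    where
    lower : coeff q d ≈ 0# → deg q < d
    lower c≈0 k d≤k with ℕₚ.m≤n⇒m<n∨m≡n d≤k
    ... | inj₁ d<k   = deg-q k d<k
    ... | inj₂ ≡.refl = c≈0

  monic-multiple : ∀ {e} q → deg q < suc e → ¬ coeff q e ≈ 0# → ∃[ t ] Monic e (scale t q)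
  monic-multiple {e} q deg-q c≉0 with invertible (coeff q e) c≉0
  ... | t , ct≈1 = t , trans (coeff-scale t q e) (trans (*-comm _ _) ct≈1) , deg-scale t {q} deg-q

  module _ (f g : Polynomial) where

    combinations : Ideals.Ideal R[X]
    combinations = record
      { member   = λ x → ∃[ u ] ∃[ v ] x ≋ u *ₚ f +ₚ v *ₚ g
      ; resp     = λ x≋y (u , v , p) → u , v , ≋-trans (≋-sym x≋y) p
      ; 0∈       = [] , [] , ≋-refl
      ; +-closed = λ (u , v , p) (u′ , v′ , p′) → u +ₚ u′ , v +ₚ v′ , ≋-trans (+ₚ-cong p p′)
          (solve 6 (λ u v u′ v′ f g → (u :* f :+ v :* g) :+ (u′ :* f :+ v′ :* g) := (u :+ u′) :* f :+ (v :+ v′) :* g)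
            ≋-refl u v u′ v′ f g)
      ; *-closed = λ r (u , v , p) → r *ₚ u , r *ₚ v , ≋-trans (*ₚ-congˡ r p)
          (solve 5 (λ r u v f g → r :* (u :* f :+ v :* g) := (r :* u) :* f :+ (r :* v) :* g) ≋-refl r u v f g)
      }
      where open Solver R[X]

    private module I = Ideals.Ideal combinations

    f∈ : I.member f
    f∈ = 1ₚ , [] , ≋-sym (≋-trans (+ₚ-identityʳ (1ₚ *ₚ f)) (*ₚ-identityˡ f))

    g∈ : I.member g
    g∈ = [] , 1ₚ , ≋-sym (*ₚ-identityˡ g)

    scale∈ : ∀ t q → I.member q → I.member (scale t q)
    scale∈ t q q∈ = I.resp (≋-trans (+ₚ-cong (≋-refl {scale t q}) shift-[]) (+ₚ-identityʳ _)) (I.*-closed (constant t) q∈)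

    remainder∈ : ∀ {x q m r} → I.member x → I.member m → x ≋ q *ₚ m +ₚ r → I.member r
    remainder∈ {x} {q} {m} {r} x∈ m∈ eq = I.resp
      (≋-trans (+ₚ-cong eq (≋-refl {(-ₚ q) *ₚ m}))
        (solve 3 (λ q m r → (q :* m :+ r) :+ (:- q) :* m := r) ≋-refl q m r))
      (I.+-closed x∈ (I.*-closed (-ₚ q) m∈))
      where open Solver R[X]

    -- A monic member of least degree divides both generators: a nonzero remainder would be a member
    -- of smaller degree, and a scalar multiple of it monic. The number `d` bounds the descent.
    greatest-common-divisor : ∀ d {e m} → e < d → Monic e m → I.member m →
      ¬ ¬ (∃[ m ] (I.member m × (∃[ s ] f ≋ s *ₚ m) × (∃[ t ] g ≋ t *ₚ m)))
    greatest-common-divisor (suc d) {e} {m} (s≤s e≤d) monic m∈ none =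
      reduce f∈ λ f-divisible → reduce g∈ λ g-divisible → none (m , m∈ , f-divisible , g-divisible)
      where
      smaller : ∀ {r} → deg r < e → I.member r → ¬ ¬ (r ≋ [])
      smaller {r} deg-r r∈ r≉0 = leading-coefficient e r deg-r r≉0 λ (e′ , e′<e , deg-e′ , c≉0) →
        let t , monic′ = monic-multiple r deg-e′ c≉0 in
        greatest-common-divisor d (ℕₚ.<-≤-trans e′<e e≤d) monic′ (scale∈ t r r∈) none
      reduce : ∀ {x} → I.member x → ¬ ¬ (∃[ q ] x ≋ q *ₚ m)
      reduce {x} x∈ none with divide monic x
      ... | q , r , eq , deg-r = smaller deg-r (remainder∈ {q = q} x∈ m∈ eq) λ r≋0 →
        none (q , ≋-trans eq (≋-trans (+ₚ-cong ≋-refl r≋0) (+ₚ-identityʳ _)))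

  module _ {n h} (monic : Monic n h) (irreducible : Irreducible h) where
    open RawSemiringDefs polynomialSemiring using () renaming (_∣_ to _∣ₚ_)
    open RawSemiringDefs.Irreducible irreducible

    -- Let `m` be the common divisor and `h = s m`. If `m` is a unit, then 1 is a combination of `h`
    -- and `g`. If `s` is a unit, then `h` divides `g`, which is impossible for a nonzero `g` of
    -- degree below `n`.
    irreducible⇒coprime : ∀ g → deg g < n → ¬ g ≋ [] → ¬ ¬ (∃[ u ] ∃[ v ] 1ₚ ≋ u *ₚ h +ₚ v *ₚ g)
    irreducible⇒coprime g deg-g g≉0 none =
      leading-coefficient n g deg-g g≉0 λ (e , e<n , deg-e , c≉0) →
      let t , monic′ = monic-multiple g deg-e c≉0 in
      greatest-common-divisor h g n e<n monic′ (scale∈ h g t g (g∈ h g)) λ (m , m∈ , (s , h≋sm) , (t , g≋tm)) →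
      conclude m m∈ s h≋sm t g≋tm (split-∣1 {s} {m} (at h≋sm))
      where
      open Solver R[X]
      open SetoidReasoning P.setoid
      conclude : ∀ m → Ideals.Ideal.member (combinations h g) m → ∀ s → h ≋ s *ₚ m → ∀ t → g ≋ t *ₚ m →
                 s ∣ₚ 1ₚ ⊎ m ∣ₚ 1ₚ → ⊥
      conclude m m∈ s h≋sm t g≋tm (inj₂ (divides-by a am≈1)) =
        none (Ideals.Ideal.resp (combinations h g) (coeffs am≈1) (Ideals.Ideal.*-closed (combinations h g) a m∈))
      conclude m m∈ s h≋sm t g≋tm (inj₁ (divides-by a as≈1)) = g≉0 (begin
        g                ≈⟨ g≋ ⟩
        (t *ₚ a) *ₚ h    ≈⟨ *ₚ-zeroˡ (t *ₚ a) h (deg-0 {t *ₚ a} (deg-cancel monic (t *ₚ a) {0} (deg-resp g≋ deg-g))) ⟩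
        []               ∎)
        where
        g≋ : g ≋ (t *ₚ a) *ₚ h
        g≋ = begin
          g                          ≈⟨ g≋tm ⟩
          t *ₚ m                     ≈⟨ *ₚ-congˡ t (*ₚ-identityˡ m) ⟨
          t *ₚ (1ₚ *ₚ m)             ≈⟨ *ₚ-congˡ t (P.*-congʳ {m} {a *ₚ s} (coeffs as≈1)) ⟨
          t *ₚ ((a *ₚ s) *ₚ m)       ≈⟨ solve 4 (λ t a s m → t :* ((a :* s) :* m) := (t :* a) :* (s :* m)) ≋-refl t a s m ⟩
          (t *ₚ a) *ₚ (s *ₚ m)       ≈⟨ *ₚ-congˡ (t *ₚ a) h≋sm ⟨
          (t *ₚ a) *ₚ h              ∎

    module _ {b ℓ₂} {E : CommutativeRing b ℓ₂} (ε : RingHom F E) (η : CommutativeRing.Carrier E) where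
      private module E = CommutativeRing E
      open Evaluation ε η

      -- A nonzero `g` would be coprime to `h`, and the Bézout identity evaluated at the common root
      -- would read 1 = 0.
      irreducible⇒independent : ¬ E.1# E.≈ E.0# → ev h E.≈ E.0# → ∀ g → deg g < n → ev g E.≈ E.0# → ¬ ¬ g ≋ []
      irreducible⇒independent 1≉0 root g deg-g g-root g≉0 = irreducible⇒coprime g deg-g g≉0 λ (u , v , bezout) →
        1≉0 (E.trans (E.sym (E.trans (ev-constant 1#) (RingHom.1#-homo ε)))
          (E.trans (ev-cong 1ₚ (u *ₚ h +ₚ v *ₚ g) bezout)
          (E.trans (ev-+ (u *ₚ h) (v *ₚ g))
          (E.trans (E.+-cong (E.trans (ev-* u h) (E.trans (E.*-congˡ root) (E.zeroʳ _)))
                             (E.trans (ev-* v g) (E.trans (E.*-congˡ g-root) (E.zeroʳ _))))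
                   (E.+-identityˡ E.0#)))))

-- Integral elements under homomorphisms

module _ {a ℓ₁ b ℓ₂} {R : CommutativeRing a ℓ₁} {S : CommutativeRing b ℓ₂} (φ : RingHom R S) where
  open RingHom φ using (fun; ⟦⟧-cong; 0#-homo)
  private module S = CommutativeRing S

  integral-hom : ∀ {x} → Integral.IsIntegral R x → Integral.IsIntegral S (fun x)
  integral-hom {x} (f , n , monic , root) =
    f , n , monic , S.trans (S.sym (hom-eval φ f x)) (S.trans (⟦⟧-cong root) 0#-homo)

module _ {a ℓ₁ b ℓ₂} {R : CommutativeRing a ℓ₁} {S : CommutativeRing b ℓ₂} (φ : RingHom R S) where
  private
    module R = CommutativeRing R
    module S = CommutativeRing S
  open RingHom φ using (fun; *-homo; 1#-homo)
  open SemiringExp R.semiring using () renaming (_^_ to _^ᴿ_)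
  open SemiringExp S.semiring using () renaming (_^_ to _^ˢ_)

  ^-hom : ∀ x n → fun (x ^ᴿ n) S.≈ fun x ^ˢ n
  ^-hom x zero    = 1#-homo
  ^-hom x (suc n) = S.trans (*-homo x (x ^ᴿ n)) (S.*-congˡ (^-hom x n))

𝒪-inclusion : ∀ {c ℓ} (R : CommutativeRing c ℓ) → RingHom (𝒪 R) R
𝒪-inclusion R = subring-hom R (Integral.IsIntegral R) (Integral.integral-isSubring R)

𝒪-integral : ∀ {c ℓ} (R : CommutativeRing c ℓ) x → Integral.IsIntegral (𝒪 R) x
𝒪-integral R (x , f , n , monic , root) = f , n , monic ,
  CommutativeRing.trans R (hom-eval (𝒪-inclusion R) f (x , f , n , monic , root)) root

module _ {a ℓ} (R : CommutativeRing a ℓ) (I : Ideals.Ideal R) where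
  private module Q = CommutativeRing (Quotient R I)

  quotient-hom : RingHom R (Quotient R I)
  quotient-hom = record
    { fun = id
    ; isRingHomomorphism = record
      { isSemiringHomomorphism = record
        { isNearSemiringHomomorphism = record
          { +-isMonoidHomomorphism = record
            { isMagmaHomomorphism = record
              { isRelHomomorphism = record { cong = quotient-≈ R I }
              ; homo = λ _ _ → Q.refl }
            ; ε-homo = Q.refl }
          ; *-homo = λ _ _ → Q.refl }
        ; 1#-homo = Q.refl }
      ; -‿homo = λ _ → Q.refl } }

module _ {a ℓ} (R : CommutativeRing a ℓ) where
  open PolynomialRing R

  constant-hom : RingHom R R[X]
  constant-hom = record
    { fun = constant
    ; isRingHomomorphism = record
      { isSemiringHomomorphism = record
        { isNearSemiringHomomorphism = record
          { +-isMonoidHomomorphism = record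
            { isMagmaHomomorphism = record
              { isRelHomomorphism = record { cong = λ p → ∷-cong p ≋-refl }
              ; homo = λ _ _ → ≋-refl }
            ; ε-homo = shift-[] }
          ; *-homo = λ c d → ∷-cong (CommutativeRing.sym R (CommutativeRing.+-identityʳ R _)) ≋-refl }
        ; 1#-homo = ≋-refl }
      ; -‿homo = λ _ → ≋-refl } }

  -- This is what makes the class of X a root of `f` in the quotient by `f`.
  eval-X : ∀ f → eval R[X] constant f X ≋ f
  eval-X []      = ≋-refl
  eval-X (c ∷ f) = ≋-trans
    (+ₚ-cong (≋-refl {constant c}) (≋-trans (shift-*ₚ 1ₚ (eval R[X] constant f X))
      (∷-cong (CommutativeRing.refl R) (≋-trans (*ₚ-identityˡ _) (eval-X f)))))
    (∷-cong (CommutativeRing.+-identityʳ R c) ≋-refl)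

-- Inverting integral elements in characteristic p

inverse-mod-prime : ∀ {p n} → Prime p → ¬ p ∣ n → Bézout.Identity 1 p n
inverse-mod-prime {p} {n} pp p∤n = coprime-Bézout λ {d} (d∣p , d∣n) → cases d∣n (prime⇒irreducible pp d∣p)
  where
  cases : ∀ {d} → d ∣ n → d ≡ 1 ⊎ d ≡ p → d ≡ 1
  cases d∣n (inj₁ d≡1)    = d≡1
  cases d∣n (inj₂ ≡.refl) = ⊥-elim (p∤n d∣n)

module IntegralDomain {a ℓ} (k : CommutativeRing a ℓ) {p} (pp : Prime p)
  (char : CommutativeRing._≈_ k (SemiringMult._×_ (CommutativeRing.semiring k) p (CommutativeRing.1# k))
                                (CommutativeRing.0# k))
  where
  open CommutativeRing k hiding (zero)
  open FromInteger k
  open Characteristic k pp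
  open Solver k
  open SetoidReasoning setoid
  open SemiringMult semiring using (×1-homo-*; ×-congˡ) renaming (_×_ to _⨯_)

  p∣⇒fromℤ≈0 : ∀ i → p ∣ ℤ.∣ i ∣ → fromℤ i ≈ 0#
  p∣⇒fromℤ≈0 (+ n)    p∣n = p∣⇒⨯≈0 char p∣n 1#
  p∣⇒fromℤ≈0 -[1+ n ] p∣n = trans (-‿cong (p∣⇒⨯≈0 char p∣n 1#)) (trans (sym (+-identityˡ _)) (-‿inverseʳ 0#))

  p∤⇒⨯-unit : ∀ n → ¬ p ∣ n → ∃[ u ] u * n ⨯ 1# ≈ 1#
  p∤⇒⨯-unit n p∤n with inverse-mod-prime pp p∤n
  ... | Bézout.+- x y eq = - (y ⨯ 1#) , (begin
    - (y ⨯ 1#) * n ⨯ 1#                   ≈⟨ solve 3 (λ y n o → (:- y) :* n := o :- (o :+ y :* n)) refl (y ⨯ 1#) (n ⨯ 1#) 1# ⟩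
    1# - (1# + y ⨯ 1# * n ⨯ 1#)           ≈⟨ +-congˡ (-‿cong (+-congˡ (×1-homo-* y n))) ⟨
    1# - (1# + (y ℕ.* n) ⨯ 1#)            ≈⟨ +-congˡ (-‿cong (×-congˡ eq)) ⟩
    1# - (x ℕ.* p) ⨯ 1#                   ≈⟨ +-congˡ (-‿cong (trans (×1-homo-* x p) (trans (*-congˡ char) (zeroʳ _)))) ⟩
    1# - 0#                               ≈⟨ solve 1 (λ o → o :- con (+ 0) := o) refl 1# ⟩
    1#                                    ∎)
  ... | Bézout.-+ x y eq = y ⨯ 1# , (begin
    y ⨯ 1# * n ⨯ 1#                       ≈⟨ ×1-homo-* y n ⟨
    (y ℕ.* n) ⨯ 1#                        ≈⟨ ×-congˡ eq ⟨
    1# + (x ℕ.* p) ⨯ 1#                   ≈⟨ +-congˡ (trans (×1-homo-* x p) (trans (*-congˡ char) (zeroʳ _))) ⟩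
    1# + 0#                               ≈⟨ +-identityʳ 1# ⟩
    1#                                    ∎)

  p∤⇒fromℤ-unit : ∀ i → ¬ p ∣ ℤ.∣ i ∣ → ∃[ u ] u * fromℤ i ≈ 1#
  p∤⇒fromℤ-unit (+ n)    p∤n = p∤⇒⨯-unit n p∤n
  p∤⇒fromℤ-unit -[1+ n ] p∤n with p∤⇒⨯-unit (suc n) p∤n
  ... | u , eq = - u , trans (solve 2 (λ u n → (:- u) :* (:- n) := u :* n) refl u (suc n ⨯ 1#)) eq

  module _ (no-zero-divisors : ∀ {x y} → x * y ≈ 0# → x ≈ 0# ⊎ y ≈ 0#) where

    -- An equation x f(x) ≈ - c inverts x unless p divides c, and then
    -- x cancels.
    integral-invertible : ∀ {x} → Integral.IsIntegral k x → ¬ x ≈ 0# → ∃[ y ] x * y ≈ 1#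
    integral-invertible {x} (f , n , monic , root) x≉0 = descend n f monic root
      where
      open Polynomials ℤₚ.+-*-commutativeRing using (Monic)
      descend : ∀ n f → Monic n f → eval k fromℤ f x ≈ 0# → ∃[ y ] x * y ≈ 1#
      descend n       []      (() , _)
      descend n (i ∷ f) monic root with p ∣? ℤ.∣ i ∣
      descend n (i ∷ f) monic root | no p∤i with p∤⇒fromℤ-unit i p∤i
      ... | u , ui≈1 = - (u * E) , (begin
        x * - (u * E)
          ≈⟨ solve 4 (λ x u E i → x :* (:- (u :* E)) := u :* i :- u :* (i :+ x :* E)) refl x u E (fromℤ i) ⟩
        u * fromℤ i - u * (fromℤ i + x * E)    ≈⟨ +-cong ui≈1 (-‿cong (trans (*-congˡ root) (zeroʳ u))) ⟩
        1# - 0#                                ≈⟨ solve 1 (λ o → o :- con (+ 0) := o) refl 1# ⟩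
        1#                                     ∎)
        where E = eval k fromℤ f x
      descend zero    (i ∷ f) (lead , _)    root | yes p∣i
        with () ← ≡.subst Prime (∣1⇒≡1 (≡.subst (λ j → p ∣ ℤ.∣ j ∣) lead p∣i)) pp
      descend (suc n) (i ∷ f) (lead , high) root | yes p∣i
        with no-zero-divisors {x} {eval k fromℤ f x}
               (trans (sym (trans (+-congʳ (p∣⇒fromℤ≈0 i p∣i)) (+-identityˡ _))) root)
      ... | inj₁ x≈0 = ⊥-elim (x≉0 x≈0)
      ... | inj₂ E≈0 = descend n f (lead , λ k n<k → high (suc k) (s≤s n<k)) E≈0

-- Square-zero classes modulo a polynomial of vanishing discriminant

module SquareZero {c ℓ} (𝐤 : Field c ℓ) {p} (pp : Prime p) where
  private k = Field.ring 𝐤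
  open CommutativeRing k hiding (zero)
  open SemiringMult semiring using () renaming (_×_ to _⨯_)
  open PolynomialRing k
  open Derivative k
  private module P = CommutativeRing R[X]
  open SemiringMult P.semiring using () renaming (_×_ to _⨯ₚ_)
  open SemiringExp P.semiring using (_^_)

  module _ (char : p ⨯ 1# ≈ 0#) {n f} (monic : Monic n f) (integral : All (Integral.IsIntegral k) f)
           (disc : resultant n (n ∸ 1) f (derivative f) ≈ 0#) where
    private
      A = Quotient R[X] (multiples R[X] f)
      module A = CommutativeRing A
      toA : RingHom k A
      toA = quotient-hom R[X] (multiples R[X] f) ∘ʰ constant-hom k

      -- X is a root of the monic `f`, whose coefficients are integral over ℤ; by transitivity so is
      -- X. The pigeonhole argument for its powers rests on this.
      X-integral : Integral.IsIntegral A X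
      X-integral = IntegralEquation.monic-root-integral A {n} {map constant f} {X}
        (monic-map toA {f = f} monic) (Allₚ.map⁺ (All.map (integral-hom toA) integral))
        (A.trans (A.reflexive (eval-map A id constant f X))
        (A.trans (quotient-≈ R[X] (multiples R[X] f) (eval-X k f))
                 (∈⇒≈0 R[X] (multiples R[X] f) {f} (1ₚ , ≋-sym (*ₚ-identityˡ f)))))

    char-A : SemiringMult._×_ A.semiring p A.1# A.≈ A.0#
    char-A = A.trans (A.sym (hom-⨯1 toA p)) (A.trans (RingHom.⟦⟧-cong toA char) (RingHom.0#-homo toA))

    char-P : p ⨯ₚ 1ₚ ≋ []
    char-P = ≋-trans (≋-sym (hom-⨯1 (constant-hom k) p)) (≋-trans (RingHom.⟦⟧-cong (constant-hom k) char) shift-[])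

    derivative-X : derivative X ≋ 1ₚ
    derivative-X = coeffs λ { zero → +-identityʳ 1# ; (suc zero) → refl ; (suc (suc j)) → refl }

    derivative-X^ : ∀ N → p ∣ N → derivative (X ^ N) ≋ []
    derivative-X^ zero    _   = shift-[]
    derivative-X^ (suc N) p∣N = ≋-trans (derivative-^ X N) (Characteristic.p∣⇒⨯≈0 R[X] pp char-P p∣N _)

    -- The derivative of X - X^(p^m) is 1, so f and f′ would be coprime
    -- if f divided it.
    difference≉0 : ∀ m → ¬ (X +ₚ -ₚ (X ^ (p ℕ.^ suc m))) A.≈ A.0#
    difference≉0 m w≈0 = Resultant.resultant≉0 𝐤 {n} {n ∸ 1} {f} (derivative q) q monic
      -- The derivative has degree below `n`, and `n` is at most `suc (n ∸ 1)` also for `n = 0`.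
      (deg-mono {derivative f} (ℕₚ.m≤n+m∸n n 1) (derivative-deg f (monic-deg {n} {f} monic)))
      (begin
        1ₚ                                             ≈⟨ derivative-X ⟨
        derivative X                                   ≈⟨ P.+-identityʳ (derivative X) ⟨
        derivative X +ₚ []                             ≈⟨ +ₚ-cong (≋-refl {derivative X})
                                                            (-ₚ-cong (derivative-X^ N (m∣m*n (p ℕ.^ m)))) ⟨
        derivative X +ₚ -ₚ derivative (X ^ N)          ≈⟨ +ₚ-cong (≋-refl {derivative X}) (derivative-neg (X ^ N)) ⟨
        derivative X +ₚ derivative (-ₚ (X ^ N))        ≈⟨ derivative-+ X (-ₚ (X ^ N)) ⟨
        derivative (X +ₚ -ₚ (X ^ N))                   ≈⟨ derivative-cong w≋qf ⟩
        derivative (q *ₚ f)                            ≈⟨ derivative-* q f ⟩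
        derivative q *ₚ f +ₚ q *ₚ derivative f         ∎)
      disc
      where
      open SetoidReasoning P.setoid
      N = p ℕ.^ suc m
      w∈ : ∃[ q ] (X +ₚ -ₚ (X ^ N)) ≋ q *ₚ f
      w∈ = ≈0⇒∈ R[X] (multiples R[X] f) w≈0
      q = proj₁ w∈
      w≋qf = proj₂ w∈

    square-zero : ¬ ¬ (Σ Polynomial λ z → ¬ (∃[ q ] z ≋ q *ₚ f) × ∃[ q ] z *ₚ z ≋ q *ₚ f)
    square-zero none = from-nilpotent (Characteristic.nilpotent-difference A pp char-A X-integral)
      where
      open SemiringExp A.semiring using () renaming (_^_ to _^A_)
      from-nilpotent : (∃[ i ] ∃[ m ] (X A.- X ^A (p ℕ.^ suc m)) ^A (p ℕ.^ i) A.≈ A.0#) → ⊥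
      from-nilpotent (i , m , nilpotent) = nilpotent⇒square-zero A (p ℕ.^ i) {w}
        -- One further factor `w` turns the exponent into a successor.
        (A.trans (A.*-congˡ {w} nilpotent) (A.zeroʳ w)) w≉0
        λ (z , z≉0 , zz≈0) → none (z , (λ z∈ → z≉0 (∈⇒≈0 R[X] (multiples R[X] f) {z} z∈)) ,
                                   ≈0⇒∈ R[X] (multiples R[X] f) {z *ₚ z} zz≈0)
        where
        w = X A.- X ^A (p ℕ.^ suc m)
        w≉0 : ¬ w A.≈ A.0#
        w≉0 w≈0 = difference≉0 m (A.trans
          (A.+-congˡ {X} (A.-‿cong (^-hom (quotient-hom R[X] (multiples R[X] f)) X (p ℕ.^ suc m)))) w≈0)

-- Ideals with a square factor

module SquareFactor {a ℓ} (R : CommutativeRing a ℓ) where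
  open CommutativeRing R hiding (zero)
  open Ideals R
  open Ideal using (member)
  open Solver R

  span⊆ : ∀ {I : Set (a ⊔ ℓ)} {g : I → Carrier} (J : Ideal) → (∀ i → g i ∈ᴵ J) → ∀ {x} → Span g x → x ∈ᴵ J
  span⊆ J gens (gen i)     = gens i
  span⊆ J gens (resp eq s) = Ideal.resp J eq (span⊆ J gens s)
  span⊆ J gens null        = Ideal.0∈ J
  span⊆ J gens (add s t)   = Ideal.+-closed J (span⊆ J gens s) (span⊆ J gens t)
  span⊆ J gens (scale r s) = Ideal.*-closed J r (span⊆ J gens s)

  -- The colon ideal (J : P²), tested on the products that generate P².
  _∈_:²_ : Carrier → Ideal → Ideal → Set (a ⊔ ℓ)
  r ∈ J :² P = ∀ {x y} → x ∈ᴵ P → y ∈ᴵ P → x * (y * r) ∈ᴵ J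

  -- P² (J : P²), which is J when P² divides J.
  squarePart : Ideal → Ideal → Ideal
  squarePart P J = ⟨ (λ (((x , _) , (y , _) , (r , _)) : ∃ (member P) × ∃ (member P) × ∃ (_∈ J :² P)) → x * (y * r)) ⟩

  -- Only the inclusion J ⊆ P² (J : P²) is recorded, the reverse one being automatic. In this form
  -- the property passes from one factor to a whole product without computing a cofactor.
  _²∣_ : Ideal → Ideal → Set (a ⊔ ℓ)
  P ²∣ J = ∀ {x} → x ∈ᴵ J → x ∈ᴵ squarePart P J

  -- An element `y` of `I` is moved onto the last factor: `y * r` lies in (I J : P²) whenever `r`
  -- lies in (J : P²).
  ²∣-·ʳ : ∀ {P} I J → P ²∣ J → P ²∣ (I · J)
  ²∣-·ʳ {P} I J P²∣J = span⊆ (squarePart P (I · J)) λ ((y , y∈) , (x , x∈)) → multiply y y∈ (P²∣J x∈)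
    where
    multiply : ∀ y → y ∈ᴵ I → ∀ {x} → x ∈ᴵ squarePart P J → y * x ∈ᴵ squarePart P (I · J)
    multiply y y∈ (gen ((u , u∈) , (v , v∈) , (r , r∈))) = resp
      (solve 4 (λ y u v r → u :* (v :* (y :* r)) := y :* (u :* (v :* r))) refl y u v r)
      (gen ((u , u∈) , (v , v∈) , (y * r , λ {s} {t} s∈ t∈ → resp
        (solve 4 (λ y s t r → y :* (s :* (t :* r)) := s :* (t :* (y :* r))) refl y s t r)
        (gen ((y , y∈) , (s * (t * r) , r∈ s∈ t∈))))))
    multiply y y∈ (resp eq s)  = resp (*-congˡ eq) (multiply y y∈ s)
    multiply y y∈ null         = resp (sym (zeroʳ y)) null
    multiply y y∈ (add s t)    = resp (sym (distribˡ y _ _)) (add (multiply y y∈ s) (multiply y y∈ t))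
    multiply y y∈ (scale r {x} s) = resp (solve 3 (λ y r x → r :* (y :* x) := y :* (r :* x)) refl y r x)
                                         (scale r (multiply y y∈ s))

  ²∣-·ˡ : ∀ {P} J I → P ²∣ J → P ²∣ (J · I)
  ²∣-·ˡ {P} J I P²∣J x∈ = transport (²∣-·ʳ {P} I J P²∣J (swap J I x∈))
    where
    swap : ∀ J I {x} → x ∈ᴵ J · I → x ∈ᴵ I · J
    swap J I = span⊆ (I · J) λ ((u , u∈) , (v , v∈)) → resp (*-comm v u) (gen ((v , v∈) , (u , u∈)))
    transport : ∀ {x} → x ∈ᴵ squarePart P (I · J) → x ∈ᴵ squarePart P (J · I)
    transport = span⊆ (squarePart P (J · I)) λ (u , v , (r , r∈)) → gen (u , v , (r , λ {s} {t} s∈ t∈ → swap I J (r∈ s∈ t∈)))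

  ²∣-^ : ∀ P {e} → 1 < e → P ²∣ (P ^ᴵ e)
  ²∣-^ P {suc (suc e)} _ = span⊆ S λ ((u , u∈) , (x , x∈)) → multiply u u∈ x∈
    where
    S = squarePart P (P ^ᴵ suc (suc e))
    multiply : ∀ u → u ∈ᴵ P → ∀ {x} → x ∈ᴵ P ^ᴵ suc e → u * x ∈ᴵ S
    multiply u u∈ (gen ((v , v∈) , (r , r∈))) =
      gen ((u , u∈) , (v , v∈) , (r , λ {s} {t} s∈ t∈ → gen ((s , s∈) , (t * r , gen ((t , t∈) , (r , r∈))))))
    multiply u u∈ (resp eq s)  = resp (*-congˡ eq) (multiply u u∈ s)
    multiply u u∈ null         = resp (sym (zeroʳ u)) null
    multiply u u∈ (add s t)    = resp (sym (distribˡ u _ _)) (add (multiply u u∈ s) (multiply u u∈ t))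
    multiply u u∈ (scale r {x} s) = resp (solve 3 (λ y r x → r :* (y :* x) := y :* (r :* x)) refl u r x)
                                         (scale r (multiply u u∈ s))
  ²∣-^ P {suc zero} (s≤s ())

  ²∣-∏ : ∀ {k} (I : Fin k → Ideal) {P} i → P ²∣ I i → P ²∣ ∏ I
  ²∣-∏ I {P} zero    P²∣I = ²∣-·ˡ {P} (I zero) (∏ (I ∘ suc)) P²∣I
  ²∣-∏ I {P} (suc i) P²∣I = ²∣-·ʳ {P} (I zero) (∏ (I ∘ suc)) (²∣-∏ (I ∘ suc) {P} i P²∣I)

  ²∣-resp : ∀ {P I J} → I ≐ᴵ J → P ²∣ J → P ²∣ I
  ²∣-resp {P} {I} {J} (I⊆J , J⊆I) P²∣J x∈ = span⊆ (squarePart P I)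
    (λ (u , v , (r , r∈)) → gen (u , v , (r , λ {s} {t} s∈ t∈ → J⊆I (r∈ s∈ t∈)))) (P²∣J (I⊆J x∈))

module _ {a ℓ₁ b ℓ₂} {K : CommutativeRing a ℓ₁} {F : CommutativeRing b ℓ₂} (φ : RingHom K F) where
  open RingHom φ using (fun; *-homo; 0#-homo; -‿homo)
  open CommutativeRing F hiding (zero)
  private
    module K = PolynomialRing K
    module F = PolynomialRing F

  map-scale : ∀ c f → map fun (K.scale c f) F.≋ F.scale (fun c) (map fun f)
  map-scale c []      = F.≋-refl
  map-scale c (d ∷ f) = F.∷-cong (*-homo c d) (map-scale c f)

  map-neg : ∀ f → map fun (K.-ₚ f) F.≋ F.-ₚ map fun f
  map-neg []      = F.≋-refl
  map-neg (c ∷ f) = F.∷-cong (-‿homo c) (map-neg f)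

  map-*ₚ : ∀ f g → map fun (f K.*ₚ g) F.≋ map fun f F.*ₚ map fun g
  map-*ₚ []      g = F.≋-refl
  map-*ₚ (c ∷ f) g = F.≋-trans (map-+ₚ φ (K.scale c g) (K.shift (f K.*ₚ g)))
    (F.+ₚ-cong (map-scale c g) (F.∷-cong 0#-homo (map-*ₚ f g)))

  private
    replicate-map : ∀ s f g → map fun f F.≋ g → ∀ k →
      fun (K.coeff (replicate s (CommutativeRing.0# K) ++ f) k) ≈ F.coeff (replicate s 0# ++ g) k
    replicate-map zero    f g eq k       = trans (sym (coeff-map φ f k)) (F.at eq k)
    replicate-map (suc s) f g eq zero    = 0#-homo
    replicate-map (suc s) f g eq (suc k) = replicate-map s f g eq k

    sylvester-hom : ∀ m l f g i j → fun (K.sylvester m l f (K.derivative g) i j) ≈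
                    F.sylvester m l (map fun f) (F.derivative (map fun g)) i j
    sylvester-hom m l f g i j with splitAt l i
    ... | inj₁ r = replicate-map (toℕ (opposite r)) f (map fun f) F.≋-refl (toℕ (opposite j))
    ... | inj₂ r = replicate-map (toℕ (opposite r)) (K.derivative g) (F.derivative (map fun g))
                     (map-derivative φ g) (toℕ (opposite j))

  -- The sign is its own inverse, so a second multiplication removes it. Stating this through φ
  -- serves both the reduction modulo 𝔭 and the embedding into M.
  discriminant≈0⇒resultant≈0 : ∀ n f → fun (K.discriminant n f) ≈ 0# →
    F.resultant n (n ∸ 1) (map fun f) (F.derivative (map fun f)) ≈ 0#
  discriminant≈0⇒resultant≈0 n f disc≈0 = begin
    F.resultant n (n ∸ 1) (map fun f) (F.derivative (map fun f))
      ≈⟨ trans (det-hom φ (K.sylvester n (n ∸ 1) f (K.derivative f)))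
               (Determinant.det-cong F (sylvester-hom n (n ∸ 1) f f)) ⟨
    fun r                       ≈⟨ *-identityˡ _ ⟨
    1# * fun r                  ≈⟨ *-congʳ (Determinant.sgn*sgn F N) ⟨
    (s * s) * fun r             ≈⟨ *-assoc _ _ _ ⟩
    s * (s * fun r)             ≈⟨ *-congˡ (*-congʳ (sgn-hom φ N)) ⟨
    s * (fun s′ * fun r)        ≈⟨ *-congˡ (*-homo s′ r) ⟨
    s * fun (K.discriminant n f) ≈⟨ trans (*-congˡ disc≈0) (zeroʳ s) ⟩
    0#                          ∎
    where
    open SetoidReasoning setoid
    N  = n ℕ.* (n ∸ 1) / 2
    s  = SemiringExp._^_ semiring (- 1#) N
    s′ = SemiringExp._^_ (CommutativeRing.semiring K) (CommutativeRing.-_ K (CommutativeRing.1# K)) N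
    r  = K.resultant n (n ∸ 1) f (K.derivative f)

-- If (Δ) = 𝔭 K and P² divides the extension J of 𝔭, then the elements
-- b r k with b ∈ P, r ∈ (J : P²) and k ∈ K have quotients by Δ in P⁻¹,
-- and not all of these quotients can be integral.
module FractionalElement {a ℓ} {A B : CommutativeRing a ℓ} (φ : RingHom A B)
  (𝔭 K : Ideals.Ideal A) (Δ : CommutativeRing.Carrier A)
  where
  private
    module A  = CommutativeRing A
    module IA = Ideals A
  open CommutativeRing B hiding (zero)
  open Ideals B
  open SquareFactor B
  open Solver B
  open RingHom φ using (fun; ⟦⟧-cong; +-homo; *-homo; 0#-homo)
  open SetoidReasoning setoid

  private
    δ = fun Δ
    J = extend {R = A} {S = B} fun 𝔭

  -- For γ = β/Δ these say that γ𝔭 and γ²𝔭 are integral, with denominators cleared so as to stay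
  -- inside the ring of integers.
  record Fractional (β : Carrier) : Set (a ⊔ ℓ) where
    field
      𝔭-multiple        : ∀ {x} → x IA.∈ᴵ 𝔭 → ∃[ t ] fun x * β ≈ t * δ
      square-𝔭-multiple : ∀ {x} → x IA.∈ᴵ 𝔭 → ∃[ t ] (β * β) * fun x ≈ t * (δ * δ)

  module _ (𝔭K⊆Δ : ∀ {x k} → x IA.∈ᴵ 𝔭 → k IA.∈ᴵ K → ∃[ y ] x A.* k A.≈ y A.* Δ) where

    J-multiple : ∀ {k} → k IA.∈ᴵ K → ∀ {y} → y ∈ᴵ J → ∃[ t ] y * fun k ≈ t * δ
    J-multiple {k} k∈ = span⊆ colon λ (x , x∈) → let y , eq = 𝔭K⊆Δ x∈ k∈ in
      fun y , trans (sym (*-homo x k)) (trans (⟦⟧-cong eq) (*-homo y Δ))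
      where
      colon : Ideal
      colon = record
        { member   = λ y → Multiple B δ (y * fun k)
        ; resp     = λ x≈y → multiple-resp B δ (*-congʳ x≈y)
        ; 0∈       = multiple-resp B δ (sym (zeroˡ _)) (multiple-0 B δ)
        ; +-closed = λ m m′ → multiple-resp B δ (sym (distribʳ _ _ _)) (multiple-+ B δ m m′)
        ; *-closed = λ r m → multiple-resp B δ (sym (*-assoc r _ _)) (multiple-* B δ r m)
        }

    fractional : ∀ {P b r k} → b ∈ᴵ P → r ∈ J :² P → k IA.∈ᴵ K → Fractional ((b * r) * fun k)
    fractional {P} {b} {r} {k} b∈ r∈ k∈ = record
      { 𝔭-multiple = λ {x} x∈ → let t , eq = J-multiple k∈ (gen (x , x∈)) in t * (b * r) , (begin
          fun x * ((b * r) * fun k)     ≈⟨ solve 3 (λ x m k → x :* (m :* k) := (x :* k) :* m) refl (fun x) (b * r) (fun k) ⟩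
          (fun x * fun k) * (b * r)     ≈⟨ *-congʳ eq ⟩
          (t * δ) * (b * r)             ≈⟨ solve 3 (λ t d m → (t :* d) :* m := (t :* m) :* d) refl t δ (b * r) ⟩
          (t * (b * r)) * δ             ∎)
      -- Squaring produces the factor `b * (b * r)`, which lies in `J` by the choice of `r`. Its
      -- product with `k` supplies one δ, and `x * k` supplies the other.
      ; square-𝔭-multiple = λ {x} x∈ →
          let t , eq  = J-multiple k∈ (gen (x , x∈))
              u , eq′ = J-multiple k∈ (r∈ b∈ b∈)
          in (u * r) * t , (begin
          (((b * r) * fun k) * ((b * r) * fun k)) * fun x
            ≈⟨ solve 4 (λ b r k x → (((b :* r) :* k) :* ((b :* r) :* k)) :* x := (((b :* (b :* r)) :* k) :* r) :* (x :* k))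
                 refl b r (fun k) (fun x) ⟩
          ((b * (b * r)) * fun k * r) * (fun x * fun k)
            ≈⟨ *-cong (*-congʳ eq′) eq ⟩
          ((u * δ) * r) * (t * δ)
            ≈⟨ solve 4 (λ u r t d → ((u :* d) :* r) :* (t :* d) := ((u :* r) :* t) :* (d :* d)) refl u r t δ ⟩
          ((u * r) * t) * (δ * δ) ∎)
      }

    module _ {P : Ideal} (Δ∈𝔭K : Δ IA.∈ᴵ 𝔭 IA.· K) (P²∣J : P ²∣ J) (1∉P : ¬ 1# ∈ᴵ P)
             (cancel : ∀ {x} → x * δ ≈ 0# → x ≈ 0#) where

      -- A generator `u v r` of J, with `u` and `v` in P, times `k` is `u (v r k)`. Were all the
      -- `v r k` multiples of δ, then J K would lie in δP. But δ is in J K, so cancelling δ would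
      -- put 1 in P.
      ¬all-integral : ¬ (∀ β → Fractional β → ¬ ¬ (∃[ t ] β ≈ t * δ))
      ¬all-integral integral = Δ∈D λ (q , q∈ , δ≈qδ) → 1∉P (Ideal.resp P (sym (one q δ≈qδ)) q∈)
        where
        one : ∀ q → δ ≈ q * δ → 1# ≈ q
        one q δ≈qδ = begin
          1#             ≈⟨ solve 2 (λ o q → o := (o :- q) :+ q) refl 1# q ⟩
          (1# - q) + q   ≈⟨ +-congʳ (cancel (trans (solve 3 (λ o q d → (o :- q) :* d := o :* d :- q :* d) refl 1# q δ)
                              (trans (+-cong (trans (*-identityˡ δ) δ≈qδ) refl) (-‿inverseʳ (q * δ))))) ⟩
          0# + q         ≈⟨ +-identityˡ q ⟩
          q              ∎
        -- The ideal δP under a double negation, which it inherits from the assumption `integral`.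
        D : Carrier → Set _
        D x = ¬ ¬ (∃[ q ] (q ∈ᴵ P × x ≈ q * δ))
        D-resp : ∀ {x y} → x ≈ y → D x → D y
        D-resp x≈y dx none = dx λ (q , q∈ , eq) → none (q , q∈ , trans (sym x≈y) eq)
        D-0 : D 0#
        D-0 none = none (0# , Ideal.0∈ P , sym (zeroˡ δ))
        D-+ : ∀ {x y} → D x → D y → D (x + y)
        D-+ dx dy none = dx λ (q , q∈ , eq) → dy λ (r , r∈ , eq′) →
          none (q + r , Ideal.+-closed P q∈ r∈ , trans (+-cong eq eq′) (sym (distribʳ δ q r)))
        D-* : ∀ r {x} → D x → D (r * x)
        D-* r dx none = dx λ (q , q∈ , eq) →
          none (r * q , Ideal.*-closed P r q∈ , trans (*-congˡ eq) (sym (*-assoc r q δ)))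
        J-D : ∀ {k} → k IA.∈ᴵ K → ∀ {y} → y ∈ᴵ J → D (y * fun k)
        J-D {k} k∈ y∈ = span⊆ colon
          (λ ((u , u∈) , (v , v∈) , (r , r∈)) none →
            integral ((v * r) * fun k) (fractional {P} {v} {r} {k} v∈ (λ {s} {t} → r∈ {s} {t}) k∈) λ (t , eq) →
            none (t * u , Ideal.*-closed P t u∈ , (begin
              (u * (v * r)) * fun k    ≈⟨ *-assoc u (v * r) (fun k) ⟩
              u * ((v * r) * fun k)    ≈⟨ *-congˡ eq ⟩
              u * (t * δ)              ≈⟨ solve 3 (λ u t d → u :* (t :* d) := (t :* u) :* d) refl u t δ ⟩
              (t * u) * δ              ∎)))
          (P²∣J y∈)
          where
          colon : Ideal
          colon = record
            { member   = λ y → D (y * fun k)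
            ; resp     = λ x≈y → D-resp (*-congʳ x≈y)
            ; 0∈       = D-resp (sym (zeroˡ _)) D-0
            ; +-closed = λ m m′ → D-resp (sym (distribʳ _ _ _)) (D-+ m m′)
            ; *-closed = λ r m → D-resp (sym (*-assoc r _ _)) (D-* r m)
            }
        Δ∈D : D δ
        Δ∈D = SquareFactor.span⊆ A preimage
          (λ ((x , x∈) , (k , k∈)) → D-resp (sym (*-homo x k)) (J-D k∈ (gen (x , x∈)))) Δ∈𝔭K
          where
          preimage : IA.Ideal
          preimage = record
            { member   = λ x → D (fun x)
            ; resp     = λ x≈y → D-resp (⟦⟧-cong x≈y)
            ; 0∈       = D-resp (sym 0#-homo) D-0
            ; +-closed = λ m m′ → D-resp (sym (+-homo _ _)) (D-+ m m′)
            ; *-closed = λ r m → D-resp (sym (*-homo r _)) (D-* (fun r) m)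
            }

-- Cosets and the index of a subgroup

module _ {a ℓ b} (R : CommutativeRing a ℓ) (B : Pred (CommutativeRing.Carrier R) b) where
  open CommutativeRing R hiding (zero)

  record IsAdditiveSubgroup : Set (a ⊔ ℓ ⊔ b) where
    field
      resp     : ∀ {x y} → x ≈ y → B x → B y
      0∈       : B 0#
      +-closed : ∀ {x y} → B x → B y → B (x + y)
      -‿closed : ∀ {x} → B x → B (- x)

  module Cosets (isSubgroup : IsAdditiveSubgroup) where
    open IsAdditiveSubgroup isSubgroup
    open Solver R
    open SemiringMult semiring using () renaming (_×_ to _⨯_)

    record _∼_ (x y : Carrier) : Set b where
      constructor coset
      field difference∈ : B (x - y)
    open _∼_

    ≈⇒∼ : ∀ {x y} → x ≈ y → x ∼ y
    ≈⇒∼ p = coset (resp (sym (trans (+-congʳ p) (-‿inverseʳ _))) 0∈)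

    cosets : CommutativeMonoid a b
    cosets = record
      { Carrier = Carrier ; _≈_ = _∼_ ; _∙_ = _+_ ; ε = 0#
      ; isCommutativeMonoid = record
        { isMonoid = record
          { isSemigroup = record
            { isMagma = record
              { isEquivalence = record
                { refl  = ≈⇒∼ refl
                ; sym   = λ {x} {y} (coset p) → coset
                    (resp (solve 2 (λ x y → :- (x :- y) := y :- x) refl x y) (-‿closed p))
                ; trans = λ {x} {y} {z} (coset p) (coset q) → coset
                    (resp (solve 3 (λ x y z → (x :- y) :+ (y :- z) := x :- z) refl x y z) (+-closed p q)) }
              ; ∙-cong = λ {x} {y} {u} {v} (coset p) (coset q) → coset
                  (resp (solve 4 (λ x y u v → (x :- y) :+ (u :- v) := (x :+ u) :- (y :+ v)) refl x y u v)
                        (+-closed p q)) }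
            ; assoc = λ x y z → ≈⇒∼ (+-assoc x y z) }
          ; identity = (λ x → ≈⇒∼ (+-identityˡ x)) , (λ x → ≈⇒∼ (+-identityʳ x)) }
        ; comm = λ x y → ≈⇒∼ (+-comm x y) } }

    private module C = CommutativeMonoid cosets
    open MonoidSum cosets using (sum; sum-cong-≋; sum-permute; ∑-distrib-+; sum-replicate)
    open MonoidMult C.monoid using () renaming (_×_ to _⨯ᶜ_)

    ⨯ᶜ≡⨯ : ∀ n x → n ⨯ᶜ x ≡ n ⨯ x
    ⨯ᶜ≡⨯ zero    x = ≡.refl
    ⨯ᶜ≡⨯ (suc n) x = ≡.cong (λ y → x + y) (⨯ᶜ≡⨯ n x)

    -- Translation by x permutes the cosets, so summing representatives
    -- of all of them before and after gives N x.
    index-annihilates : ∀ {N} → HasIndex +-abelianGroup B N → ∀ x → B (N ⨯ x)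
    index-annihilates {N} (r , represent , unique) x = resp
      (solve 2 (λ s m → (s :+ m) :- s := m) refl (sum r) (N ⨯ x))
      (difference∈ (C.trans (C.reflexive (≡.cong (λ m → sum r + m) (≡.sym (⨯ᶜ≡⨯ N x)))) (C.sym translated)))
      where
      index : Carrier → Fin N
      index y = proj₁ (represent y)
      index-∼ : ∀ y → y ∼ r (index y)
      index-∼ y = coset (proj₂ (represent y))
      translate : Carrier → Fin N → Fin N
      translate x i = index (r i + x)
      inverse : ∀ x y → x + y ≈ 0# → ∀ i → translate x (translate y i) ≡ i
      inverse x y x+y≈0 i = unique _ _ (difference∈ (begin
        r (translate x (translate y i))   ≈⟨ index-∼ (r (translate y i) + x) ⟨
        r (translate y i) + x             ≈⟨ C.∙-congʳ (index-∼ (r i + y)) ⟨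
        (r i + y) + x                     ≈⟨ ≈⇒∼ (trans (+-assoc _ _ _)
                                                (trans (+-congˡ (trans (+-comm y x) x+y≈0)) (+-identityʳ (r i)))) ⟩
        r i                               ∎))
        where open SetoidReasoning C.setoid
      π : Permutation N N
      π = permutation (translate x) (translate (- x))
        (inverse x (- x) (-‿inverseʳ x))
        (inverse (- x) x (-‿inverseˡ x))
      translated : sum r ∼ (sum r + N ⨯ᶜ x)
      translated = begin
        sum r                             ≈⟨ sum-permute r π ⟩
        sum (λ i → r (translate x i))     ≈⟨ sum-cong-≋ (λ i → C.sym (index-∼ (r i + x))) ⟩
        sum (λ i → r i + x)               ≈⟨ ∑-distrib-+ r (λ _ → x) ⟩
        sum r + sum {N} (λ _ → x)         ≈⟨ C.∙-congˡ {sum r} (sum-replicate N) ⟩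
        sum r + N ⨯ᶜ x                    ∎
        where open SetoidReasoning C.setoid

    multiple-closed : ∀ n {x} → B x → B (n ⨯ x)
    multiple-closed zero    _  = 0∈
    multiple-closed (suc n) bx = +-closed bx (multiple-closed n bx)

    -- If `p` did not divide `N`, a Bézout identity would write 1 through `p` and `N`, both of which
    -- carry `x` into `B`.
    prime∣index : ∀ {p N x} → Prime p → HasIndex +-abelianGroup B N → B (p ⨯ x) → ¬ B x → p ∣ N
    prime∣index {p} {N} {x} pp has-index px∈ x∉ with p ∣? N
    ... | yes p∣N = p∣N
    ... | no  p∤N = ⊥-elim (x∉ (combine (inverse-mod-prime pp p∤N)))
      where
      open SemiringMult semiring using (×-assocˡ; ×-congˡ)
      multiple∈ : ∀ m n → B (n ⨯ x) → B ((m ℕ.* n) ⨯ x)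
      multiple∈ m n nx∈ = resp (×-assocˡ x m n) (multiple-closed m nx∈)
      cancel : ∀ {m n} → 1 ℕ.+ m ≡ n → B (m ⨯ x) → B (n ⨯ x) → B x
      cancel {m} {n} eq mx∈ nx∈ = resp
        (trans (+-congʳ (×-congˡ {x} (≡.sym eq))) (solve 2 (λ x m → (x :+ m) :- m := x) refl x (m ⨯ x)))
        (+-closed nx∈ (-‿closed mx∈))
      combine : Bézout.Identity 1 p N → B x
      combine (Bézout.+- s t eq) = cancel eq (multiple∈ t N (index-annihilates has-index x)) (multiple∈ s p px∈)
      combine (Bézout.-+ s t eq) = cancel eq (multiple∈ s p px∈) (multiple∈ t N (index-annihilates has-index x))

-- The residue field of a prime above p

module ResidueField {a ℓ} (A : CommutativeRing a ℓ) (integral : ∀ x → Integral.IsIntegral A x)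
  {p} (pp : Prime p) (𝔭 : Ideals.Ideal A) (isPrime : Ideals.IsNonzeroPrime A 𝔭) (over : LiesOver A 𝔭 p)
  where
  open CommutativeRing A hiding (zero)
  open Ideals A using (_∈ᴵ_)
  open SemiringMult semiring using () renaming (_×_ to _⨯_)
  open Ideals.IsNonzeroPrime isPrime using (proper; prime)
  private
    k = Quotient A 𝔭
    module k = CommutativeRing k
    π : RingHom A k
    π = quotient-hom A 𝔭

  p∈𝔭 : p ⨯ 1# ∈ᴵ 𝔭
  p∈𝔭 = Equivalence.from (over (+ p)) ∣-refl

  private
    char-k : SemiringMult._×_ k.semiring p k.1# k.≈ k.0#
    char-k = k.trans (k.sym (hom-⨯1 π p)) (∈⇒≈0 A 𝔭 p∈𝔭)

    no-zero-divisors : ∀ {x y} → x k.* y k.≈ k.0# → x k.≈ k.0# ⊎ y k.≈ k.0#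
    no-zero-divisors xy≈0 = ⊎-map (∈⇒≈0 A 𝔭) (∈⇒≈0 A 𝔭) (prime (≈0⇒∈ A 𝔭 xy≈0))

  -- Maximality of 𝔭 comes out of integrality: an integer equation for `x`, read in characteristic
  -- `p`, exhibits an inverse.
  residueField : Field a (a ⊔ ℓ)
  residueField = record
    { ring       = k
    ; 1≉0        = λ 1≈0 → proper (≈0⇒∈ A 𝔭 1≈0)
    ; invertible = λ x → IntegralDomain.integral-invertible k pp char-k no-zero-divisors (integral-hom π (integral x))
    }

  invertible-mod : ∀ {x} → ¬ x ∈ᴵ 𝔭 → ∃[ y ] x * y - 1# ∈ᴵ 𝔭
  invertible-mod {x} x∉𝔭 = let y , eq = Field.invertible residueField x (x∉𝔭 ∘ ≈0⇒∈ A 𝔭) in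
    y , Congruent.difference∈ eq

  private
    module A[X] = PolynomialRing A
    module k[X] = PolynomialRing k

  -- Lifts the square-zero class of k[X]/(h) to the ring above; the quotient has the same carrier,
  -- so the same lists serve. Reduction to degree below `n` prepares the comparison of coefficients
  -- in powers of η.
  nontrivial-square-zero : ∀ {n h} → A[X].Monic n h → A[X].discriminant n h ∈ᴵ 𝔭 →
    ¬ ¬ (Σ A[X].Polynomial λ z → A[X].deg z < n × (∃[ e ] ¬ A[X].coeff z e ∈ᴵ 𝔭) ×
         Σ A[X].Polynomial λ q → ∀ j → A[X].coeff (z A[X].*ₚ z A[X].+ₚ A[X].-ₚ (q A[X].*ₚ h)) j ∈ᴵ 𝔭)
  nontrivial-square-zero {n} {h} monic disc∈𝔭 none =
    SquareZero.square-zero residueField pp char-k {n} {hk} monic-k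
      (All.universal (λ x → integral-hom π (integral x)) hk)
      (discriminant≈0⇒resultant≈0 π n h (∈⇒≈0 A 𝔭 disc∈𝔭))
      reduce
    where
    hk = map id h
    monic-k : k[X].Monic n hk
    monic-k = monic-map π {n} {h} monic
    module kX = CommutativeRing k[X].R[X]
    open Solver k[X].R[X]

    map-id : ∀ f → map id f k[X].≋ f
    map-id f = kX.reflexive (Listₚ.map-id f)

    reduce : ¬ (Σ k[X].Polynomial λ z → ¬ (∃[ q ] z k[X].≋ q k[X].*ₚ hk) × ∃[ q ] z k[X].*ₚ z k[X].≋ q k[X].*ₚ hk)
    reduce (z , z∉ , q , zz≋) = finish (k[X].divide {n} {hk} monic-k z)
      where
      finish : ¬ (∃[ s ] ∃[ r ] (z k[X].≋ (s k[X].*ₚ hk k[X].+ₚ r) × k[X].deg r < n))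
      finish (s , r , z≋ , deg-r) =
        Coprimality.leading-coefficient residueField n t deg-t t≉0 λ (e , _ , _ , c≉0) →
        none (t , deg-take , (e , λ c∈ → c≉0 (k.trans (k.sym (coeff-k t e)) (∈⇒≈0 A 𝔭 c∈))) ,
              q′ , λ j → ≈0⇒∈ A 𝔭 (k.trans (k.sym (coeff-map π d j)) (k[X].at d≋0 j)))
        where
        -- The remainder has degree below `n` only modulo 𝔭; truncating the list makes the bound
        -- hold before reduction.
        t : List Carrier
        t = take n r
        t≋r : t k[X].≋ r
        t≋r = Resultant.take-deg residueField n r deg-r
        deg-t : k[X].deg t < n
        deg-t = k[X].deg-resp (k[X].≋-sym t≋r) deg-r
        deg-take : A[X].deg t < n
        deg-take = A[X].deg-mono {t} (≡.subst (_≤ n) (≡.sym (Listₚ.length-take n r)) (ℕₚ.m⊓n≤m n (length r)))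
          (A[X].deg-length t)
        coeff-k : ∀ f e → A[X].coeff f e k.≈ k[X].coeff f e
        coeff-k f e = k.trans (k.sym (coeff-map π f e)) (k[X].at (map-id f) e)
        t≉0 : ¬ t k[X].≋ []
        t≉0 t≋0 = z∉ (s , k[X].≋-trans z≋ (k[X].≋-trans
          (k[X].+ₚ-cong (k[X].≋-refl {s k[X].*ₚ hk}) (k[X].≋-trans (k[X].≋-sym t≋r) t≋0)) (k[X].+ₚ-identityʳ _)))
        -- From `z = s h + r` and `z² = q h` follows `r² = (q - s² h - 2 s r) h`.
        q′ : List Carrier
        q′ = q k[X].+ₚ k[X].-ₚ ((s k[X].*ₚ s) k[X].*ₚ hk k[X].+ₚ (s k[X].*ₚ r k[X].+ₚ s k[X].*ₚ r))
        d : List Carrier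
        d = t A[X].*ₚ t A[X].+ₚ A[X].-ₚ (q′ A[X].*ₚ h)
        open import Relation.Binary.Reasoning.Setoid kX.setoid
        d≋0 : map id d k[X].≋ []
        d≋0 = begin
          map id d
            ≈⟨ map-+ₚ π (t A[X].*ₚ t) (A[X].-ₚ (q′ A[X].*ₚ h)) ⟩
          map id (t A[X].*ₚ t) k[X].+ₚ map id (A[X].-ₚ (q′ A[X].*ₚ h))
            ≈⟨ k[X].+ₚ-cong (map-*ₚ π t t) (kX.trans (map-neg π (q′ A[X].*ₚ h)) (k[X].-ₚ-cong (map-*ₚ π q′ h))) ⟩
          map id t k[X].*ₚ map id t k[X].+ₚ k[X].-ₚ (map id q′ k[X].*ₚ hk)
            ≈⟨ k[X].+ₚ-cong (kX.*-cong (kX.trans (map-id t) t≋r) (kX.trans (map-id t) t≋r))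
                            (k[X].-ₚ-cong (kX.*-congʳ {hk} (map-id q′))) ⟩
          r k[X].*ₚ r k[X].+ₚ k[X].-ₚ (q′ k[X].*ₚ hk)
            ≈⟨ solve 4 (λ r q s h → r :* r :- (q :- ((s :* s) :* h :+ (s :* r :+ s :* r))) :* h :=
                                   (s :* h :+ r) :* (s :* h :+ r) :- q :* h) kX.refl r q s hk ⟩
          (s k[X].*ₚ hk k[X].+ₚ r) k[X].*ₚ (s k[X].*ₚ hk k[X].+ₚ r) k[X].+ₚ k[X].-ₚ (q k[X].*ₚ hk)
            ≈⟨ k[X].+ₚ-cong (kX.trans (kX.*-cong (kX.sym z≋) (kX.sym z≋)) zz≋) kX.refl ⟩
          q k[X].*ₚ hk k[X].+ₚ k[X].-ₚ (q k[X].*ₚ hk)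
            ≈⟨ kX.-‿inverseʳ (q k[X].*ₚ hk) ⟩
          [] ∎

-- Characteristic zero and nonvanishing of the discriminant

CharacteristicZero : ∀ {c ℓ} → CommutativeRing c ℓ → Set ℓ
CharacteristicZero R = ∀ n → ¬ suc n ⨯ 1# ≈ 0#
  where
  open CommutativeRing R
  open SemiringMult semiring using () renaming (_×_ to _⨯_)

module _ {c ℓ} {R : CommutativeRing c ℓ} (φ : RingHom ℚₚ.+-*-commutativeRing R) where
  open CommutativeRing R hiding (zero)
  open RingHom φ using (fun; *-homo; 1#-homo; ⟦⟧-cong)
  open SemiringMult (CommutativeRing.semiring ℚₚ.+-*-commutativeRing) using () renaming (_×_ to _⨯_)

  private
    0<1+n⨯1 : ∀ n → 0ℚ ℚ.< suc n ⨯ 1ℚ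
    0<1+n⨯1 zero    = ≡.subst (0ℚ ℚ.<_) (≡.sym (ℚₚ.+-identityʳ 1ℚ)) (ℚₚ.positive⁻¹ 1ℚ)
    0<1+n⨯1 (suc n) = ≡.subst (ℚ._< suc (suc n) ⨯ 1ℚ) (ℚₚ.+-identityʳ 0ℚ)
      (ℚₚ.+-mono-< (ℚₚ.positive⁻¹ 1ℚ) (0<1+n⨯1 n))

  ℚ-algebra⇒characteristicZero : ¬ 1# ≈ 0# → CharacteristicZero R
  ℚ-algebra⇒characteristicZero 1≉0 n n≈0 = 1≉0 (trans (sym 1#-homo)
    (trans (⟦⟧-cong (≡.sym (ℚₚ.*-inverseʳ q)))
    (trans (*-homo q (1/ q))
    (trans (*-congʳ (trans (hom-⨯1 φ (suc n)) n≈0)) (zeroˡ _)))))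
    where
    q = suc n ⨯ 1ℚ
    instance
      q≢0 : ℚ.NonZero q
      q≢0 = ℚ.≢-nonZero λ q≡0 → ℚₚ.<⇒≢ (0<1+n⨯1 n) (≡.sym q≡0)

module _ {a ℓ₁ c ℓ₂} {K : CommutativeRing a ℓ₁} (𝐅 : Field c ℓ₂) (φ : RingHom K (Field.ring 𝐅)) where
  private F = Field.ring 𝐅
  open CommutativeRing F hiding (zero)
  open RingHom φ using (fun)
  open SemiringMult semiring using () renaming (_×_ to _⨯_)
  private
    module F[X] = PolynomialRing F
  open Derivative F using (coeff-derivative; derivative-deg; ⨯-cong)

  -- In characteristic 0 the derivative has a nonzero coefficient at degree one less, so it is
  -- nonzero of smaller degree, hence coprime to the irreducible polynomial, and the resultant
  -- cannot vanish.
  irreducible⇒discriminant≉0 : CharacteristicZero F → ∀ {n f} → Polynomials.Monic K n f →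
    F[X].Irreducible (map fun f) → ¬ fun (Polynomials.discriminant K n f) ≈ 0#
  -- A monic polynomial of degree 0 is 1, a unit, hence not irreducible.
  irreducible⇒discriminant≉0 char {zero}  {f} monic irreducible disc≈0 =
    RawSemiringDefs.Irreducible.p∤1 irreducible (divides-by F[X].1ₚ (F[X].at
      (F[X].≋-trans (F[X].*ₚ-identityˡ (map fun f)) (F[X].coeffs {map fun f} {F[X].1ₚ} λ
        { zero → proj₁ monic′ ; (suc k) → proj₂ monic′ (suc k) (s≤s z≤n) }))))
    where
    monic′ : F[X].Monic 0 (map fun f)
    monic′ = monic-map φ {f = f} monic
  irreducible⇒discriminant≉0 char {suc n} {f} monic irreducible disc≈0 =
    Coprimality.irreducible⇒coprime 𝐅 {suc n} {g} monic′ irreducible (F[X].derivative g)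
      (derivative-deg g (F[X].monic-deg {suc n} {g} monic′)) derivative≉0
      λ (u , v , bezout) → Resultant.resultant≉0 𝐅 {suc n} {n} {g} {F[X].derivative g} u v monic′
        (derivative-deg g (F[X].monic-deg {suc n} {g} monic′)) bezout
        (discriminant≈0⇒resultant≈0 φ (suc n) f disc≈0)
    where
    g = map fun f
    monic′ : F[X].Monic (suc n) g
    monic′ = monic-map φ {f = f} monic
    derivative≉0 : ¬ F[X].derivative g F[X].≋ []
    derivative≉0 g′≋0 = char n (trans (⨯-cong (suc n) (sym (proj₁ monic′)))
      (trans (sym (coeff-derivative g n)) (F[X].at g′≋0 n)))

-- Integral elements of M(η) and the order 𝒪M[η]

module _ {c ℓ c′ ℓ′} {R : CommutativeRing c ℓ} {S : CommutativeRing c′ ℓ′} (φ : RingHom R S) where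
  open RingHom φ

  𝒪-hom : RingHom (𝒪 R) (𝒪 S)
  𝒪-hom = record
    { fun = 𝒪-map φ
    ; isRingHomomorphism = record
      { isSemiringHomomorphism = record
        { isNearSemiringHomomorphism = record
          { +-isMonoidHomomorphism = record
            { isMagmaHomomorphism = record
              { isRelHomomorphism = record { cong = ⟦⟧-cong }
              ; homo = λ x y → +-homo (proj₁ x) (proj₁ y) }
            ; ε-homo = 0#-homo }
          ; *-homo = λ x y → *-homo (proj₁ x) (proj₁ y) }
        ; 1#-homo = 1#-homo }
      ; -‿homo = λ x → -‿homo (proj₁ x) } }

module _ {a ℓ} (R : CommutativeRing a ℓ) where
  open CommutativeRing R
  open Integral R using (IsIntegral; integral-isSubring)
  open IsSubring integral-isSubring

  eval-integral : ∀ {b} {B : Set b} (φ : B → Carrier) (f : List B) {x} →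
                  (∀ c → IsIntegral (φ c)) → IsIntegral x → IsIntegral (eval R φ f x)
  eval-integral φ []      int-φ int-x = 0-closed
  eval-integral φ (c ∷ f) int-φ int-x = +-closed (int-φ c) (*-closed int-x (eval-integral φ f int-φ int-x))

module _ {a ℓ p} (R : CommutativeRing a ℓ) (P : CommutativeRing.Carrier R → Set p) (S : IsSubring R P) where
  open Integral using (IsIntegral)

  subring-integral : ∀ {x} (px : P x) → IsIntegral R x → IsIntegral (subring R P S) (x , px)
  subring-integral {x} px (f , n , monic , root) =
    f , n , monic , CommutativeRing.trans R (hom-eval (subring-hom R P S) f (x , px)) root

module _ {c ℓ} {M : CommutativeRing c ℓ} (𝛀 : Field c ℓ) (ε : RingHom M (Field.ring 𝛀))
         (η : CommutativeRing.Carrier (Field.ring 𝛀)) where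
  open Simple 𝛀 ε η
  open RingHom ε using (fun; 0#-homo)

  eval-generated : ∀ {b} {B : Set b} (φ : B → CommutativeRing.Carrier M) (f : List B) →
                   Generated (eval (Field.ring 𝛀) (fun ∘ φ) f η)
  eval-generated φ []      = resp 0#-homo (base _)
  eval-generated φ (c ∷ f) = add (base (φ c)) (mul root (eval-generated φ f))

module _ {a ℓ₁ b ℓ₂} {R : CommutativeRing a ℓ₁} {S : CommutativeRing b ℓ₂} (φ : RingHom R S) where
  private
    module R = CommutativeRing R
    module S = CommutativeRing S
  open RingHom φ using (fun; +-homo; 0#-homo)
  open SemiringMult R.semiring using () renaming (_×_ to _⨯ᴿ_)
  open SemiringMult S.semiring using () renaming (_×_ to _⨯ˢ_)

  ⨯-hom : ∀ n x → fun (n ⨯ᴿ x) S.≈ n ⨯ˢ fun x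
  ⨯-hom zero    x = 0#-homo
  ⨯-hom (suc n) x = S.trans (+-homo x (n ⨯ᴿ x)) (S.+-congˡ (⨯-hom n x))

module Adjunction {c ℓ}
  {L : CommutativeRing c ℓ} (𝐌 : Field c ℓ) (ι : RingHom L (Field.ring 𝐌))
  {n} {h : Polynomials.Polynomial (𝒪 L)} (monic : Polynomials.Monic (𝒪 L) n h)
  (irreducible : Polynomials.Irreducible (Field.ring 𝐌) (map (RingHom.fun ι ∘ proj₁) h))
  (𝛀 : Field c ℓ) (ε : RingHom (Field.ring 𝐌) (Field.ring 𝛀)) (η : CommutativeRing.Carrier (Field.ring 𝛀))
  (h[η]≈0 : CommutativeRing._≈_ (Field.ring 𝛀)
    (eval (Field.ring 𝛀) (RingHom.fun ε ∘ RingHom.fun ι ∘ proj₁) h η) (CommutativeRing.0# (Field.ring 𝛀)))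
  where
  open Simple 𝛀 ε η
  private
    M = Field.ring 𝐌
    Ω = Field.ring 𝛀
    module M where
      open CommutativeRing M public
      open Solver M public
      open SetoidReasoning setoid public
    module L[X] = PolynomialRing (𝒪 L)
    module 𝒪M[X] = PolynomialRing (𝒪 M)
    module M[X] = PolynomialRing M
    module 𝒪M = CommutativeRing (𝒪 M)
    module ε = RingHom ε
  open CommutativeRing Ω hiding (zero)
  open SemiringMult semiring using (×-assoc-*; ×-congʳ) renaming (_×_ to _⨯_)
  open Integral Ω using (IsIntegral)
  open Solver Ω
  open SetoidReasoning setoid

  private
    𝒪ι : RingHom (𝒪 L) (𝒪 M)
    𝒪ι = 𝒪-hom ι

  to-M : RingHom (𝒪 M) M
  to-M = 𝒪-inclusion M

  to-Ω : RingHom (𝒪 M) Ω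
  to-Ω = ε ∘ʰ to-M

  private
    module φ = Evaluation (to-Ω ∘ʰ 𝒪ι) η
    module ψ = Evaluation to-Ω η
    module ev-ε = Evaluation ε η

  to-Ω-integral : ∀ x → IsIntegral (RingHom.fun to-Ω x)
  to-Ω-integral x = integral-hom to-Ω (𝒪-integral M x)

  η-integral : IsIntegral η
  η-integral = IntegralEquation.monic-root-integral Ω {n} {map φ′.fun h}
    (monic-map (to-Ω ∘ʰ 𝒪ι) {f = h} monic)
    (Allₚ.map⁺ (All.universal (λ x → to-Ω-integral (RingHom.fun 𝒪ι x)) h))
    (trans (reflexive (eval-map Ω id φ′.fun h η)) h[η]≈0)
    where module φ′ = RingHom (to-Ω ∘ʰ 𝒪ι)

  𝒪M⟮η⟯ : CommutativeRing (c ⊔ ℓ) ℓ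
  𝒪M⟮η⟯ = 𝒪 (Field.ring M⟮η⟯)

  underlying : RingHom 𝒪M⟮η⟯ Ω
  underlying = subring-hom Ω Generated _ ∘ʰ 𝒪-inclusion (Field.ring M⟮η⟯)

  𝒪M[η]-isSubgroup : IsAdditiveSubgroup 𝒪M⟮η⟯ 𝒪M[η]
  𝒪M[η]-isSubgroup = record
    { resp     = λ x≈y (f , p) → f , trans (sym x≈y) p
    ; 0∈       = [] , refl
    ; +-closed = λ (f , p) (g , q) → f 𝒪M[X].+ₚ g , trans (+-cong p q) (sym (ψ.ev-+ f g))
    ; -‿closed = λ (f , p) → 𝒪M[X].-ₚ f , trans (-‿cong p) (sym (ψ.ev-neg f))
    }

  φ≈ψ : ∀ z → φ.ev z ≈ ψ.ev (map (RingHom.fun 𝒪ι) z)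
  φ≈ψ z = reflexive (≡.sym (eval-map Ω (RingHom.fun to-Ω) (RingHom.fun 𝒪ι) z η))

  module _ (γ : M.Carrier) (z : L[X].Polynomial) where

    private
      θ = ε.fun γ * φ.ev z

    θ-generated : Generated θ
    θ-generated = mul (base γ) (eval-generated 𝛀 ε η (RingHom.fun ι ∘ proj₁) z)

    θ-integral : (∃[ f ] (ε.fun γ * ε.fun γ) * (φ.ev z * φ.ev z) ≈ ψ.ev f) → IsIntegral θ
    θ-integral (f , eq) = IntegralEquation.square-integral Ω (IntegralEquation.integral-resp Ω
      (sym (trans (solve 2 (λ g z → (g :* z) :* (g :* z) := (g :* g) :* (z :* z)) refl (ε.fun γ) (φ.ev z)) eq))
      (eval-integral Ω (RingHom.fun to-Ω) f to-Ω-integral η-integral))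

    -- Applied to `d = z² - q h`, whose coefficients lie in 𝔭 and whose value at η is that of z².
    square-in-𝒪M[η] : ∀ d → (∀ j → Integral.IsIntegral M ((γ M.* γ) M.* RingHom.fun ι (proj₁ (L[X].coeff d j)))) →
                      ∃[ f ] (ε.fun γ * ε.fun γ) * φ.ev d ≈ ψ.ev f
    square-in-𝒪M[η] []      coefficients = [] , zeroʳ _
    square-in-𝒪M[η] (x ∷ d) coefficients =
      let f , eq = square-in-𝒪M[η] d (coefficients ∘ suc)
      in (_ , coefficients 0) ∷ f , (begin
        g * (ε.fun ιx + η * φ.ev d)
          ≈⟨ solve 4 (λ g x y d → g :* (x :+ y :* d) := g :* x :+ y :* (g :* d)) refl g (ε.fun ιx) η (φ.ev d) ⟩
        g * ε.fun ιx + η * (g * φ.ev d)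
          ≈⟨ +-cong (*-congʳ (ε.*-homo γ γ)) (*-congˡ (sym eq)) ⟨
        ε.fun (γ M.* γ) * ε.fun ιx + η * ψ.ev f
          ≈⟨ +-congʳ (ε.*-homo (γ M.* γ) ιx) ⟨
        ε.fun ((γ M.* γ) M.* ιx) + η * ψ.ev f ∎)
      where
      g  = ε.fun γ * ε.fun γ
      ιx = RingHom.fun ι (proj₁ x)

    module _ (integral : IsIntegral θ) where

      element : CommutativeRing.Carrier 𝒪M⟮η⟯
      element = (θ , θ-generated) , subring-integral Ω Generated _ θ-generated integral

      private
        module 𝒪M⟮η⟯ = CommutativeRing 𝒪M⟮η⟯
        open SemiringMult 𝒪M⟮η⟯.semiring using () renaming (_×_ to _⨯′_)
        open SemiringMult (CommutativeRing.semiring (𝒪 L)) using () renaming (_×_ to _⨯ᴸ_)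
        1ᴸ = CommutativeRing.1# (𝒪 L)

      multiple∈𝒪M[η] : ∀ p → Integral.IsIntegral M (RingHom.fun ι (proj₁ (p ⨯ᴸ 1ᴸ)) M.* γ) → 𝒪M[η] (p ⨯′ element)
      multiple∈𝒪M[η] p integral = 𝒪M[X].scale t (map (RingHom.fun 𝒪ι) z) , (begin
        RingHom.fun underlying (p ⨯′ element)     ≈⟨ ⨯-hom underlying p element ⟩
        p ⨯ θ                                     ≈⟨ ×-congʳ p (*-identityˡ θ) ⟨
        p ⨯ (1# * θ)                              ≈⟨ ×-assoc-* p 1# θ ⟨
        (p ⨯ 1#) * θ                              ≈⟨ *-congʳ (hom-⨯1 (to-Ω ∘ʰ 𝒪ι) p) ⟨
        ε.fun (ιp) * (ε.fun γ * φ.ev z)           ≈⟨ *-assoc _ _ _ ⟨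
        (ε.fun (ιp) * ε.fun γ) * φ.ev z           ≈⟨ *-congʳ (ε.*-homo ιp γ) ⟨
        ε.fun (proj₁ t) * φ.ev z                  ≈⟨ *-congˡ (φ≈ψ z) ⟩
        ε.fun (proj₁ t) * ψ.ev (map (RingHom.fun 𝒪ι) z)          ≈⟨ ψ.ev-scale t (map (RingHom.fun 𝒪ι) z) ⟨
        ψ.ev (𝒪M[X].scale t (map (RingHom.fun 𝒪ι) z))            ∎)
        where
        ιp = RingHom.fun ι (proj₁ (p ⨯ᴸ 1ᴸ))
        t : 𝒪M.Carrier
        t = ιp M.* γ , integral

      -- Dividing a representation of θ by the monic `h` leaves `g` of degree below `n` with the
      -- same value at η. By independence `γ z` and `g` agree coefficientwise, and those of `g` are
      -- integral.
      element∈⇒coefficients : L[X].deg z < n → 𝒪M[η] element →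
        ¬ ¬ (∀ e → Integral.IsIntegral M (γ M.* RingHom.fun ι (proj₁ (L[X].coeff z e))))
      element∈⇒coefficients deg-z (f , θ≈f) none =
        reduce (𝒪M[X].divide {n} {map (RingHom.fun 𝒪ι) h} (monic-map 𝒪ι {f = h} monic) f)
        where
        ιh = map (RingHom.fun 𝒪ι) h
        ιz = map (RingHom.fun ι ∘ proj₁) z
        reduce : ¬ (∃[ q ] ∃[ g ] (f 𝒪M[X].≋ (q 𝒪M[X].*ₚ ιh 𝒪M[X].+ₚ g) × 𝒪M[X].deg g < n))
        reduce (q , g , f≋ , deg-g) =
          Coprimality.irreducible⇒independent 𝐌 {n} {map (RingHom.fun ι ∘ proj₁) h}
            (monic-map (ι ∘ʰ 𝒪-inclusion L) {f = h} monic) irreducible ε η (Field.1≉0 𝛀)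
            (trans (reflexive (eval-map Ω ε.fun (RingHom.fun ι ∘ proj₁) h η)) h[η]≈0)
            w deg-w w[η]≈0
            λ w≋0 → none λ e → IntegralEquation.integral-resp M (M.sym (coefficient w≋0 e)) (proj₂ (𝒪M[X].coeff g e))
          where
          w = M[X].scale γ ιz M[X].+ₚ M[X].-ₚ map proj₁ g
          deg-w : M[X].deg w < n
          deg-w = M[X].deg-+ₚ {M[X].scale γ ιz} (M[X].deg-scale γ {ιz} (deg-map (ι ∘ʰ 𝒪-inclusion L) {z} deg-z))
                    (M[X].deg-neg {map proj₁ g} (deg-map to-M {g} deg-g))
          w[η]≈0 : ev-ε.ev w ≈ 0#
          w[η]≈0 = begin
            ev-ε.ev w
              ≈⟨ trans (ev-ε.ev-+ (M[X].scale γ ιz) (M[X].-ₚ map proj₁ g))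
                       (+-cong (ev-ε.ev-scale γ ιz) (ev-ε.ev-neg (map proj₁ g))) ⟩
            ε.fun γ * ev-ε.ev ιz - ev-ε.ev (map proj₁ g)
              ≈⟨ +-cong (*-congˡ (reflexive (eval-map Ω ε.fun (RingHom.fun ι ∘ proj₁) z η)))
                        (-‿cong (reflexive (eval-map Ω ε.fun proj₁ g η))) ⟩
            θ - ψ.ev g
              ≈⟨ +-congʳ (trans θ≈f (trans (ψ.ev-cong f (q 𝒪M[X].*ₚ ιh 𝒪M[X].+ₚ g) f≋) (ψ.ev-+ (q 𝒪M[X].*ₚ ιh) g))) ⟩
            (ψ.ev (q 𝒪M[X].*ₚ ιh) + ψ.ev g) - ψ.ev g
              ≈⟨ solve 2 (λ x y → (x :+ y) :- y := x) refl (ψ.ev (q 𝒪M[X].*ₚ ιh)) (ψ.ev g) ⟩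
            ψ.ev (q 𝒪M[X].*ₚ ιh)
              ≈⟨ trans (ψ.ev-* q ιh) (trans (*-congˡ (trans (sym (φ≈ψ h)) h[η]≈0)) (zeroʳ _)) ⟩
            0# ∎

          coefficient : w M[X].≋ [] → ∀ e →
            γ M.* RingHom.fun ι (proj₁ (L[X].coeff z e)) M.≈ proj₁ (𝒪M[X].coeff g e)
          coefficient w≋0 e = M.begin
            γ M.* RingHom.fun ι (proj₁ (L[X].coeff z e))
              M.≈⟨ M.*-congˡ (coeff-map (ι ∘ʰ 𝒪-inclusion L) z e) ⟨
            γ M.* M[X].coeff ιz e
              M.≈⟨ M.solve 2 (λ x y → x M.:= (x M.:- y) M.:+ y) M.refl (γ M.* M[X].coeff ιz e) (M[X].coeff (map proj₁ g) e) ⟩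
            (γ M.* M[X].coeff ιz e M.- M[X].coeff (map proj₁ g) e) M.+ M[X].coeff (map proj₁ g) e
              M.≈⟨ M.+-congʳ (M.+-cong (M[X].coeff-scale γ ιz e) (M[X].coeff-neg (map proj₁ g) e)) ⟨
            (M[X].coeff (M[X].scale γ ιz) e M.+ M[X].coeff (M[X].-ₚ map proj₁ g) e) M.+ M[X].coeff (map proj₁ g) e
              M.≈⟨ M.+-cong (M.trans (M.sym (M[X].coeff-+ (M[X].scale γ ιz) (M[X].-ₚ map proj₁ g) e)) (M[X].at w≋0 e))
                            (coeff-map to-M g e) ⟩
            M.0# M.+ proj₁ (𝒪M[X].coeff g e)
              M.≈⟨ M.+-identityˡ _ ⟩
            proj₁ (𝒪M[X].coeff g e) M.∎

-- An element of order p modulo 𝒪M[η]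

module Nonmaximality {c ℓ} (𝐋 : NumberField c ℓ)
  {n} {h : Polynomials.Polynomial (𝒪 (NumberField.ring 𝐋))} (monic : Polynomials.Monic (𝒪 (NumberField.ring 𝐋)) n h)
  {p} (pp : Prime p)
  (𝔭 : Ideals.Ideal (𝒪 (NumberField.ring 𝐋)))
  (isPrime : Ideals.IsNonzeroPrime (𝒪 (NumberField.ring 𝐋)) 𝔭) (over : LiesOver (𝒪 (NumberField.ring 𝐋)) 𝔭 p)
  (K : Ideals.Ideal (𝒪 (NumberField.ring 𝐋)))
  (Δ≐𝔭K : Ideals._≐ᴵ_ (𝒪 (NumberField.ring 𝐋))
    (Ideals.principal (𝒪 (NumberField.ring 𝐋)) (Polynomials.discriminant (𝒪 (NumberField.ring 𝐋)) n h))
    (Ideals._·_ (𝒪 (NumberField.ring 𝐋)) 𝔭 K))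
  (𝐌 : Field c ℓ) (ι : RingHom (NumberField.ring 𝐋) (Field.ring 𝐌))
  (irreducible : Polynomials.Irreducible (Field.ring 𝐌) (map (RingHom.fun ι ∘ proj₁) h))
  (𝛀 : Field c ℓ) (ε : RingHom (Field.ring 𝐌) (Field.ring 𝛀)) (η : CommutativeRing.Carrier (Field.ring 𝛀))
  (h[η]≈0 : CommutativeRing._≈_ (Field.ring 𝛀)
    (eval (Field.ring 𝛀) (RingHom.fun ε ∘ RingHom.fun ι ∘ proj₁) h η) (CommutativeRing.0# (Field.ring 𝛀)))
  where
  open Adjunction 𝐌 ι {n} {h} monic irreducible 𝛀 ε η h[η]≈0
  open Simple 𝛀 ε η using (𝒪M[η])
  private
    L = NumberField.ring 𝐋
    M = Field.ring 𝐌
    Ω = Field.ring 𝛀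
    Δ = Polynomials.discriminant (𝒪 L) n h
    module 𝒪L = CommutativeRing (𝒪 L)
    module 𝒪M = CommutativeRing (𝒪 M)
    module Ω  = CommutativeRing Ω
    module L[X] = PolynomialRing (𝒪 L)
    module ι  = RingHom ι
    module ε  = RingHom ε
    module φ  = Evaluation (to-Ω ∘ʰ 𝒪-hom ι) η
  open Ideals (𝒪 L)
  open CommutativeRing M hiding (zero)
  open Integral M using (IsIntegral; integral-isSubring)
  open IntegralEquation M using (integral-resp)
  open ResidueField (𝒪 L) (𝒪-integral L) pp 𝔭 isPrime over
  open FractionalElement (𝒪-hom ι) 𝔭 K Δ
  open Solver M

  Δ∈𝔭K : Δ ∈ᴵ 𝔭 · K
  Δ∈𝔭K = proj₁ Δ≐𝔭K (gen _)

  Δ∈𝔭 : Δ ∈ᴵ 𝔭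
  Δ∈𝔭 = SquareFactor.span⊆ (𝒪 L) 𝔭
    (λ ((x , x∈) , (k , _)) → Ideal.resp 𝔭 (𝒪L.*-comm k x) (Ideal.*-closed 𝔭 k x∈)) Δ∈𝔭K

  𝔭K⊆Δ : ∀ {x k} → x ∈ᴵ 𝔭 → k ∈ᴵ K → ∃[ y ] x 𝒪L.* k 𝒪L.≈ y 𝒪L.* Δ
  𝔭K⊆Δ {x} {k} x∈ k∈ = principal⇒multiple (𝒪 L) (proj₂ Δ≐𝔭K (gen ((x , x∈) , (k , k∈))))

  D : Carrier
  D = ι.fun (proj₁ Δ)

  -- Irreducibility over M is used here for the first of two times, to divide by Δ; the other is the
  -- independence of the powers of η.
  D≉0 : ¬ D ≈ 0#
  D≉0 = irreducible⇒discriminant≉0 𝐌 (ι ∘ʰ 𝒪-inclusion L)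
    (ℚ-algebra⇒characteristicZero (ι ∘ʰ NumberField.fromℚ 𝐋) (Field.1≉0 𝐌)) {n} {h} monic irreducible

  D⁻¹ : Carrier
  D⁻¹ = proj₁ (Field.invertible 𝐌 D D≉0)

  DD⁻¹≈1 : D * D⁻¹ ≈ 1#
  DD⁻¹≈1 = proj₂ (Field.invertible 𝐌 D D≉0)

  module _ {β : 𝒪M.Carrier} (fractional : Fractional β)
    {z : L[X].Polynomial} (deg-z : L[X].deg z < n) (nontrivial : ∃[ e ] ¬ L[X].coeff z e ∈ᴵ 𝔭)
    {q : L[X].Polynomial} (square : ∀ j → L[X].coeff (z L[X].*ₚ z L[X].+ₚ L[X].-ₚ (q L[X].*ₚ h)) j ∈ᴵ 𝔭) where
    open Fractional fractional

    private
      γ = proj₁ β * D⁻¹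
      d = z L[X].*ₚ z L[X].+ₚ L[X].-ₚ (q L[X].*ₚ h)

    γD≈β : γ * D ≈ proj₁ β
    γD≈β = trans (solve 3 (λ b i d → (b :* i) :* d := b :* (d :* i)) refl (proj₁ β) D⁻¹ D)
      (trans (*-congˡ DD⁻¹≈1) (*-identityʳ _))

    𝔭γ-integral : ∀ {x} → x ∈ᴵ 𝔭 → IsIntegral (ι.fun (proj₁ x) * γ)
    𝔭γ-integral {x} x∈ = let t , eq = 𝔭-multiple x∈ in integral-resp (sym (begin
      ιx * (proj₁ β * D⁻¹)     ≈⟨ *-assoc _ _ _ ⟨
      (ιx * proj₁ β) * D⁻¹     ≈⟨ *-congʳ eq ⟩
      (proj₁ t * D) * D⁻¹      ≈⟨ trans (*-assoc _ _ _) (*-congˡ DD⁻¹≈1) ⟩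
      proj₁ t * 1#             ≈⟨ *-identityʳ _ ⟩
      proj₁ t                  ∎)) (proj₂ t)
      where
      open SetoidReasoning setoid
      ιx = ι.fun (proj₁ x)

    γ²𝔭-integral : ∀ {x} → x ∈ᴵ 𝔭 → IsIntegral ((γ * γ) * ι.fun (proj₁ x))
    γ²𝔭-integral {x} x∈ = let t , eq = square-𝔭-multiple x∈ in integral-resp (sym (begin
      (γ * γ) * ιx
        ≈⟨ solve 3 (λ b i x → ((b :* i) :* (b :* i)) :* x := ((b :* b) :* x) :* (i :* i)) refl (proj₁ β) D⁻¹ ιx ⟩
      ((proj₁ β * proj₁ β) * ιx) * (D⁻¹ * D⁻¹)
        ≈⟨ *-congʳ eq ⟩
      (proj₁ t * (D * D)) * (D⁻¹ * D⁻¹)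
        ≈⟨ solve 3 (λ t d i → (t :* (d :* d)) :* (i :* i) := t :* ((d :* i) :* (d :* i))) refl (proj₁ t) D D⁻¹ ⟩
      proj₁ t * ((D * D⁻¹) * (D * D⁻¹))
        ≈⟨ *-congˡ (trans (*-cong DD⁻¹≈1 DD⁻¹≈1) (*-identityʳ 1#)) ⟩
      proj₁ t * 1#
        ≈⟨ *-identityʳ _ ⟩
      proj₁ t ∎)) (proj₂ t)
      where
      open SetoidReasoning setoid
      ιx = ι.fun (proj₁ x)

    z²≈d : φ.ev d Ω.≈ φ.ev z Ω.* φ.ev z
    z²≈d = Ω.trans (φ.ev-+ (z L[X].*ₚ z) (L[X].-ₚ (q L[X].*ₚ h)))
      (Ω.trans (Ω.+-cong (φ.ev-* z z) (Ω.trans (φ.ev-neg (q L[X].*ₚ h)) (Ω.-‿cong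
        (Ω.trans (φ.ev-* q h) (Ω.trans (Ω.*-congˡ h[η]≈0) (Ω.zeroʳ _))))))
      (Ω.trans (Ω.+-congˡ -0≈0) (Ω.+-identityʳ _)))
      where
      -0≈0 : Ω.- Ω.0# Ω.≈ Ω.0#
      -0≈0 = Ω.trans (Ω.sym (Ω.+-identityˡ _)) (Ω.-‿inverseʳ Ω.0#)

    θ-integral′ : Integral.IsIntegral Ω (ε.fun γ Ω.* φ.ev z)
    θ-integral′ = let f , eq = square-in-𝒪M[η] γ z d (λ j → γ²𝔭-integral (square j)) in
      θ-integral γ z (f , Ω.trans (Ω.*-congˡ (Ω.sym z²≈d)) eq)

    -- A coefficient of `z` outside 𝔭 has an inverse `y` modulo 𝔭, say `zₑ y = 1 + m` with `m` in 𝔭.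
    -- Then `γ = (γ zₑ) y - m γ`, and both terms are integral.
    γ-integral : (∀ e → IsIntegral (γ * ι.fun (proj₁ (L[X].coeff z e)))) → IsIntegral γ
    γ-integral integral = let e , zₑ∉ = nontrivial ; y , zₑy≡1 = invertible-mod zₑ∉ in
      integral-resp (begin
        (γ * ι.fun (proj₁ (L[X].coeff z e))) * ι.fun (proj₁ y) - ι.fun (proj₁ (L[X].coeff z e 𝒪L.* y 𝒪L.- 𝒪L.1#)) * γ
          ≈⟨ +-congˡ (-‿cong (*-congʳ (trans (ι.+-homo _ _) (+-cong (ι.*-homo _ _) (trans (ι.-‿homo _) (-‿cong ι.1#-homo)))))) ⟩
        (γ * ι.fun (proj₁ (L[X].coeff z e))) * ι.fun (proj₁ y) - (ι.fun (proj₁ (L[X].coeff z e)) * ι.fun (proj₁ y) - 1#) * γ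
          ≈⟨ solve 4 (λ g a b o → (g :* a) :* b :- (a :* b :- o) :* g := o :* g) refl
               γ (ι.fun (proj₁ (L[X].coeff z e))) (ι.fun (proj₁ y)) 1# ⟩
        1# * γ
          ≈⟨ *-identityˡ γ ⟩
        γ ∎)
      (+-closed (*-closed (integral e) (proj₂ (𝒪-map ι y))) (-‿closed (𝔭γ-integral zₑy≡1)))
      where
      open SetoidReasoning setoid
      open IsSubring integral-isSubring

    p∣index : ¬ (∃[ t ] β 𝒪M.≈ t 𝒪M.* 𝒪-map ι Δ) → ∀ {index} →
              HasIndex (CommutativeRing.+-abelianGroup 𝒪M⟮η⟯) 𝒪M[η] index → p ∣ index
    p∣index β∤Δ has-index = Cosets.prime∣index 𝒪M⟮η⟯ 𝒪M[η] 𝒪M[η]-isSubgroup pp has-index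
      (multiple∈𝒪M[η] γ z θ-integral′ p (𝔭γ-integral p∈𝔭))
      λ θ∈ → element∈⇒coefficients γ z θ-integral′ deg-z θ∈ λ integral →
        β∤Δ ((γ , γ-integral integral) , sym γD≈β)

proposition3p1 : ∀ {c ℓ : Level}
    (𝐋 : NumberField c ℓ) (let L = NumberField.ring 𝐋)
    (n : ℕ) (h : Polynomials.Polynomial (𝒪 L)) →
    Polynomials.Monic (𝒪 L) n h →
    Polynomials.Irreducible (𝒪 L) h →
    (p : ℕ) → Prime p →
    (𝔭 : Ideals.Ideal (𝒪 L)) → Ideals.IsNonzeroPrime (𝒪 L) 𝔭 → LiesOver (𝒪 L) 𝔭 p →
    Ideals._∣ᴵ_ (𝒪 L) 𝔭 (Ideals.principal (𝒪 L) (Polynomials.discriminant (𝒪 L) n h)) →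
    (𝐌 : Field c ℓ) (let M = Field.ring 𝐌)
    (ι : RingHom L M) → FiniteExtension ι →
    Polynomials.Irreducible M (map (RingHom.fun ι ∘ proj₁) h) →
    (𝛀 : Field c ℓ) (let Ω = Field.ring 𝛀)
    (ε : RingHom M Ω) (η : CommutativeRing.Carrier Ω) →
    CommutativeRing._≈_ Ω (eval Ω (RingHom.fun ε ∘ RingHom.fun ι ∘ proj₁) h η)
    (CommutativeRing.0# Ω) →
    RamifiedIn ι 𝔭 →
    (index : ℕ) →
    HasIndex (CommutativeRing.+-abelianGroup (𝒪 (Field.ring (Simple.M⟮η⟯ 𝛀 ε η))))
    (Simple.𝒪M[η] 𝛀 ε η) index →
    p ∣ index
proposition3p1 𝐋 n h monic _ p pp 𝔭 isPrime over (K , Δ≐𝔭K) 𝐌 ι _ irreducible 𝛀 ε η h[η]≈0 (factorisation , i , 1<e)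
  index has-index = decidable-stable (p ∣? index) λ p∤index →
    nontrivial-square-zero {n} {h} monic Δ∈𝔭 λ (z , deg-z , nontrivial , q , square) →
    -- Cancelling Δ takes place in the field M, where its image is nonzero.
    ¬all-integral 𝔭K⊆Δ {P i} Δ∈𝔭K P²∣𝔭 proper (λ xD≈0 → zero-product (M.trans (M.*-comm _ _) xD≈0) D≉0)
      λ β fractional β∤Δ → p∤index (p∣index fractional {z} deg-z nontrivial {q} square β∤Δ has-index)
  where
  L = NumberField.ring 𝐋
  module M = CommutativeRing (Field.ring 𝐌)
  open Nonmaximality 𝐋 {n} {h} monic pp 𝔭 isPrime over K Δ≐𝔭K 𝐌 ι irreducible 𝛀 ε η h[η]≈0
  open ResidueField (𝒪 L) (𝒪-integral L) pp 𝔭 isPrime over using (nontrivial-square-zero)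
  open FractionalElement (𝒪-hom ι) 𝔭 K (Polynomials.discriminant (𝒪 L) n h) using (¬all-integral)
  open Ideals (𝒪 (Field.ring 𝐌)) using (∏; _^ᴵ_; module IsNonzeroPrime; module PrimeFactorisation)
  open PrimeFactorisation factorisation using (P; e; product) renaming (isPrime to factor-isPrime)
  open IsNonzeroPrime (factor-isPrime i) using (proper)
  open SquareFactor (𝒪 (Field.ring 𝐌)) using (_²∣_; ²∣-resp; ²∣-∏; ²∣-^)
  open Kernel 𝐌 using (zero-product)

  𝔭𝒪M : Ideals.Ideal (𝒪 (Field.ring 𝐌))
  𝔭𝒪M = extend {R = 𝒪 L} {S = 𝒪 (Field.ring 𝐌)} (𝒪-map ι) 𝔭

  P²∣𝔭 : P i ²∣ 𝔭𝒪M
  P²∣𝔭 = ²∣-resp {P i} {𝔭𝒪M} {∏ (λ j → P j ^ᴵ e j)} product (²∣-∏ (λ j → P j ^ᴵ e j) {P i} i (²∣-^ (P i) 1<e))
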